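{- Let $p$ be an odd prime and $D_{2p}=\langle \tau,\sigma\mid \tau^p=\sigma^2=e,\ \sigma\tau\sigma=\tau^{ -1}\rangle$. The number of connected Cayley graphs on $D_{2p}$ up to isomorphism is $\mathcal{N}_1'=\mathcal{N}'-\mathcal{N}_c'-1$, where $$\mathcal{N}'=\frac{1}{p}\left(2^{\frac{p+1}{2}}-2^{\frac{3p-1}{2}}\right)+\frac{2}{p-1}\sum_{i=0}^{p-2}2^{\frac{\gcd(2i,p-1)}{2}+\gcd(i,p-1)},\qquad \mathcal{N}_c'=\frac{2}{p-1}\sum_{d\mid\frac{p-1}{2}}\Phi(d)\,2^{\frac{p-1}{2d}},$$ and $\Phi$ is Euler's totient function.
   Context: For a finite group $G$ and $S\subseteq G$ with $e\notin S$ and $S^{ -1}=S$, the Cayley graph $\mathrm{Cay}(G,S)$ is the undirected graph with vertex set $G$ in which $g,h$ are adjacent whenever $hg^{ -1}\in S$; it is connected iff $\langle S\rangle=G$. Here $\gcd(0,p-1)=p-1$. -}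

module Defs where

open import Data.Nat using (ℕ; zero; suc; _+_; _*_; _∸_; _^_; _/_)
open import Data.Nat.DivMod using (_mod_)
open import Data.Nat.GCD using (gcd)
open import Data.Nat.Divisibility using (_∣?_)
open import Data.Nat.Properties using (_≟_)
open import Data.Fin using (Fin; toℕ)
open import Data.Bool using (Bool; true; false; not)
open import Data.Product using (Σ; _×_; _,_)
open import Data.List using (List; length; map; upTo; filter)
open import Data.Nat.ListAction using (sum)
open import Data.List.Relation.Unary.All using (All)
open import Data.List.Relation.Unary.Any using (Any)
open import Data.List.Relation.Unary.AllPairs using (AllPairs)
open import Data.Integer using (+_)
open import Data.Rational as ℚ using (ℚ; 0ℚ)
open import Relation.Binary.PropositionalEquality using (_≡_)
open import Relation.Nullary using (¬_)

-- The dihedral group D_{2p}, concretely: the pair (a , b) stands for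
-- τ^a σ^b  (a ∈ ℤ/p, b ∈ {0,1}, true = 1).
-- Multiplication: τ^a σ^b · τ^c σ^d = τ^(a + (-1)^b c) σ^(b+d),
-- which realises  τ^p = σ^2 = e,  σ τ σ = τ^{-1}.

D : ℕ → Set
D p = Fin p × Bool

addF : ∀ {p} → Fin p → Fin p → Fin p
addF {suc n} a c = (toℕ a + toℕ c) mod (suc n)

negF : ∀ {p} → Fin p → Fin p
negF {suc n} a = (suc n ∸ toℕ a) mod (suc n)

_·_ : ∀ {p} → D p → D p → D p
(a , false) · (c , d) = (addF a c , d)
(a , true)  · (c , d) = (addF a (negF c) , not d)

inv : ∀ {p} → D p → D p
inv (a , false) = (negF a , false)
inv (a , true)  = (a , true)

Subset : ℕ → Set
Subset p = D p → Bool

ConnectionSet : ∀ {p} → Subset p → Set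
ConnectionSet {p} S =
  ((a : Fin p) → toℕ a ≡ 0 → S (a , false) ≡ false) ×
  ((g : D p) → S (inv g) ≡ S g)

Adj : ∀ {p} → Subset p → D p → D p → Bool
Adj S g h = S (h · inv g)

data Reach {p} (S : Subset p) : D p → D p → Set where
  here : ∀ {g} → Reach S g g
  step : ∀ {g h k} → Adj S g h ≡ true → Reach S h k → Reach S g k

Connected : ∀ {p} → Subset p → Set
Connected {p} S = (g h : D p) → Reach S g h

GraphIso : ∀ {p} → Subset p → Subset p → Set
GraphIso {p} S T =
  Σ (D p → D p) λ f → Σ (D p → D p) λ f' →
    ((x : D p) → f' (f x) ≡ x) × ((x : D p) → f (f' x) ≡ x) ×
    ((g h : D p) → Adj S g h ≡ Adj T (f g) (f h))

ConnCayley : ∀ {p} → Subset p → Set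
ConnCayley S = ConnectionSet S × Connected S

NumConnCayleyUpToIso : ℕ → ℕ → Set
NumConnCayleyUpToIso p N =
  Σ (List (Subset p)) λ L →
    (length L ≡ N) ×
    All ConnCayley L ×
    AllPairs (λ S T → ¬ GraphIso S T) L ×
    ((S : Subset p) → ConnCayley S → Any (GraphIso S) L)

toℚ : ℕ → ℚ
toℚ n = + n ℚ./ 1

-- 1/n (only used for n ≥ 1)
recip : ℕ → ℚ
recip zero    = 0ℚ
recip (suc n) = + 1 ℚ./ suc n

Φ : ℕ → ℕ
Φ n = length (filter (λ k → gcd (suc k) n ≟ 1) (upTo n))

N′ : ℕ → ℚ
N′ p = recip p ℚ.* (toℚ (2 ^ ((p + 1) / 2)) ℚ.- toℚ (2 ^ ((3 * p ∸ 1) / 2)))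
       ℚ.+ toℚ 2 ℚ.* recip (p ∸ 1) ℚ.*
           toℚ (sum (map (λ i → 2 ^ (gcd (2 * i) (p ∸ 1) / 2 + gcd i (p ∸ 1)))
                         (upTo (p ∸ 1))))

-- N_c' = 2/(p-1) Σ_{d ∣ (p-1)/2} Φ(d) 2^((p-1)/(2d));
-- divisors d = suc k with 0 ≤ k < m, m = (p-1)/2, and (p-1)/(2d) = m/d.
Nc′ : ℕ → ℚ
Nc′ p = toℚ 2 ℚ.* recip (p ∸ 1) ℚ.*
        toℚ (sum (map (λ k → Φ (suc k) * 2 ^ (m / suc k))
                      (filter (λ k → suc k ∣? m) (upTo m))))
  where
  m : ℕ
  m = (p ∸ 1) / 2

{-# OPTIONS --safe #-}

-- Write a connection set S as a pair (A, B) of subsets of ℤ/p: the rotations τ^a and the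
-- reflections τ^bσ in S.  The automorphisms τ ↦ τ^κ, σ ↦ τ^γσ act by affine substitutions.
--
-- Isomorphic connected graphs are related by an automorphism.  The group ⟨τ⟩ × D₂ₚ of order 2p² acts
-- by translations on the set of isomorphisms from S to T, and (p being odd) only isomorphisms
-- normalising ⟨τ⟩ have a nontrivial stabiliser; such an isomorphism is an automorphism up to translation.
-- If there were none, 2p² would divide the number of isomorphisms, which is the number of
-- automorphisms of S, hence also the number of automorphisms of S normalising ⟨τ⟩.  But that number is
-- at most 2p(p - 1) when B is neither empty nor full.  If B is full, the isomorphism restricts to one
-- of circulant graphs, and this induces an isomorphism of the prisms over them, where B is a singleton.
--
-- So the connected graphs correspond to the orbits of the affine group on pairs (A, B) with B ≠ ∅ and
-- not both A = ∅ and ∣B∣ = 1.  Burnside's lemma counts them; with a primitive root g of ℤ/p, the pairs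
-- fixed by x ↦ g^i x + c are counted by 2 to the power of the number of orbits of g^i on (ℤ/p)*/±1
-- and of x ↦ g^i x + c on ℤ/p.
module Submission where

open import Defs
open import Data.Bool using (Bool; true; false; not; if_then_else_)
import Data.Bool.Properties as Bool
open import Data.Empty using (⊥; ⊥-elim)
open import Data.Fin using (Fin; toℕ)
import Data.Fin.Properties as Fin
open import Data.List using (List; []; _∷_; _++_; map; foldr; filter; length; upTo; allFin; cartesianProduct; cartesianProductWith)
import Data.List.Properties as List
open import Data.List.Membership.Propositional using (_∈_; lose; find)
open import Data.List.Membership.Propositional.Properties using (∈-map⁺; ∈-map⁻; ∈-filter⁺; ∈-filter⁻; ∈-cartesianProduct⁺; ∈-cartesianProduct⁻; ∈-cartesianProductWith⁺; ∈-allFin; ∈-upTo⁺; ∈-upTo⁻; ∈-length)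
open import Data.List.Relation.Unary.All as All using (All; []; _∷_)
import Data.List.Relation.Unary.All.Properties as All
import Data.List.Relation.Unary.Any.Properties as Any
open import Data.List.Relation.Unary.Any as Any using (Any; here; there)
open import Data.List.Relation.Unary.AllPairs as AllPairs using (AllPairs; []; _∷_)
import Data.List.Relation.Unary.AllPairs.Properties as AllPairs
open import Data.List.Relation.Unary.Unique.Propositional using (Unique)
import Data.List.Relation.Unary.Unique.Propositional.Properties as Unique
open import Data.Nat using (ℕ; zero; suc; _+_; _*_; _∸_; _^_; _/_; _%_; _≤_; _<_; z≤n; s≤s; NonZero; nonTrivial⇒n>1; ≢-nonZero; >-nonZero; ≢-nonZero⁻¹; pred)
open import Data.Nat.DivMod
open import Data.Nat.Divisibility
open import Data.Nat.GCD using (gcd)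
import Data.Nat.GCD as GCD
open import Data.Nat.ListAction using (sum; product)
open import Data.Nat.Primality using (Prime)
import Data.Nat.Primality as Prime
import Data.Nat.Coprimality as Coprime
import Data.Nat.Properties as ℕ
import Data.Nat.Induction as ℕ
open import Data.Nat.Tactic.RingSolver using (solve-∀)
open import Data.Product using (Σ; ∃; _×_; _,_; proj₁; proj₂)
import Data.Product.Properties as Product
open import Data.Sum using (_⊎_; inj₁; inj₂)
open import Data.Vec using (Vec; []; _∷_; lookup; tabulate; replicate; tail)
import Data.Vec.Properties as Vec
open import Function using (_∘_; id)
open import Relation.Binary using (DecidableEquality)
open import Relation.Binary.PropositionalEquality using (_≡_; _≢_; refl; sym; trans; cong; cong₂; subst; setoid; module ≡-Reasoning)
open import Relation.Nullary using (¬_; Dec; yes; no; does; contradiction; ¬?)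
open import Relation.Nullary.Decidable using (_×-dec_; _→-dec_; map′; dec-true; dec-false; decidable-stable)
open import Relation.Unary using (Decidable)
open import Level using (0ℓ)
open import Algebra.Bundles using (CommutativeRing; Group)
open import Algebra.Structures using (IsCommutativeRing)
import Algebra.Properties.CommutativeSemiring.Exp as Exp
import Algebra.Solver.Ring.NaturalCoefficients.Default as SemiringSolver
import Algebra.Properties.Ring as RingProperties
open import Data.List.Membership.Propositional.Properties.WithK using (unique∧set⇒bag)
open import Data.List.Relation.Binary.BagAndSetEquality using (∼bag⇒↭)
open import Data.List.Relation.Binary.Permutation.Propositional using (_↭_; ↭⇒↭ₛ)
import Data.List.Relation.Binary.Permutation.Setoid.Properties as Permutation
open import Function.Bundles using (mk⇔)
open import Data.Nat.Primality.Factorisation using (factorise)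
open import Induction.WellFounded using (Acc; acc)
import Algebra.Properties.AbelianGroup as AbelianGroupProperties
import Data.Integer as ℤ
import Data.Integer.Properties as ℤ
open import Data.Rational as ℚ using (ℚ; 1ℚ; _-_; toℚᵘ)
import Data.Rational.Properties as ℚ
import Data.Rational.Solver as ℚ
open import Data.Rational.Unnormalised as ℚᵘ using (ℚᵘ; mkℚᵘ; *≡*)
import Data.Rational.Unnormalised.Properties as ℚᵘ
open import Relation.Binary.PropositionalEquality.Properties using (isEquivalence)
import Algebra.Properties.Group as GroupProperties

-- Finite sums

-- The origin of the three terms: `N′` is the number of affine orbits on all pairs (A, B) with A
-- symmetric and 0 ∉ A, `Nc′` the number of those with B = ∅, and the last 1 is the orbit with A = ∅
-- and ∣B∣ = 1, a perfect matching. Write p = 2m + 1. For 0 < i < p - 1 each of the p maps x ↦ g^i x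
-- + c fixes 2^gcd(i,m) · 2^(1 + gcd(i,p-1)) pairs. For i = 0 this value is right for the identity
-- only: the p - 1 other translations fix just ∅ and ℤ/p as B. Replacing p · 2^p by 2^p + 2(p - 1)
-- there and dividing by p(p - 1) gives the first summand of `N′`, which is (2^(m+1) - 2^(m+p))/p.
--
-- The obstacle is a constant B: if B is empty or full, the two cosets of ⟨τ⟩ can be translated
-- independently, so at least 2p² automorphisms normalise ⟨τ⟩ and divisibility by 2p² is no
-- contradiction. The matching in a prism ties the two translations together again, which brings
-- circulant graphs back to the nonconstant case.

∑ : ∀ {A : Set} → List A → (A → ℕ) → ℕ
∑ xs f = sum (map f xs)

-- Cardinalities are sums of `𝟙` over duplicate-free lists, which turns double counting into
-- `∑-swap`.
𝟙 : ∀ {P : Set} → Dec P → ℕ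
𝟙 d = if does d then 1 else 0

𝟙-yes : ∀ {P : Set} (d : Dec P) → P → 𝟙 d ≡ 1
𝟙-yes (yes _) _ = refl
𝟙-yes (no ¬p) p = contradiction p ¬p

𝟙-no : ∀ {P : Set} (d : Dec P) → ¬ P → 𝟙 d ≡ 0
𝟙-no (yes p) ¬p = contradiction p ¬p
𝟙-no (no _)  _  = refl

𝟙-cong : ∀ {P Q : Set} (d : Dec P) (e : Dec Q) → (P → Q) → (Q → P) → 𝟙 d ≡ 𝟙 e
𝟙-cong (yes p) e to from = sym (𝟙-yes e (to p))
𝟙-cong (no ¬p) e to from = sym (𝟙-no e (¬p ∘ from))

𝟙-× : ∀ {P Q : Set} (d : Dec P) (e : Dec Q) → 𝟙 (d ×-dec e) ≡ 𝟙 d * 𝟙 e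
𝟙-× (yes _) (yes _) = refl
𝟙-× (yes _) (no _)  = refl
𝟙-× (no _)  _       = refl

private variable
  A B : Set

∑-cong : ∀ (xs : List A) {f g : A → ℕ} → (∀ {x} → x ∈ xs → f x ≡ g x) → ∑ xs f ≡ ∑ xs g
∑-cong []       eq = refl
∑-cong (x ∷ xs) eq = cong₂ _+_ (eq (here refl)) (∑-cong xs (eq ∘ there))

∑-cong′ : ∀ (xs : List A) {f g : A → ℕ} → (∀ x → f x ≡ g x) → ∑ xs f ≡ ∑ xs g
∑-cong′ xs eq = ∑-cong xs (λ {x} _ → eq x)

∑-+ : ∀ (xs : List A) (f g : A → ℕ) → ∑ xs (λ x → f x + g x) ≡ ∑ xs f + ∑ xs g
∑-+ []       f g = refl
∑-+ (x ∷ xs) f g rewrite ∑-+ xs f g = lemma (f x) (g x) (∑ xs f) (∑ xs g)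
  where
  lemma : ∀ a b c d → a + b + (c + d) ≡ a + c + (b + d)
  lemma = solve-∀

∑-*ˡ : ∀ (xs : List A) (c : ℕ) (f : A → ℕ) → ∑ xs (λ x → c * f x) ≡ c * ∑ xs f
∑-*ˡ []       c f = sym (ℕ.*-zeroʳ c)
∑-*ˡ (x ∷ xs) c f rewrite ∑-*ˡ xs c f = sym (ℕ.*-distribˡ-+ c (f x) (∑ xs f))

∑-*ʳ : ∀ (xs : List A) (c : ℕ) (f : A → ℕ) → ∑ xs (λ x → f x * c) ≡ ∑ xs f * c
∑-*ʳ xs c f = trans (∑-cong′ xs (λ x → ℕ.*-comm (f x) c)) (trans (∑-*ˡ xs c f) (ℕ.*-comm c _))

∑-const : ∀ (xs : List A) (c : ℕ) → ∑ xs (λ _ → c) ≡ length xs * c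
∑-const []       c = refl
∑-const (x ∷ xs) c = cong (c +_) (∑-const xs c)

∑-1 : ∀ (xs : List A) → ∑ xs (λ _ → 1) ≡ length xs
∑-1 xs = trans (∑-const xs 1) (ℕ.*-identityʳ _)

∑-zero : ∀ (xs : List A) {f : A → ℕ} → (∀ {x} → x ∈ xs → f x ≡ 0) → ∑ xs f ≡ 0
∑-zero xs eq = trans (∑-cong xs eq) (trans (∑-const xs 0) (ℕ.*-zeroʳ (length xs)))

∑-swap : ∀ (xs : List A) (ys : List B) (f : A → B → ℕ) →
         ∑ xs (λ x → ∑ ys (f x)) ≡ ∑ ys (λ y → ∑ xs (λ x → f x y))
∑-swap []       ys f = sym (∑-zero ys (λ _ → refl))
∑-swap (x ∷ xs) ys f = trans (cong (∑ ys (f x) +_) (∑-swap xs ys f)) (sym (∑-+ ys (f x) _))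

∑-map : ∀ (h : A → B) (xs : List A) (f : B → ℕ) → ∑ (map h xs) f ≡ ∑ xs (f ∘ h)
∑-map h xs f = cong sum (sym (List.map-∘ xs))

∑-++ : ∀ (xs ys : List A) (f : A → ℕ) → ∑ (xs ++ ys) f ≡ ∑ xs f + ∑ ys f
∑-++ []       ys f = refl
∑-++ (x ∷ xs) ys f = trans (cong (f x +_) (∑-++ xs ys f)) (sym (ℕ.+-assoc (f x) _ _))

∑-cartesianProduct : ∀ (xs : List A) (ys : List B) (f : A × B → ℕ) →
                     ∑ (cartesianProduct xs ys) f ≡ ∑ xs (λ x → ∑ ys (λ y → f (x , y)))
∑-cartesianProduct []       ys f = refl
∑-cartesianProduct (x ∷ xs) ys f =
  trans (∑-++ (map (x ,_) ys) _ f) (cong₂ _+_ (∑-map (x ,_) ys f) (∑-cartesianProduct xs ys f))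

∑-filter : ∀ {P : A → Set} (P? : Decidable P) (xs : List A) (f : A → ℕ) →
           ∑ (filter P? xs) f ≡ ∑ xs (λ x → 𝟙 (P? x) * f x)
∑-filter P? []       f = refl
∑-filter P? (x ∷ xs) f with P? x
... | yes _ = cong₂ _+_ (sym (ℕ.+-identityʳ (f x))) (∑-filter P? xs f)
... | no  _ = ∑-filter P? xs f

length-filter : ∀ {P : A → Set} (P? : Decidable P) (xs : List A) →
                length (filter P? xs) ≡ ∑ xs (𝟙 ∘ P?)
length-filter P? xs = trans (sym (∑-1 (filter P? xs)))
  (trans (∑-filter P? xs _) (∑-cong′ xs (λ x → ℕ.*-identityʳ _)))

∑-mono-≤ : ∀ (xs : List A) {f g : A → ℕ} → (∀ {x} → x ∈ xs → f x ≤ g x) → ∑ xs f ≤ ∑ xs g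
∑-mono-≤ []       le = z≤n
∑-mono-≤ (x ∷ xs) le = ℕ.+-mono-≤ (le (here refl)) (∑-mono-≤ xs (le ∘ there))

module _ (_≟_ : DecidableEquality A) where

  ∑-indicator : ∀ {xs : List A} {a} → Unique xs → a ∈ xs → (f : A → ℕ) →
                ∑ xs (λ x → 𝟙 (a ≟ x) * f x) ≡ f a
  ∑-indicator {a = a} (a∉ ∷ uq) (here refl) f rewrite 𝟙-yes (a ≟ a) refl =
    trans (cong₂ _+_ (ℕ.+-identityʳ (f a))
                     (∑-zero _ (λ x∈ → cong (_* f _) (𝟙-no (a ≟ _) (All.lookup a∉ x∈)))))
          (ℕ.+-identityʳ (f a))
  ∑-indicator {x ∷ xs} {a} (x∉ ∷ uq) (there a∈) f
    rewrite 𝟙-no (a ≟ x) (λ { refl → All.lookup x∉ a∈ refl }) = ∑-indicator uq a∈ f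

  ∑-indicator-1 : ∀ {xs : List A} {a} → Unique xs → a ∈ xs → ∑ xs (λ x → 𝟙 (a ≟ x)) ≡ 1
  ∑-indicator-1 {xs} uq a∈ =
    trans (∑-cong′ xs (λ x → sym (ℕ.*-identityʳ _))) (∑-indicator uq a∈ (λ _ → 1))

module _ (_≟A_ : DecidableEquality A) (_≟B_ : DecidableEquality B) where

  -- Double count of the pairs with f x = y, which are also the pairs with g y = x. No permutation
  -- of lists is involved.
  ∑-bijection : ∀ {xs : List A} {ys : List B} → Unique xs → Unique ys →
    (f : A → B) (g : B → A) →
    (∀ {x} → x ∈ xs → f x ∈ ys) → (∀ {y} → y ∈ ys → g y ∈ xs) →
    (∀ {x} → x ∈ xs → g (f x) ≡ x) → (∀ {y} → y ∈ ys → f (g y) ≡ y) →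
    (h : B → ℕ) → ∑ xs (h ∘ f) ≡ ∑ ys h
  ∑-bijection {xs} {ys} uxs uys f g f∈ g∈ gf fg h = begin
    ∑ xs (h ∘ f)
      ≡⟨ ∑-cong xs (λ x∈ → sym (∑-indicator _≟B_ uys (f∈ x∈) h)) ⟩
    ∑ xs (λ x → ∑ ys (λ y → 𝟙 (f x ≟B y) * h y))
      ≡⟨ ∑-swap xs ys _ ⟩
    ∑ ys (λ y → ∑ xs (λ x → 𝟙 (f x ≟B y) * h y))
      ≡⟨ ∑-cong ys (λ {y} y∈ → ∑-cong xs (λ {x} x∈ → cong (_* h y)
           (𝟙-cong (f x ≟B y) (g y ≟A x) (λ { refl → gf x∈ }) (λ { refl → fg y∈ })))) ⟩
    ∑ ys (λ y → ∑ xs (λ x → 𝟙 (g y ≟A x) * h y))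
      ≡⟨ ∑-cong ys (λ {y} y∈ → ∑-indicator _≟A_ uxs (g∈ y∈) (λ _ → h y)) ⟩
    ∑ ys h ∎
    where open ≡-Reasoning

  -- The same double count: each x occurs in exactly one pair, each y in at most one.
  length-injection : ∀ {xs : List A} {ys : List B} → Unique xs → Unique ys →
    (f : A → B) → (∀ {x} → x ∈ xs → f x ∈ ys) →
    (∀ {x x'} → x ∈ xs → x' ∈ xs → f x ≡ f x' → x ≡ x') →
    length xs ≤ length ys
  length-injection {xs} {ys} uxs uys f f∈ inj = begin
    length xs                                   ≡⟨ ∑-1 xs ⟨
    ∑ xs (λ _ → 1)                              ≡⟨ ∑-cong xs (λ x∈ → sym (∑-indicator-1 _≟B_ uys (f∈ x∈))) ⟩
    ∑ xs (λ x → ∑ ys (λ y → 𝟙 (f x ≟B y)))      ≡⟨ ∑-swap xs ys _ ⟩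
    ∑ ys (λ y → ∑ xs (λ x → 𝟙 (f x ≟B y)))      ≤⟨ ∑-mono-≤ ys (λ {y} _ → fibre xs uxs y inj) ⟩
    ∑ ys (λ _ → 1)                              ≡⟨ ∑-1 ys ⟩
    length ys                                   ∎
    where
    open ℕ.≤-Reasoning
    fibre : ∀ zs → Unique zs → ∀ y → (∀ {x x'} → x ∈ zs → x' ∈ zs → f x ≡ f x' → x ≡ x') →
            ∑ zs (λ x → 𝟙 (f x ≟B y)) ≤ 1
    fibre []       _          y _   = z≤n
    fibre (z ∷ zs) (z∉ ∷ uzs) y inj with f z ≟B y
    ... | no  _    = fibre zs uzs y (λ x∈ x'∈ → inj (there x∈) (there x'∈))
    ... | yes refl = ℕ.≤-reflexive (cong suc (∑-zero zs (λ {x} x∈ → 𝟙-no (f x ≟B f z)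
          (λ eq → All.lookup z∉ x∈ (inj (here refl) (there x∈) (sym eq))))))

-- Orbit counting

-- Used twice: for affine maps acting on pairs of subsets, and for translations acting on graph
-- isomorphisms. The group enters the counting through `∑-translate`, the invariance of sums under
-- right translation.
module Burnside
  {X G : Set} (_≟_ : DecidableEquality X)
  (gs : List G) (act : G → X → X) (_∙_ : G → G → G) (ε : G) (_⁻¹ : G → G)
  (ε∈ : ε ∈ gs)
  (∙-closed : ∀ {g h} → g ∈ gs → h ∈ gs → (g ∙ h) ∈ gs)
  (⁻¹-closed : ∀ {g} → g ∈ gs → (g ⁻¹) ∈ gs)
  (act-ε : ∀ x → act ε x ≡ x)
  (act-∙ : ∀ g h x → act (g ∙ h) x ≡ act g (act h x))
  (act-⁻¹ : ∀ {g} → g ∈ gs → ∀ x → act (g ⁻¹) (act g x) ≡ x)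
  (∑-translate : ∀ {g} → g ∈ gs → (f : G → ℕ) → ∑ gs (λ h → f (h ∙ g)) ≡ ∑ gs f)
  where

  _~_ : X → X → Set
  x ~ y = ∃ λ g → g ∈ gs × act g x ≡ y

  _~?_ : ∀ x y → Dec (x ~ y)
  x ~? y = map′ find (λ (g , g∈ , eq) → lose g∈ eq) (Any.any? (λ g → act g x ≟ y) gs)

  ~-refl : ∀ {x} → x ~ x
  ~-refl {x} = ε , ε∈ , act-ε x

  ~-sym : ∀ {x y} → x ~ y → y ~ x
  ~-sym (g , g∈ , refl) = g ⁻¹ , ⁻¹-closed g∈ , act-⁻¹ g∈ _

  ~-trans : ∀ {x y z} → x ~ y → y ~ z → x ~ z
  ~-trans (g , g∈ , refl) (h , h∈ , refl) = h ∙ g , ∙-closed h∈ g∈ , act-∙ h g _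

  stab : X → ℕ
  stab x = ∑ gs (λ g → 𝟙 (act g x ≟ x))

  Closed : List X → Set
  Closed xs = ∀ {x g} → g ∈ gs → x ∈ xs → act g x ∈ xs

  -- Right translation by an `h` with `act h x ≡ y` carries the stabiliser of `y` onto the set of
  -- all elements taking `x` to `y`.
  transporters : ∀ {x y} → x ~ y → ∑ gs (λ g → 𝟙 (act g x ≟ y)) ≡ stab y
  transporters {x} {y} (h , h∈ , eq) = sym (begin
    ∑ gs (λ g → 𝟙 (act g y ≟ y))        ≡⟨ ∑-cong′ gs (λ g → 𝟙-cong (act g y ≟ y) (act (g ∙ h) x ≟ y)
                                             (trans (lemma g)) (trans (sym (lemma g)))) ⟩
    ∑ gs (λ g → 𝟙 (act (g ∙ h) x ≟ y))  ≡⟨ ∑-translate h∈ (λ g → 𝟙 (act g x ≟ y)) ⟩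
    ∑ gs (λ g → 𝟙 (act g x ≟ y))        ∎)
    where
    open ≡-Reasoning
    lemma : ∀ g → act (g ∙ h) x ≡ act g y
    lemma g = trans (act-∙ g h x) (cong (act g) eq)

  -- Sorts the group by the image of `x`: each point of the orbit receives as many elements as its
  -- stabiliser has, any other point none. The weights stay inside the sum because Burnside's lemma
  -- needs exactly this sum over one orbit.
  orbit-stabiliser : ∀ {xs x} → Unique xs → Closed xs → x ∈ xs →
                     ∑ xs (λ y → 𝟙 (x ~? y) * stab y) ≡ length gs
  orbit-stabiliser {xs} {x} uq cl x∈ = begin
    ∑ xs (λ y → 𝟙 (x ~? y) * stab y)               ≡⟨ ∑-cong′ xs (λ y → step₁ y (x ~? y)) ⟩
    ∑ xs (λ y → ∑ gs (λ g → 𝟙 (act g x ≟ y)))      ≡⟨ ∑-swap xs gs _ ⟩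
    ∑ gs (λ g → ∑ xs (λ y → 𝟙 (act g x ≟ y)))      ≡⟨ ∑-cong gs (λ g∈ → ∑-indicator-1 _≟_ uq (cl g∈ x∈)) ⟩
    ∑ gs (λ _ → 1)                                 ≡⟨ ∑-1 gs ⟩
    length gs                                      ∎
    where
    open ≡-Reasoning
    step₁ : ∀ y (d : Dec (x ~ y)) → 𝟙 d * stab y ≡ ∑ gs (λ g → 𝟙 (act g x ≟ y))
    step₁ y (yes x~y) = trans (ℕ.+-identityʳ _) (sym (transporters x~y))
    step₁ y (no  x≁y) = sym (∑-zero gs (λ g∈ → 𝟙-no (_ ≟ y) (λ eq → x≁y (_ , g∈ , eq))))

  -- `count` is Burnside's lemma with the fixed pairs still summed by point instead of by group
  -- element.
  record Transversal (xs : List X) : Set where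
    field
      reps     : List X
      reps⊆    : All (_∈ xs) reps
      distinct : AllPairs (λ x y → ¬ (x ~ y)) reps
      covers   : ∀ {x} → x ∈ xs → Any (x ~_) reps
      count    : ∑ xs stab ≡ length gs * length reps

  -- Each round removes the whole orbit of the head, so the recursion is on the length. By
  -- `orbit-stabiliser` the removed orbit contributes exactly `length gs` to the sum of stabilisers.
  transversal : ∀ xs → Unique xs → Closed xs → Transversal xs
  transversal xs uq cl = go xs uq cl (ℕ.<-wellFounded (length xs))
    where
    go : ∀ xs → Unique xs → Closed xs → Acc _<_ (length xs) → Transversal xs
    go [] uq cl _ = record
      { reps = [] ; reps⊆ = [] ; distinct = [] ; covers = λ () ; count = sym (ℕ.*-zeroʳ (length gs)) }
    go xs@(x ∷ xs') uq cl (acc rs) = record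
      { reps     = x ∷ reps
      ; reps⊆    = here refl ∷ All.map (λ y∈ → proj₁ (∈-filter⁻ other? y∈)) reps⊆
      ; distinct = All.map (λ y∈ → proj₂ (∈-filter⁻ other? {xs = xs} y∈)) reps⊆ ∷ distinct
      ; covers   = cov
      ; count    = cnt
      }
      where
      other? : ∀ y → Dec (¬ (x ~ y))
      other? y = ¬? (x ~? y)
      rest : List X
      rest = filter other? xs
      rest-closed : Closed rest
      rest-closed g∈ y∈ with ∈-filter⁻ other? {xs = xs} y∈
      ... | y∈xs , x≁y = ∈-filter⁺ other? (cl g∈ y∈xs) (λ x~gy → x≁y (~-trans x~gy (~-sym (_ , g∈ , refl))))
      shorter : length rest < length xs
      shorter = List.filter-notAll other? xs (here (λ x≁x → x≁x ~-refl))
      open Transversal (go rest (Unique.filter⁺ other? uq) rest-closed (rs shorter))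
      cov : ∀ {y} → y ∈ xs → Any (y ~_) (x ∷ reps)
      cov {y} y∈ with x ~? y
      ... | yes x~y = here (~-sym x~y)
      ... | no  x≁y = there (covers (∈-filter⁺ other? y∈ x≁y))
      split : ∀ y (d : Dec (x ~ y)) → stab y ≡ 𝟙 d * stab y + 𝟙 (¬? d) * stab y
      split y (yes _) = sym (trans (ℕ.+-identityʳ _) (ℕ.+-identityʳ _))
      split y (no  _) = sym (ℕ.+-identityʳ _)
      open ≡-Reasoning
      cnt : ∑ xs stab ≡ length gs * suc (length reps)
      cnt = begin
        ∑ xs stab                                         ≡⟨ ∑-cong′ xs (λ y → split y (x ~? y)) ⟩
        ∑ xs (λ y → 𝟙 (x ~? y) * stab y + 𝟙 (other? y) * stab y) ≡⟨ ∑-+ xs (λ y → 𝟙 (x ~? y) * stab y) (λ y → 𝟙 (other? y) * stab y) ⟩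
        ∑ xs (λ y → 𝟙 (x ~? y) * stab y) + ∑ xs (λ y → 𝟙 (other? y) * stab y)
          ≡⟨ cong₂ _+_ (orbit-stabiliser uq cl (here refl)) (sym (∑-filter other? xs stab)) ⟩
        length gs + ∑ rest stab                           ≡⟨ cong (length gs +_) count ⟩
        length gs + length gs * length reps               ≡⟨ ℕ.*-suc (length gs) _ ⟨
        length gs * suc (length reps)                     ∎

-- The prime field ℤ/p on Fin p

module Residues (n : ℕ) where

  private
    p : ℕ
    p = suc n

  F : Set
  F = Fin p

  [_] : ℕ → F
  [ k ] = k mod p

  toℕ-[] : ∀ k → toℕ [ k ] ≡ k % p
  toℕ-[] k = Fin.toℕ-fromℕ< (m%n<n k p)

  []-cong : ∀ j k → j % p ≡ k % p → [ j ] ≡ [ k ]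
  []-cong j k eq = Fin.toℕ-injective (trans (toℕ-[] j) (trans eq (sym (toℕ-[] k))))

  []-toℕ : ∀ a → [ toℕ a ] ≡ a
  []-toℕ a = Fin.toℕ-injective (trans (toℕ-[] (toℕ a)) (m<n⇒m%n≡m (Fin.toℕ<n a)))

  infixl 6 _⊕_
  infixl 7 _⊗_
  infix  8 ⊖_

  -- Addition and negation are the operations of the dihedral group's definition, so that
  -- `AgreesWithDefs` holds by `refl`.
  _⊕_ _⊗_ : F → F → F
  a ⊕ b = addF a b
  a ⊗ b = [ toℕ a * toℕ b ]

  ⊖_ : F → F
  ⊖ a = negF a

  0F 1F : F
  0F = [ 0 ]
  1F = [ 1 ]

  []-+ : ∀ j k → [ j ] ⊕ [ k ] ≡ [ j + k ]
  []-+ j k rewrite toℕ-[] j | toℕ-[] k = []-cong (j % p + k % p) (j + k) (sym (%-distribˡ-+ j k p))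

  []-* : ∀ j k → [ j ] ⊗ [ k ] ≡ [ j * k ]
  []-* j k rewrite toℕ-[] j | toℕ-[] k = []-cong (j % p * (k % p)) (j * k) (sym (%-distribˡ-* j k p))

  []-p : ∀ k → [ k + p ] ≡ [ k ]
  []-p k = []-cong (k + p) k ([m+n]%n≡m%n k p)

  private
    lift : ∀ (P : F → Set) → (∀ k → P [ k ]) → ∀ a → P a
    lift P h a = subst P ([]-toℕ a) (h (toℕ a))

    lift₂ : ∀ (P : F → F → Set) → (∀ j k → P [ j ] [ k ]) → ∀ a b → P a b
    lift₂ P h a b = lift (λ a → P a b) (λ j → lift (P [ j ]) (h j) b) a

    lift₃ : ∀ (P : F → F → F → Set) → (∀ i j k → P [ i ] [ j ] [ k ]) → ∀ a b c → P a b c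
    lift₃ P h a b c = lift (λ a → P a b c) (λ i → lift₂ (P [ i ]) (h i) b c) a

    ⊕-assoc : ∀ a b c → (a ⊕ b) ⊕ c ≡ a ⊕ (b ⊕ c)
    ⊕-assoc = lift₃ _ λ i j k → trans (cong (_⊕ [ k ]) ([]-+ i j)) (trans ([]-+ (i + j) k)
      (trans (cong [_] (ℕ.+-assoc i j k)) (sym (trans (cong ([ i ] ⊕_) ([]-+ j k)) ([]-+ i (j + k))))))

    ⊕-comm : ∀ a b → a ⊕ b ≡ b ⊕ a
    ⊕-comm a b = cong [_] (ℕ.+-comm (toℕ a) (toℕ b))

    ⊕-identityˡ : ∀ a → 0F ⊕ a ≡ a
    ⊕-identityˡ a = []-toℕ a

    ⊗-assoc : ∀ a b c → (a ⊗ b) ⊗ c ≡ a ⊗ (b ⊗ c)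
    ⊗-assoc = lift₃ _ λ i j k → trans (cong (_⊗ [ k ]) ([]-* i j)) (trans ([]-* (i * j) k)
      (trans (cong [_] (ℕ.*-assoc i j k)) (sym (trans (cong ([ i ] ⊗_) ([]-* j k)) ([]-* i (j * k))))))

    ⊗-comm : ∀ a b → a ⊗ b ≡ b ⊗ a
    ⊗-comm a b = cong [_] (ℕ.*-comm (toℕ a) (toℕ b))

    ⊗-identityˡ : ∀ a → 1F ⊗ a ≡ a
    ⊗-identityˡ = lift _ λ k → trans ([]-* 1 k) (cong [_] (ℕ.*-identityˡ k))

    ⊗-distribˡ-⊕ : ∀ a b c → a ⊗ (b ⊕ c) ≡ a ⊗ b ⊕ a ⊗ c
    ⊗-distribˡ-⊕ = lift₃ _ λ i j k → trans (cong ([ i ] ⊗_) ([]-+ j k)) (trans ([]-* i (j + k))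
      (trans (cong [_] (ℕ.*-distribˡ-+ i j k)) (sym (trans (cong₂ _⊕_ ([]-* i j) ([]-* i k)) ([]-+ (i * j) (i * k))))))

    ⊖-inverseˡ : ∀ a → ⊖ a ⊕ a ≡ 0F
    ⊖-inverseˡ a = begin
      [ p ∸ toℕ a ] ⊕ a           ≡⟨ cong (⊖ a ⊕_) ([]-toℕ a) ⟨
      [ p ∸ toℕ a ] ⊕ [ toℕ a ]   ≡⟨ []-+ (p ∸ toℕ a) (toℕ a) ⟩
      [ p ∸ toℕ a + toℕ a ]       ≡⟨ cong [_] (ℕ.m∸n+n≡m (ℕ.<⇒≤ (Fin.toℕ<n a))) ⟩
      [ p ]                       ≡⟨ []-p 0 ⟩
      0F                          ∎
      where open ≡-Reasoning

  isCommutativeRing : IsCommutativeRing _≡_ _⊕_ _⊗_ ⊖_ 0F 1F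
  isCommutativeRing = record
    { isRing = record
      { +-isAbelianGroup = record
        { isGroup = record
          { isMonoid = record
            { isSemigroup = record
              { isMagma = record { isEquivalence = isEquivalence ; ∙-cong = cong₂ _⊕_ }
              ; assoc = ⊕-assoc }
            ; identity = comm∧idˡ⇒id ⊕-comm ⊕-identityˡ }
          ; inverse = comm∧invˡ⇒inv ⊕-comm ⊖-inverseˡ
          ; ⁻¹-cong = cong ⊖_ }
        ; comm = ⊕-comm }
      ; *-cong = cong₂ _⊗_
      ; *-assoc = ⊗-assoc
      ; *-identity = comm∧idˡ⇒id ⊗-comm ⊗-identityˡ
      ; distrib = ⊗-distribˡ-⊕ , λ a b c → trans (⊗-comm (b ⊕ c) a)
          (trans (⊗-distribˡ-⊕ a b c) (cong₂ _⊕_ (⊗-comm a b) (⊗-comm a c))) }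
    ; *-comm = ⊗-comm }
    where
    open import Algebra.Consequences.Propositional using (comm∧idˡ⇒id; comm∧invˡ⇒inv)

  residueRing : CommutativeRing 0ℓ 0ℓ
  residueRing = record { isCommutativeRing = isCommutativeRing }

  module _ (pr : Prime p) where

    1F≢0F : 1F ≢ 0F
    1F≢0F eq with trans (sym (m<n⇒m%n≡m (nonTrivial⇒n>1 p {{Prime.prime⇒nonTrivial pr}})))
                        (trans (sym (toℕ-[] 1)) (trans (cong toℕ eq) (toℕ-[] 0)))
    ... | ()

    inverse : ∀ a → a ≢ 0F → ∃ λ b → a ⊗ b ≡ 1F
    inverse a a≢0 with Coprime.coprime-Bézout {toℕ a} {p} (Coprime.sym (Coprime.prime⇒coprime pr {{nz}} (Fin.toℕ<n a)))
      where
      nz : NonZero (toℕ a)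
      nz = ≢-nonZero (λ eq → a≢0 (trans (sym ([]-toℕ a)) (cong [_] eq)))
    ... | GCD.Bézout.+- x y eq = [ x ] , (begin
        a ⊗ [ x ]             ≡⟨ cong (_⊗ [ x ]) ([]-toℕ a) ⟨
        [ toℕ a ] ⊗ [ x ]     ≡⟨ []-* (toℕ a) x ⟩
        [ toℕ a * x ]         ≡⟨ cong [_] (ℕ.*-comm (toℕ a) x) ⟩
        [ x * toℕ a ]         ≡⟨ cong [_] eq ⟨
        [ 1 + y * p ]         ≡⟨ []-cong (1 + y * p) 1 ([m+kn]%n≡m%n 1 y p) ⟩
        1F                    ∎)
      where open ≡-Reasoning
    -- Here 1 + x a is a multiple of p, so x is the inverse up to the sign that `⊖ 1F` repairs.
    ... | GCD.Bézout.-+ x y eq = [ x ] ⊗ ⊖ 1F , (begin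
        a ⊗ ([ x ] ⊗ ⊖ 1F)         ≡⟨ ⊗-assoc a [ x ] (⊖ 1F) ⟨
        a ⊗ [ x ] ⊗ ⊖ 1F           ≡⟨ cong (_⊗ ⊖ 1F) minus ⟩
        ⊖ 1F ⊗ ⊖ 1F                ≡⟨ -1*-1 ⟩
        1F                         ∎)
      where
      open ≡-Reasoning
      open RingProperties (CommutativeRing.ring residueRing) using (-1*x≈-x; -‿involutive; +-inverseʳ-unique)
      -1*-1 : ⊖ 1F ⊗ ⊖ 1F ≡ 1F
      -1*-1 = trans (-1*x≈-x (⊖ 1F)) (-‿involutive 1F)
      minus : a ⊗ [ x ] ≡ ⊖ 1F
      minus = +-inverseʳ-unique 1F (a ⊗ [ x ]) (begin
        1F ⊕ a ⊗ [ x ]               ≡⟨ cong (λ a → 1F ⊕ a ⊗ [ x ]) ([]-toℕ a) ⟨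
        1F ⊕ [ toℕ a ] ⊗ [ x ]       ≡⟨ cong (1F ⊕_) ([]-* (toℕ a) x) ⟩
        [ 1 ] ⊕ [ toℕ a * x ]        ≡⟨ []-+ 1 (toℕ a * x) ⟩
        [ 1 + toℕ a * x ]            ≡⟨ cong (λ j → [ 1 + j ]) (ℕ.*-comm (toℕ a) x) ⟩
        [ 1 + x * toℕ a ]            ≡⟨ cong [_] eq ⟩
        [ y * p ]                    ≡⟨ []-cong (y * p) 0 ([m+kn]%n≡m%n 0 y p) ⟩
        0F                           ∎)

    -- A nonzero `c` generates the additive group: `y` is `x` plus `(y ⊕ ⊖ x) ⊗ c⁻¹` copies of `c`.
    -- In this form the prime order of ⟨τ⟩ is used later: what one nontrivial rotation preserves,
    -- all rotations preserve.
    translate-induction : ∀ {c} → c ≢ 0F → (P : F → Set) → (∀ x → P x → P (x ⊕ c)) → ∀ x y → P x → P y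
    translate-induction {c} c≢0 P next x y Px = subst P reach (multiples (toℕ ((y ⊕ ⊖ x) ⊗ c⁻¹)))
      where
      open CommutativeRing residueRing using (distribʳ; +-assoc; +-comm; *-assoc; *-comm; *-identityˡ; *-identityʳ; zeroˡ; +-identityʳ)
      open AbelianGroupProperties (CommutativeRing.+-abelianGroup residueRing) using (xyx⁻¹≈y)
      open ≡-Reasoning
      c⁻¹ : F
      c⁻¹ = proj₁ (inverse c c≢0)
      multiples : ∀ k → P (x ⊕ [ k ] ⊗ c)
      multiples zero    = subst P (sym (trans (cong (x ⊕_) (zeroˡ c)) (+-identityʳ x))) Px
      multiples (suc k) = subst P (begin
        x ⊕ [ k ] ⊗ c ⊕ c            ≡⟨ +-assoc x ([ k ] ⊗ c) c ⟩
        x ⊕ ([ k ] ⊗ c ⊕ c)          ≡⟨ cong (λ e → x ⊕ ([ k ] ⊗ c ⊕ e)) (*-identityˡ c) ⟨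
        x ⊕ ([ k ] ⊗ c ⊕ 1F ⊗ c)     ≡⟨ cong (x ⊕_) (distribʳ c [ k ] 1F) ⟨
        x ⊕ ([ k ] ⊕ [ 1 ]) ⊗ c      ≡⟨ cong (λ e → x ⊕ e ⊗ c) (trans ([]-+ k 1) (cong [_] (ℕ.+-comm k 1))) ⟩
        x ⊕ [ suc k ] ⊗ c            ∎) (next _ (multiples k))
      reach : x ⊕ [ toℕ ((y ⊕ ⊖ x) ⊗ c⁻¹) ] ⊗ c ≡ y
      reach = begin
        x ⊕ [ toℕ ((y ⊕ ⊖ x) ⊗ c⁻¹) ] ⊗ c  ≡⟨ cong (λ e → x ⊕ e ⊗ c) ([]-toℕ ((y ⊕ ⊖ x) ⊗ c⁻¹)) ⟩
        x ⊕ (y ⊕ ⊖ x) ⊗ c⁻¹ ⊗ c            ≡⟨ cong (x ⊕_) (*-assoc (y ⊕ ⊖ x) c⁻¹ c) ⟩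
        x ⊕ (y ⊕ ⊖ x) ⊗ (c⁻¹ ⊗ c)          ≡⟨ cong (λ e → x ⊕ (y ⊕ ⊖ x) ⊗ e) (trans (*-comm c⁻¹ c) (proj₂ (inverse c c≢0))) ⟩
        x ⊕ (y ⊕ ⊖ x) ⊗ 1F                 ≡⟨ cong (x ⊕_) (*-identityʳ (y ⊕ ⊖ x)) ⟩
        x ⊕ (y ⊕ ⊖ x)                      ≡⟨ +-assoc x y (⊖ x) ⟨
        x ⊕ y ⊕ ⊖ x                        ≡⟨ xyx⁻¹≈y x y ⟩
        y                                  ∎

-- The multiplicative group of a finite field is cyclic

-- `E` is meant for the exponents that act trivially. Bézout over ℕ reads gcd + multiple = multiple,
-- so `cancel` stands in for subtraction. Serves both the orders of field elements and the
-- invariance of subsets under powers of g.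
gcd-closed : (E : ℕ → Set) → (∀ q {j} → E j → E (q * j)) → (∀ {d u} → E (d + u) → E u → E d) →
             ∀ i j → E i → E j → E (gcd i j)
gcd-closed E multiple cancel i j Ei Ej with GCD.Bézout.identity (GCD.gcd-GCD i j)
... | GCD.Bézout.+- x y eq = cancel (subst E (sym eq) (multiple x Ei)) (multiple y Ej)
... | GCD.Bézout.-+ x y eq = cancel (subst E (sym eq) (multiple y Ej)) (multiple x Ei)

prime∤⇒coprime : ∀ {q i} → Prime q → ¬ q ∣ i → Coprime.Coprime i q
prime∤⇒coprime pr q∤i (j∣i , j∣q) with Prime.prime⇒irreducible pr j∣q
... | inj₁ j≡1  = j≡1
... | inj₂ refl = contradiction j∣i q∤i

-- Pins down orders that are powers of q: if z^k = 1 and z^(q^(r+1)) = 1, apply it to gcd(k,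
-- q^(r+1)). Either z^(q^r) = 1, or q^(r+1) divides k.
∣-prime-power : ∀ {q} → Prime q → ∀ r {g} → g ∣ q ^ suc r → g ∣ q ^ r ⊎ q ^ suc r ∣ g
∣-prime-power {q} pr r {g} g∣ with q ∣? g
... | no q∤g = inj₁ (Coprime.coprime-divisor (prime∤⇒coprime pr q∤g) g∣)
∣-prime-power {q} pr r {g} g∣ | yes (divides g' refl) = go r g∣
  where
  instance _ = Prime.prime⇒nonZero pr
  go : ∀ r → g' * q ∣ q ^ suc r → g' * q ∣ q ^ r ⊎ q ^ suc r ∣ g' * q
  go zero    _  = inj₂ (subst (_∣ g' * q) (sym (ℕ.*-identityʳ q)) (n∣m*n g'))
  go (suc r) g∣ with ∣-prime-power pr r (*-cancelˡ-∣ q (subst (_∣ q ^ suc (suc r)) (ℕ.*-comm g' q) g∣))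
  ... | inj₁ h = inj₁ (subst (_∣ q ^ suc r) (ℕ.*-comm q g') (*-monoʳ-∣ q h))
  ... | inj₂ h = inj₂ (subst (q ^ suc (suc r) ∣_) (ℕ.*-comm q g') (*-monoʳ-∣ q h))

prime-power-coprime : ∀ {q m} → Prime q → ¬ q ∣ m → ∀ r → Coprime.Coprime (q ^ r) m
prime-power-coprime pr q∤m zero    (i∣ , _)   = ∣1⇒≡1 i∣
prime-power-coprime pr q∤m (suc r) (i∣ , i∣m) = prime-power-coprime pr q∤m r
  (Coprime.coprime-divisor (prime∤⇒coprime pr (λ q∣i → q∤m (∣-trans q∣i i∣m))) i∣ , i∣m)

prime-divisor : ∀ d → d ≢ 1 → .{{_ : NonZero d}} → ∃ λ q → Prime q × q ∣ d
prime-divisor d d≢1 with factorise d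
... | record { factors = []     ; isFactorisation = eq } = contradiction eq d≢1
... | record { factors = q ∷ qs ; isFactorisation = eq ; factorsPrime = pq ∷ _ } =
  q , pq , subst (q ∣_) (sym eq) (m∣m*n (product qs))

split-prime : ∀ {q} → Prime q → ∀ n → .{{NonZero n}} → ∃ λ r → ∃ λ m → n ≡ q ^ r * m × ¬ q ∣ m
split-prime {q} pr n = go n (ℕ.<-wellFounded n)
  where
  instance
    _ = Prime.prime⇒nonZero pr
    _ = Prime.prime⇒nonTrivial pr
  go : ∀ n → .{{NonZero n}} → Acc _<_ n → ∃ λ r → ∃ λ m → n ≡ q ^ r * m × ¬ q ∣ m
  go n (acc rs) with q ∣? n
  ... | no q∤n = 0 , n , sym (ℕ.*-identityˡ n) , q∤n
  ... | yes q∣n with go (quotient q∣n) {{quotient≢0 q∣n}} (rs (quotient-< q∣n))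
  ...   | r , m , eq , q∤m = suc r , m , trans (m∣n⇒n≡m*quotient q∣n)
            (trans (cong (q *_) eq) (sym (ℕ.*-assoc q (q ^ r) m))) , q∤m

module FiniteField
  {F : Set} {_⊕_ _⊗_ : F → F → F} {⊖_ : F → F} {0F 1F : F}
  (isCommutativeRing : IsCommutativeRing _≡_ _⊕_ _⊗_ ⊖_ 0F 1F)
  (_≟_ : DecidableEquality F)
  (els : List F) (els-unique : Unique els) (els-complete : ∀ x → x ∈ els)
  (1≢0 : 1F ≢ 0F) (inverse : ∀ a → a ≢ 0F → ∃ λ b → (a ⊗ b) ≡ 1F)
  where

  R : CommutativeRing 0ℓ 0ℓ
  R = record { isCommutativeRing = isCommutativeRing }

  open CommutativeRing R using (commutativeSemiring; ring)
    renaming ( *-comm to ⊗-comm; *-assoc to ⊗-assoc; *-identityˡ to ⊗-identityˡ; *-identityʳ to ⊗-identityʳ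
             ; +-identityˡ to ⊕-identityˡ; +-identityʳ to ⊕-identityʳ; +-assoc to ⊕-assoc
             ; -‿inverseˡ to ⊖-inverseˡ; -‿inverseʳ to ⊖-inverseʳ
             ; zeroˡ to ⊗-zeroˡ; zeroʳ to ⊗-zeroʳ)
  open RingProperties ring using (+-inverseˡ-unique)
  open Exp commutativeSemiring using (^-homo-*; ^-assocʳ; ^-distrib-*) renaming (_^_ to _↑_)
  open SemiringSolver commutativeSemiring

  ⊗-cancelˡ : ∀ a {x y} → a ≢ 0F → a ⊗ x ≡ a ⊗ y → x ≡ y
  ⊗-cancelˡ a {x} {y} a≢0 eq with inverse a a≢0
  ... | b , ab≡1 = trans (sym (undo x)) (trans (cong (b ⊗_) eq) (undo y))
    where
    undo : ∀ z → b ⊗ (a ⊗ z) ≡ z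
    undo z = trans (sym (⊗-assoc b a z)) (trans (cong (_⊗ z) (trans (⊗-comm b a) ab≡1)) (⊗-identityˡ z))

  ⊗-≢0 : ∀ {a b} → a ≢ 0F → b ≢ 0F → a ⊗ b ≢ 0F
  ⊗-≢0 {a} a≢0 b≢0 eq = b≢0 (⊗-cancelˡ a a≢0 (trans eq (sym (⊗-zeroʳ a))))

  ↑-≢0 : ∀ {a} k → a ≢ 0F → (a ↑ k) ≢ 0F
  ↑-≢0 zero    a≢0 = 1≢0
  ↑-≢0 (suc k) a≢0 = ⊗-≢0 a≢0 (↑-≢0 k a≢0)

  1-↑ : ∀ k → 1F ↑ k ≡ 1F
  1-↑ zero    = refl
  1-↑ (suc k) = trans (⊗-identityˡ _) (1-↑ k)

  units : List F
  units = filter (λ x → ¬? (x ≟ 0F)) els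

  units-unique : Unique units
  units-unique = Unique.filter⁺ _ els-unique

  ∈-units⁺ : ∀ {a} → a ≢ 0F → a ∈ units
  ∈-units⁺ = ∈-filter⁺ _ (els-complete _)

  ∈-units⁻ : ∀ {a} → a ∈ units → a ≢ 0F
  ∈-units⁻ a∈ = proj₂ (∈-filter⁻ (λ x → ¬? (x ≟ 0F)) {xs = els} a∈)

  ∣units∣ : ℕ
  ∣units∣ = length units

  private
    ∏ : List F → F
    ∏ = foldr _⊗_ 1F

    ∏-scale : ∀ a xs → ∏ (map (a ⊗_) xs) ≡ (a ↑ length xs) ⊗ ∏ xs
    ∏-scale a []       = sym (⊗-identityˡ 1F)
    ∏-scale a (x ∷ xs) = trans (cong ((a ⊗ x) ⊗_) (∏-scale a xs))
      (solve 4 (λ a x u v → (a :* x) :* (u :* v) := (a :* u) :* (x :* v)) refl a x (a ↑ length xs) (∏ xs))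

    ∏-≢0 : ∀ xs → All (_≢ 0F) xs → ∏ xs ≢ 0F
    ∏-≢0 []       _          = 1≢0
    ∏-≢0 (x ∷ xs) (x≢0 ∷ ne) = ⊗-≢0 x≢0 (∏-≢0 xs ne)

  scale-units : ∀ {a} → a ≢ 0F → map (a ⊗_) units ↭ units
  scale-units {a} a≢0 = ∼bag⇒↭ (unique∧set⇒bag (Unique.map⁺ (⊗-cancelˡ a a≢0) units-unique) units-unique (mk⇔ to from))
    where
    to : ∀ {y} → y ∈ map (a ⊗_) units → y ∈ units
    to y∈ with ∈-map⁻ (a ⊗_) y∈
    ... | x , x∈ , refl = ∈-units⁺ (⊗-≢0 a≢0 (∈-units⁻ x∈))
    from : ∀ {y} → y ∈ units → y ∈ map (a ⊗_) units
    from {y} y∈ with inverse a a≢0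
    ... | b , ab≡1 = subst (_∈ map (a ⊗_) units) a[by]≡y (∈-map⁺ (a ⊗_) (∈-units⁺ by≢0))
      where
      a[by]≡y : a ⊗ (b ⊗ y) ≡ y
      a[by]≡y = trans (sym (⊗-assoc a b y)) (trans (cong (_⊗ y) ab≡1) (⊗-identityˡ y))
      by≢0 : b ⊗ y ≢ 0F
      by≢0 eq = ∈-units⁻ y∈ (trans (sym a[by]≡y) (trans (cong (a ⊗_) eq) (⊗-zeroʳ a)))

  -- Multiplication by `a` permutes the units, so their product is unchanged although it picks up
  -- the factor `a ↑ ∣units∣`; cancel the product.
  fermat : ∀ {a} → a ≢ 0F → a ↑ ∣units∣ ≡ 1F
  fermat {a} a≢0 = ⊗-cancelˡ (∏ units) (∏-≢0 units (All.tabulate ∈-units⁻)) (begin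
    ∏ units ⊗ (a ↑ ∣units∣)    ≡⟨ ⊗-comm _ _ ⟩
    (a ↑ ∣units∣) ⊗ ∏ units    ≡⟨ ∏-scale a units ⟨
    ∏ (map (a ⊗_) units)       ≡⟨ Permutation.foldr-commMonoid (setoid F) (CommutativeRing.*-isCommutativeMonoid R) (↭⇒↭ₛ (scale-units a≢0)) ⟩
    ∏ units                    ≡⟨ ⊗-identityʳ _ ⟨
    ∏ units ⊗ 1F               ∎)
    where open ≡-Reasoning

  -- The coefficient vector of a monic polynomial, leading coefficient omitted.
  evalMonic : ∀ {d} → Vec F d → F → F
  evalMonic []       x = 1F
  evalMonic (c ∷ cs) x = c ⊕ (x ⊗ evalMonic cs x)

  -- Division by x - r with x written as `r ⊕ δ`: no subtraction occurs, so the semiring solver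
  -- applies. The coefficients of the quotient are the successive Horner values at r.
  divide-root : ∀ {d} (cs : Vec F (suc d)) r → ∃ λ (ds : Vec F d) →
                ∀ δ → evalMonic cs (r ⊕ δ) ≡ evalMonic cs r ⊕ (δ ⊗ evalMonic ds (r ⊕ δ))
  divide-root (c ∷ []) r = [] , λ δ →
    solve 3 (λ c r δ → c :+ ((r :+ δ) :* con 1) := (c :+ (r :* con 1)) :+ (δ :* con 1)) refl c r δ
  divide-root (c ∷ cs@(_ ∷ _)) r with divide-root cs r
  ... | ds , eq = evalMonic cs r ∷ ds , λ δ →
    trans (cong (λ e → c ⊕ ((r ⊕ δ) ⊗ e)) (eq δ))
      (solve 5 (λ c r δ e d → c :+ ((r :+ δ) :* (e :+ (δ :* d))) := (c :+ (r :* e)) :+ (δ :* (e :+ ((r :+ δ) :* d))))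
        refl c r δ (evalMonic cs r) (evalMonic ds (r ⊕ δ)))

  root-bound : ∀ {d} (cs : Vec F d) xs → Unique xs → All (λ x → evalMonic cs x ≡ 0F) xs → length xs ≤ d
  root-bound cs       []       _          _         = z≤n
  root-bound []       (x ∷ xs) _          (r ∷ _)   = contradiction r 1≢0
  root-bound (c ∷ cs) (r ∷ xs) (r∉ ∷ uxs) (r0 ∷ rs) with divide-root (c ∷ cs) r
  ... | ds , eq = s≤s (root-bound ds xs uxs (All.tabulate λ {x} x∈ → root x∈))
    where
    root : ∀ {x} → x ∈ xs → evalMonic ds x ≡ 0F
    root {x} x∈ = ⊗-cancelˡ δ δ≢0 (begin
      δ ⊗ evalMonic ds x                                      ≡⟨ cong (λ y → δ ⊗ evalMonic ds y) r+δ≡x ⟨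
      δ ⊗ evalMonic ds (r ⊕ δ)                                ≡⟨ ⊕-identityˡ _ ⟨
      0F ⊕ (δ ⊗ evalMonic ds (r ⊕ δ))                         ≡⟨ cong (_⊕ (δ ⊗ evalMonic ds (r ⊕ δ))) r0 ⟨
      evalMonic (c ∷ cs) r ⊕ (δ ⊗ evalMonic ds (r ⊕ δ))       ≡⟨ eq δ ⟨
      evalMonic (c ∷ cs) (r ⊕ δ)                              ≡⟨ cong (evalMonic (c ∷ cs)) r+δ≡x ⟩
      evalMonic (c ∷ cs) x                                    ≡⟨ All.lookup rs x∈ ⟩
      0F                                                      ≡⟨ ⊗-zeroʳ δ ⟨
      δ ⊗ 0F                                                  ∎)
      where
      open ≡-Reasoning
      δ : F
      δ = (⊖ r) ⊕ x
      r+δ≡x : r ⊕ δ ≡ x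
      r+δ≡x = trans (sym (⊕-assoc r (⊖ r) x)) (trans (cong (_⊕ x) (⊖-inverseʳ r)) (⊕-identityˡ x))
      δ≢0 : δ ≢ 0F
      δ≢0 δ≡0 = All.lookup r∉ x∈ (trans (sym (⊕-identityʳ r)) (trans (cong (r ⊕_) (sym δ≡0)) r+δ≡x))

  evalMonic-x^d : ∀ d x → evalMonic (replicate d 0F) x ≡ x ↑ d
  evalMonic-x^d zero    x = refl
  evalMonic-x^d (suc d) x = trans (⊕-identityˡ _) (cong (x ⊗_) (evalMonic-x^d d x))

  unity-roots-bound : ∀ d → (∀ {x} → x ∈ units → x ↑ suc d ≡ 1F) → ∣units∣ ≤ suc d
  unity-roots-bound d h = root-bound ((⊖ 1F) ∷ replicate d 0F) units units-unique
    (All.tabulate λ {x} x∈ → trans (cong (λ e → (⊖ 1F) ⊕ (x ⊗ e)) (evalMonic-x^d d x))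
      (trans (cong ((⊖ 1F) ⊕_) (h x∈)) (⊖-inverseˡ 1F)))

  -- The polynomial x^(d+1) - 1 has at most d + 1 roots, so an exponent below the number of units
  -- cannot send all of them to 1.
  non-root : ∀ d → suc d < ∣units∣ → ∃ λ y → y ≢ 0F × y ↑ suc d ≢ 1F
  non-root d d<N with Any.any? (λ y → ¬? ((y ↑ suc d) ≟ 1F)) units
  ... | yes any with find any
  ...   | y , y∈ , ne = y , ∈-units⁻ y∈ , ne
  non-root d d<N | no none = contradiction (unity-roots-bound d all) (ℕ.<⇒≱ d<N)
    where
    all : ∀ {x} → x ∈ units → x ↑ suc d ≡ 1F
    all {x} x∈ with (x ↑ suc d) ≟ 1F
    ... | yes eq = eq
    ... | no  ne = contradiction (lose x∈ ne) none

  HasOrder : F → ℕ → Set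
  HasOrder a d = a ↑ d ≡ 1F × (∀ k → a ↑ k ≡ 1F → d ∣ k)

  ↑-*-≡1 : ∀ {a} j k → a ↑ j ≡ 1F → a ↑ (k * j) ≡ 1F
  ↑-*-≡1 {a} j k eq = trans (cong (a ↑_) (ℕ.*-comm k j)) (trans (sym (^-assocʳ a j k)) (trans (cong (_↑ k) eq) (1-↑ k)))

  ↑-∣-≡1 : ∀ a j k → j ∣ k → a ↑ j ≡ 1F → a ↑ k ≡ 1F
  ↑-∣-≡1 a j k (divides q refl) eq = ↑-*-≡1 j q eq

  ↑-gcd-≡1 : ∀ {a} j k → a ↑ j ≡ 1F → a ↑ k ≡ 1F → a ↑ gcd j k ≡ 1F
  ↑-gcd-≡1 {a} = gcd-closed (λ k → a ↑ k ≡ 1F) (λ q {j} → ↑-*-≡1 j q)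
    (λ {d} {u} adu au → trans (sym (⊗-identityʳ _)) (trans (cong ((a ↑ d) ⊗_) (sym au)) (trans (sym (^-homo-* a d u)) adu)))

  order-prime-power : ∀ {q} → Prime q → ∀ r {z} → z ↑ (q ^ suc r) ≡ 1F → z ↑ (q ^ r) ≢ 1F → HasOrder z (q ^ suc r)
  order-prime-power {q} pr r {z} z1 z≢1 = z1 , λ k zk → divides-exponent k zk
    where
    divides-exponent : ∀ k → z ↑ k ≡ 1F → q ^ suc r ∣ k
    divides-exponent k zk with ∣-prime-power pr r (GCD.gcd[m,n]∣n k (q ^ suc r))
    ... | inj₁ g∣ = contradiction (↑-∣-≡1 z _ _ g∣ (↑-gcd-≡1 k (q ^ suc r) zk z1)) z≢1
    ... | inj₂ ∣g = ∣-trans ∣g (GCD.gcd[m,n]∣m k (q ^ suc r))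

  -- Raising (a b)^k = 1 to the power e removes b and leaves a^(k e) = 1, so d divides k e and,
  -- being coprime to e, divides k. The same holds with the roles exchanged.
  order-product : ∀ {a b d e} → Coprime.Coprime d e → HasOrder a d → HasOrder b e → HasOrder (a ⊗ b) (d * e)
  order-product {a} {b} {d} {e} cop (ad , a-ord) (be , b-ord) = one , divides-exponent
    where
    one : (a ⊗ b) ↑ (d * e) ≡ 1F
    one = trans (^-distrib-* a b (d * e))
      (trans (cong₂ _⊗_ (↑-∣-≡1 a d _ (m∣m*n e) ad) (↑-∣-≡1 b e _ (n∣m*n d) be)) (⊗-identityˡ 1F))
    divides-exponent : ∀ k → (a ⊗ b) ↑ k ≡ 1F → d * e ∣ k
    divides-exponent k abk = Coprime-product d∣k e∣k
      where
      d∣k : d ∣ k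
      d∣k = Coprime.coprime-divisor cop (subst (d ∣_) (ℕ.*-comm k e) (a-ord (k * e) (begin
        a ↑ (k * e)                        ≡⟨ ⊗-identityʳ _ ⟨
        (a ↑ (k * e)) ⊗ 1F                 ≡⟨ cong ((a ↑ (k * e)) ⊗_) (↑-*-≡1 e k be) ⟨
        (a ↑ (k * e)) ⊗ (b ↑ (k * e))      ≡⟨ ^-distrib-* a b (k * e) ⟨
        (a ⊗ b) ↑ (k * e)                  ≡⟨ ↑-∣-≡1 (a ⊗ b) k _ (m∣m*n e) abk ⟩
        1F                                 ∎)))
        where open ≡-Reasoning
      e∣k : e ∣ k
      e∣k = Coprime.coprime-divisor (Coprime.sym cop) (subst (e ∣_) (ℕ.*-comm k d) (b-ord (k * d) (begin
        b ↑ (k * d)                        ≡⟨ ⊗-identityˡ _ ⟨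
        1F ⊗ (b ↑ (k * d))                 ≡⟨ cong (_⊗ (b ↑ (k * d))) (↑-*-≡1 d k ad) ⟨
        (a ↑ (k * d)) ⊗ (b ↑ (k * d))      ≡⟨ ^-distrib-* a b (k * d) ⟨
        (a ⊗ b) ↑ (k * d)                  ≡⟨ ↑-∣-≡1 (a ⊗ b) k _ (m∣m*n d) abk ⟩
        1F                                 ∎)))
        where open ≡-Reasoning
      Coprime-product : d ∣ k → e ∣ k → d * e ∣ k
      Coprime-product (divides q refl) e∣qd =
        subst (_∣ q * d) (ℕ.*-comm e d) (*-monoˡ-∣ d (Coprime.coprime-divisor (Coprime.sym cop) (subst (e ∣_) (ℕ.*-comm q d) e∣qd)))

  instance
    ∣units∣-nonZero : NonZero ∣units∣
    ∣units∣-nonZero = >-nonZero (∈-length (∈-units⁺ 1≢0))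

  -- Induction on d: split off the full power of a prime divisor q, and multiply an element of that
  -- order by one of the coprime order d' from the induction. For d = `∣units∣` this is a primitive
  -- root.
  element-of-order : ∀ d → d ∣ ∣units∣ → .{{NonZero d}} → ∃ λ a → HasOrder a d
  element-of-order d = go d (ℕ.<-wellFounded d)
    where
    go : ∀ d → Acc _<_ d → d ∣ ∣units∣ → .{{NonZero d}} → ∃ λ a → HasOrder a d
    go d (acc rs) d∣N with d ℕ.≟ 1
    ... | yes refl = 1F , ⊗-identityˡ 1F , λ k _ → 1∣ k
    ... | no  d≢1  with prime-divisor d d≢1
    ...   | q , pq , q∣d with split-prime pq d
    ...     | zero  , d' , eq , q∤d' = contradiction (subst (q ∣_) (trans eq (ℕ.*-identityˡ d')) q∣d) q∤d'
    ...     | suc r , d' , refl , q∤d' = combine (go d' (rs d'<d) (∣-trans (n∣m*n (q ^ suc r)) d∣N) {{d'≢0}}) d∣N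
      where
      instance
        _ = Prime.prime⇒nonZero pq
        _ = Prime.prime⇒nonTrivial pq
        _ = ℕ.m^n≢0 q r
      d'≢0 : NonZero d'
      d'≢0 = ℕ.m*n≢0⇒n≢0 (q ^ suc r)
      d'<d : d' < q ^ suc r * d'
      d'<d = subst (d' <_) (ℕ.*-comm d' (q ^ suc r)) (ℕ.m<m*n d' (q ^ suc r) {{d'≢0}}
        (ℕ.<-≤-trans (nonTrivial⇒n>1 q) (ℕ.m≤m*n q (q ^ r))))
      combine : (∃ λ a → HasOrder a d') → q ^ suc r * d' ∣ ∣units∣ → ∃ λ a → HasOrder a (q ^ suc r * d')
      combine (a , a-ord) (divides c N≡) = z ⊗ a ,
        order-product (prime-power-coprime pq q∤d' (suc r)) (order-prime-power pq r z^q^r+1 z^q^r) a-ord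
        where
        instance
          _ = ℕ.m*n≢0⇒m≢0 c {{subst NonZero N≡ ∣units∣-nonZero}}
          _ = d'≢0
          _ = ℕ.m*n≢0 c d'
          _ = ℕ.m*n≢0 (c * d') (q ^ r)
        -- `e` is `∣units∣` / q, smaller than `∣units∣`, so some unit y has y^e ≠ 1.
        e : ℕ
        e = c * d' * q ^ r
        N≡e*q : ∣units∣ ≡ e * q
        N≡e*q = trans N≡ (lemma c q (q ^ r) d')
          where
          lemma : ∀ c q s d → c * (q * s * d) ≡ c * d * s * q
          lemma = solve-∀
        nr : ∃ λ y → y ≢ 0F × y ↑ e ≢ 1F
        nr with e in eq
        ... | zero = contradiction eq (≢-nonZero⁻¹ e)
        ... | suc e' = non-root e' (subst (suc e' <_) (sym (trans N≡e*q (cong (_* q) eq)))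
                         (ℕ.m<m*n (suc e') q (nonTrivial⇒n>1 q)))
        -- The exponent is `∣units∣` / q^(r+1), so that z^(q^r) = y^e ≠ 1 while z^(q^(r+1)) = 1 by
        -- `fermat`.
        z : F
        z = proj₁ nr ↑ (c * d')
        z^q^r : z ↑ (q ^ r) ≢ 1F
        z^q^r eq = proj₂ (proj₂ nr) (trans (sym (^-assocʳ (proj₁ nr) (c * d') (q ^ r))) eq)
        z^q^r+1 : z ↑ (q ^ suc r) ≡ 1F
        z^q^r+1 = trans (^-assocʳ (proj₁ nr) (c * d') (q ^ suc r))
          (trans (cong (proj₁ nr ↑_) (trans (lemma c d' q (q ^ r)) (sym N≡e*q))) (fermat (proj₁ (proj₂ nr))))
          where
          lemma : ∀ c d q s → c * d * (q * s) ≡ c * d * s * q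
          lemma = solve-∀

  abstract
    primitive-root : ∃ λ g → HasOrder g ∣units∣
    primitive-root = element-of-order ∣units∣ ∣-refl

  g : F
  g = proj₁ primitive-root

  g≢0 : g ≢ 0F
  g≢0 g≡0 = 0↑≢1 ∣units∣ (trans (cong (_↑ ∣units∣) (sym g≡0)) (proj₁ (proj₂ primitive-root)))
    where
    0↑≢1 : ∀ N → .{{NonZero N}} → 0F ↑ N ≢ 1F
    0↑≢1 (suc N) eq = 1≢0 (trans (sym eq) (⊗-zeroˡ _))

  g↑N≡1 : g ↑ ∣units∣ ≡ 1F
  g↑N≡1 = proj₁ (proj₂ primitive-root)

  private
    g↑-injective-≤ : ∀ i j → i ≤ j → g ↑ i ≡ g ↑ j → i % ∣units∣ ≡ j % ∣units∣
    g↑-injective-≤ i j i≤j eq = sym (trans (cong (_% ∣units∣) (sym (ℕ.m+[n∸m]≡n i≤j)))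
      (%-remove-+ʳ i (proj₂ (proj₂ primitive-root) (j ∸ i) (⊗-cancelˡ (g ↑ i) (↑-≢0 i g≢0) (begin
        (g ↑ i) ⊗ (g ↑ (j ∸ i))    ≡⟨ ^-homo-* g i (j ∸ i) ⟨
        g ↑ (i + (j ∸ i))          ≡⟨ cong (g ↑_) (ℕ.m+[n∸m]≡n i≤j) ⟩
        g ↑ j                      ≡⟨ eq ⟨
        g ↑ i                      ≡⟨ ⊗-identityʳ _ ⟨
        (g ↑ i) ⊗ 1F               ∎)))))
      where open ≡-Reasoning

  g↑-injective : ∀ i j → g ↑ i ≡ g ↑ j → i % ∣units∣ ≡ j % ∣units∣
  g↑-injective i j eq with ℕ.≤-total i j
  ... | inj₁ i≤j = g↑-injective-≤ i j i≤j eq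
  ... | inj₂ j≤i = sym (g↑-injective-≤ j i j≤i (sym eq))

  powers : List F
  powers = map (g ↑_) (upTo ∣units∣)

  powers-unique : Unique powers
  powers-unique = AllPairs.map⁺ (AllPairs.map (λ { (i< , j< , i≢j) eq → i≢j (trans (sym (m<n⇒m%n≡m i<))
    (trans (g↑-injective _ _ eq) (m<n⇒m%n≡m j<))) }) (bounded (upTo ∣units∣) ∈-upTo⁻ (Unique.upTo⁺ ∣units∣)))
    where
    bounded : ∀ is → (∀ {i} → i ∈ is → i < ∣units∣) → Unique is →
              AllPairs (λ i j → i < ∣units∣ × j < ∣units∣ × i ≢ j) is
    bounded []       _  _         = []
    bounded (i ∷ is) lt (i∉ ∷ uq) =
      All.tabulate (λ j∈ → lt (here refl) , lt (there j∈) , All.lookup i∉ j∈) ∷ bounded is (lt ∘ there) uq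

  powers⊆units : ∀ {x} → x ∈ powers → x ∈ units
  powers⊆units x∈ with ∈-map⁻ (g ↑_) x∈
  ... | i , _ , refl = ∈-units⁺ (↑-≢0 i g≢0)

  -- By counting: the powers are `∣units∣` distinct units, and a unit outside them would give one
  -- unit too many.
  units⊆powers : ∀ {x} → x ≢ 0F → x ∈ powers
  units⊆powers {x} x≢0 with Any.any? (x ≟_) powers
  ... | yes x∈ = x∈
  ... | no  x∉ = contradiction
    (length-injection _≟_ _≟_ (All.¬Any⇒All¬ powers x∉ ∷ powers-unique) units-unique id
      (λ { (here refl) → ∈-units⁺ x≢0 ; (there y∈) → powers⊆units y∈ }) (λ _ _ → id))
    (ℕ.<⇒≱ (s≤s (ℕ.≤-reflexive (sym (trans (List.length-map (g ↑_) (upTo ∣units∣)) (List.length-upTo ∣units∣))))))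

  abstract
    discrete-log : ∀ x → x ≢ 0F → ∃ λ i → i < ∣units∣ × x ≡ g ↑ i
    discrete-log x x≢0 with ∈-map⁻ (g ↑_) (units⊆powers x≢0)
    ... | i , i∈ , eq = i , ∈-upTo⁻ i∈ , eq

  -- The element x = g^m has x² = 1, that is (x + 1) x = (x + 1) 1. Unless x + 1 = 0, cancelling
  -- gives x = 1, which the order of g forbids for 0 < m < `∣units∣`.
  g↑half≡-1 : ∀ m → ∣units∣ ≡ m + m → g ↑ m ≡ ⊖ 1F
  g↑half≡-1 m N≡ with ((g ↑ m) ⊕ 1F) ≟ 0F
  ... | yes eq = +-inverseˡ-unique (g ↑ m) 1F eq
  ... | no  ne = contradiction (proj₂ (proj₂ primitive-root) m gm≡1) N∤m
    where
    open ≡-Reasoning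
    gm≡1 : g ↑ m ≡ 1F
    gm≡1 = ⊗-cancelˡ ((g ↑ m) ⊕ 1F) ne (begin
      ((g ↑ m) ⊕ 1F) ⊗ (g ↑ m)           ≡⟨ solve 1 (λ x → (x :+ con 1) :* x := x :* x :+ x) refl (g ↑ m) ⟩
      ((g ↑ m) ⊗ (g ↑ m)) ⊕ (g ↑ m)      ≡⟨ cong (_⊕ (g ↑ m)) (trans (sym (^-homo-* g m m)) (trans (cong (g ↑_) (sym N≡)) g↑N≡1)) ⟩
      1F ⊕ (g ↑ m)                       ≡⟨ solve 1 (λ x → con 1 :+ x := (x :+ con 1) :* con 1) refl (g ↑ m) ⟩
      ((g ↑ m) ⊕ 1F) ⊗ 1F                ∎)
    instance
      m-nonZero : NonZero m
      m-nonZero = ≢-nonZero (λ { refl → ≢-nonZero⁻¹ ∣units∣ N≡ })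
    N∤m : ¬ ∣units∣ ∣ m
    N∤m N∣m = ℕ.<⇒≱ (subst (m <_) (sym N≡) (ℕ.m<m+n m (ℕ.n≢0⇒n>0 (≢-nonZero⁻¹ m)))) (∣⇒≤ N∣m)

  suc∣units∣≡∣els∣ : suc ∣units∣ ≡ length els
  suc∣units∣≡∣els∣ = begin
    1 + ∣units∣
      ≡⟨ cong₂ _+_ (sym (∑-indicator-1 _≟_ els-unique (els-complete 0F))) (length-filter _ els) ⟩
    ∑ els (λ x → 𝟙 (0F ≟ x)) + ∑ els (λ x → 𝟙 (¬? (x ≟ 0F)))
      ≡⟨ ∑-+ els (λ x → 𝟙 (0F ≟ x)) (λ x → 𝟙 (¬? (x ≟ 0F))) ⟨
    ∑ els (λ x → 𝟙 (0F ≟ x) + 𝟙 (¬? (x ≟ 0F)))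
      ≡⟨ ∑-cong′ els one ⟩
    ∑ els (λ _ → 1)
      ≡⟨ ∑-1 els ⟩
    length els ∎
    where
    open ≡-Reasoning
    one : ∀ x → 𝟙 (0F ≟ x) + 𝟙 (¬? (x ≟ 0F)) ≡ 1
    one x with x ≟ 0F
    ... | yes refl = trans (ℕ.+-identityʳ _) (𝟙-yes (0F ≟ 0F) refl)
    ... | no  ne   = cong (_+ 1) (𝟙-no (0F ≟ x) (ne ∘ sym))

-- Subsets of ℤ/p invariant under an affine map

lookup-ext : ∀ {k} {u v : Vec A k} → (∀ i → lookup u i ≡ lookup v i) → u ≡ v
lookup-ext {u = u} {v} eq =
  trans (sym (Vec.tabulate∘lookup u)) (trans (Vec.tabulate-cong eq) (Vec.tabulate∘lookup v))

allVecs : List A → ∀ k → List (Vec A k)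
allVecs xs zero    = [] ∷ []
allVecs xs (suc k) = cartesianProductWith _∷_ xs (allVecs xs k)

allVecs-unique : ∀ {xs : List A} → Unique xs → ∀ k → Unique (allVecs xs k)
allVecs-unique uq zero    = [] ∷ []
allVecs-unique uq (suc k) = Unique.cartesianProductWith⁺ _∷_ Vec.∷-injective uq (allVecs-unique uq k)

allVecs-complete : ∀ {xs : List A} → (∀ x → x ∈ xs) → ∀ {k} (v : Vec A k) → v ∈ allVecs xs k
allVecs-complete all []      = here refl
allVecs-complete all (x ∷ v) = ∈-cartesianProductWith⁺ _∷_ (all x) (allVecs-complete all v)

length-cartesianProductWith : ∀ {C : Set} (f : A → B → C) xs ys →
                              length (cartesianProductWith f xs ys) ≡ length xs * length ys
length-cartesianProductWith f []       ys = refl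
length-cartesianProductWith f (x ∷ xs) ys = trans (List.length-++ (map (f x) ys))
  (cong₂ _+_ (List.length-map (f x) ys) (length-cartesianProductWith f xs ys))

length-allVecs : ∀ (xs : List A) k → length (allVecs xs k) ≡ length xs ^ k
length-allVecs xs zero    = refl
length-allVecs xs (suc k) = trans (length-cartesianProductWith _∷_ xs (allVecs xs k))
  (cong (length xs *_) (length-allVecs xs k))

bools : List Bool
bools = false ∷ true ∷ []

bools-unique : Unique bools
bools-unique = ((λ ()) ∷ []) ∷ [] ∷ []

bools-complete : ∀ b → b ∈ bools
bools-complete false = here refl
bools-complete true  = there (here refl)

-- Subsets of ℤ/p are bit vectors, because functions into `Bool` lack the decidable propositional
-- equality on which the counting of orbits and fixed points rests.
bitvecs : ∀ k → List (Vec Bool k)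
bitvecs = allVecs bools

bitvecs-unique : ∀ k → Unique (bitvecs k)
bitvecs-unique = allVecs-unique bools-unique

∈-bitvecs : ∀ {k} (v : Vec Bool k) → v ∈ bitvecs k
∈-bitvecs = allVecs-complete bools-complete

infix 4 _≟ᵛ_
_≟ᵛ_ : ∀ {k} → DecidableEquality (Vec Bool k)
_≟ᵛ_ = Vec.≡-dec Bool._≟_

count-by-bijection : ∀ {k q} {P : Vec Bool k → Set} (P? : Decidable P)
  (encode : Vec Bool k → Vec Bool q) (decode : Vec Bool q → Vec Bool k) →
  (∀ v → P (decode v)) → (∀ v → encode (decode v) ≡ v) → (∀ u → P u → decode (encode u) ≡ u) →
  ∑ (bitvecs k) (𝟙 ∘ P?) ≡ 2 ^ q
count-by-bijection {k} {q} P? encode decode P-dec ed de = begin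
  ∑ (bitvecs k) (𝟙 ∘ P?)                    ≡⟨ length-filter P? (bitvecs k) ⟨
  length (filter P? (bitvecs k))            ≡⟨ ∑-1 (filter P? (bitvecs k)) ⟨
  ∑ (filter P? (bitvecs k)) (λ _ → 1)       ≡⟨ ∑-bijection _≟ᵛ_ _≟ᵛ_ (Unique.filter⁺ P? (bitvecs-unique k)) (bitvecs-unique q)
                                                 encode decode (λ _ → ∈-bitvecs _) (λ _ → ∈-filter⁺ P? (∈-bitvecs _) (P-dec _))
                                                 (λ {u} u∈ → de u (proj₂ (∈-filter⁻ P? {xs = bitvecs k} u∈))) (λ {v} _ → ed v) (λ _ → 1) ⟩
  ∑ (bitvecs q) (λ _ → 1)                   ≡⟨ ∑-1 (bitvecs q) ⟩
  length (bitvecs q)                        ≡⟨ length-allVecs bools q ⟩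
  2 ^ q                                     ∎
  where open ≡-Reasoning

-- Hides the arithmetic of residues behind the field laws. `translate-induction` carries the prime
-- order of the additive group; the two properties at the end carry that p is odd and that the
-- operations are those of the dihedral group's definition.
record FieldStructure (p : ℕ) : Set₁ where
  infixl 6 _⊕_
  infixl 7 _⊗_
  infix  8 ⊖_
  field
    _⊕_ _⊗_ : Fin p → Fin p → Fin p
    ⊖_      : Fin p → Fin p
    0F 1F   : Fin p
    isCommutativeRing : IsCommutativeRing _≡_ _⊕_ _⊗_ ⊖_ 0F 1F
    1≢0     : 1F ≢ 0F
    inverse : ∀ a → a ≢ 0F → ∃ λ b → a ⊗ b ≡ 1F
    translate-induction : ∀ {c} → c ≢ 0F → (P : Fin p → Set) → (∀ x → P x → P (x ⊕ c)) → ∀ x y → P x → P y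

  OddCharacteristic : Set
  OddCharacteristic = 1F ⊕ 1F ≢ 0F

  AgreesWithDefs : Set
  AgreesWithDefs = (∀ a b → addF a b ≡ a ⊕ b) × (∀ a → negF a ≡ ⊖ a) × toℕ 0F ≡ 0

module InvariantSubsets {p : ℕ} (𝔽 : FieldStructure p) where

  open FieldStructure 𝔽 public

  F : Set
  F = Fin p

  open FiniteField isCommutativeRing Fin._≟_ (allFin p) (Unique.allFin⁺ p) ∈-allFin 1≢0 inverse public

  open CommutativeRing R using (commutativeSemiring; ring; +-abelianGroup)
    renaming ( *-comm to ⊗-comm; *-assoc to ⊗-assoc; *-identityˡ to ⊗-identityˡ; *-identityʳ to ⊗-identityʳ
             ; +-identityˡ to ⊕-identityˡ; +-identityʳ to ⊕-identityʳ; +-comm to ⊕-comm; +-assoc to ⊕-assoc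
             ; -‿inverseˡ to ⊖-inverseˡ; -‿inverseʳ to ⊖-inverseʳ
             ; zeroˡ to ⊗-zeroˡ; zeroʳ to ⊗-zeroʳ; distribˡ to ⊗-distribˡ; distribʳ to ⊗-distribʳ) public
  open AbelianGroupProperties +-abelianGroup using (xyx⁻¹≈y; ∙-cancelˡ; ∙-cancelʳ) public
  open Exp commutativeSemiring using (^-homo-*) renaming (_^_ to _↑_) public

  x+[y-x]≡y : ∀ x y → x ⊕ (y ⊕ (⊖ x)) ≡ y
  x+[y-x]≡y x y = trans (sym (⊕-assoc x y (⊖ x))) (xyx⁻¹≈y x y)

  abstract
    log : F → ℕ
    log x with x Fin.≟ 0F
    -- A default value: the logarithm is only used at nonzero elements.
    ... | yes _   = 0
    ... | no  x≢0 = proj₁ (discrete-log x x≢0)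

    g↑log : ∀ {x} → x ≢ 0F → g ↑ log x ≡ x
    g↑log {x} x≢0 with x Fin.≟ 0F
    ... | yes x≡0 = contradiction x≡0 x≢0
    ... | no  ne  = sym (proj₂ (proj₂ (discrete-log x ne)))

  log-g↑-⊗ : ∀ {d} .{{_ : NonZero d}} → d ∣ ∣units∣ → ∀ e {x} → x ≢ 0F → log ((g ↑ e) ⊗ x) % d ≡ (e + log x) % d
  log-g↑-⊗ {d} d∣N e {x} x≢0 = begin
    log ((g ↑ e) ⊗ x) % d               ≡⟨ m∣n⇒o%n%m≡o%m d ∣units∣ _ d∣N ⟨
    log ((g ↑ e) ⊗ x) % ∣units∣ % d     ≡⟨ cong (_% d) (g↑-injective _ _ lemma) ⟩
    (e + log x) % ∣units∣ % d           ≡⟨ m∣n⇒o%n%m≡o%m d ∣units∣ _ d∣N ⟩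
    (e + log x) % d                     ∎
    where
    open ≡-Reasoning
    lemma : g ↑ log ((g ↑ e) ⊗ x) ≡ g ↑ (e + log x)
    lemma = trans (g↑log (⊗-≢0 (↑-≢0 e g≢0) x≢0))
      (sym (trans (^-homo-* g e (log x)) (cong ((g ↑ e) ⊗_) (g↑log x≢0))))

  -- Invariance under the homothety with centre `x₀` and ratio `g ↑ e`. It is indexed by the
  -- exponent because the exponents leaving a subset invariant are closed under gcd.
  Dilation : F → Vec Bool p → ℕ → Set
  Dilation x₀ u e = ∀ y → lookup u (x₀ ⊕ ((g ↑ e) ⊗ y)) ≡ lookup u (x₀ ⊕ y)

  dilation? : ∀ x₀ e → Decidable (λ u → Dilation x₀ u e)
  dilation? x₀ e u = Fin.all? (λ y → _ Bool.≟ _)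

  module _ (x₀ : F) (u : Vec Bool p) where

    dilation-+ : ∀ {d e} → Dilation x₀ u d → Dilation x₀ u e → Dilation x₀ u (d + e)
    dilation-+ {d} {e} Ed Ee y = trans (cong (λ z → lookup u (x₀ ⊕ z)) (trans (cong (_⊗ y) (^-homo-* g d e)) (⊗-assoc _ _ y)))
      (trans (Ed _) (Ee y))

    dilation-* : ∀ q {d} → Dilation x₀ u d → Dilation x₀ u (q * d)
    dilation-* zero    Ed y = cong (λ z → lookup u (x₀ ⊕ z)) (⊗-identityˡ y)
    dilation-* (suc q) {d} Ed = dilation-+ {d} {q * d} Ed (dilation-* q {d} Ed)

    dilation-cancel : ∀ {d e} → Dilation x₀ u (d + e) → Dilation x₀ u e → Dilation x₀ u d
    dilation-cancel {d} {e} Ede Ee y = trans (sym (Ee _)) (trans (cong (λ z → lookup u (x₀ ⊕ z)) lemma) (Ede y))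
      where
      lemma : (g ↑ e) ⊗ ((g ↑ d) ⊗ y) ≡ (g ↑ (d + e)) ⊗ y
      lemma = trans (sym (⊗-assoc _ _ y)) (cong (_⊗ y) (trans (⊗-comm _ _) (sym (^-homo-* g d e))))

    dilation-gcd : ∀ i j → Dilation x₀ u i → Dilation x₀ u j → Dilation x₀ u (gcd i j)
    dilation-gcd = gcd-closed (Dilation x₀ u) (λ q {j} → dilation-* q {j}) (λ {d} {e} → dilation-cancel {d} {e})

    dilation-∣ : ∀ {d e} → d ∣ e → Dilation x₀ u d → Dilation x₀ u e
    dilation-∣ {d} (divides q refl) = dilation-* q {d}

    dilation-N : Dilation x₀ u ∣units∣
    dilation-N y = cong (λ z → lookup u (x₀ ⊕ z)) (trans (cong (_⊗ y) g↑N≡1) (⊗-identityˡ y))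

  module _ (x₀ : F) (d : ℕ) .{{_ : NonZero d}} (d∣N : d ∣ ∣units∣) where

    private
      orbit-index : F → Fin d
      orbit-index y = log y mod d

      decodeAt : Vec Bool (suc d) → ∀ x → Dec (x ≡ x₀) → Bool
      decodeAt (b ∷ v) x (yes _) = b
      decodeAt (b ∷ v) x (no  _) = lookup v (orbit-index (x ⊕ (⊖ x₀)))

      decodeAt-centre : ∀ b v dec → decodeAt (b ∷ v) x₀ dec ≡ b
      decodeAt-centre b v (yes _) = refl
      decodeAt-centre b v (no ne) = contradiction refl ne

      decodeAt-off : ∀ b v {y} → y ≢ 0F → ∀ dec → decodeAt (b ∷ v) (x₀ ⊕ y) dec ≡ lookup v (orbit-index y)
      decodeAt-off b v {y} y≢0 (yes eq) =
        contradiction (∙-cancelˡ x₀ y 0F (trans eq (sym (⊕-identityʳ x₀)))) y≢0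
      decodeAt-off b v {y} y≢0 (no _) = cong (lookup v ∘ orbit-index) (xyx⁻¹≈y x₀ y)

    -- Multiplication by `g ↑ d` has d orbits on the nonzero elements, the classes of logarithms
    -- modulo d. An invariant subset is thus one free bit for the centre followed by one for each
    -- class.
    decode : Vec Bool (suc d) → Vec Bool p
    decode w = tabulate (λ x → decodeAt w x (x Fin.≟ x₀))

    encode : Vec Bool p → Vec Bool (suc d)
    encode u = lookup u x₀ ∷ tabulate (λ r → lookup u (x₀ ⊕ (g ↑ toℕ r)))

    decode-centre : ∀ b v → lookup (decode (b ∷ v)) x₀ ≡ b
    decode-centre b v = trans (Vec.lookup∘tabulate _ x₀) (decodeAt-centre b v (x₀ Fin.≟ x₀))

    private
      decode-off : ∀ b v {y} → y ≢ 0F → lookup (decode (b ∷ v)) (x₀ ⊕ y) ≡ lookup v (orbit-index y)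
      decode-off b v {y} y≢0 = trans (Vec.lookup∘tabulate _ (x₀ ⊕ y)) (decodeAt-off b v y≢0 ((x₀ ⊕ y) Fin.≟ x₀))

      orbit-index-cong : ∀ {y z} → log y % d ≡ log z % d → orbit-index y ≡ orbit-index z
      orbit-index-cong eq = Fin.toℕ-injective (trans (Fin.toℕ-fromℕ< _) (trans eq (sym (Fin.toℕ-fromℕ< _))))

    decode-dilation : ∀ w → Dilation x₀ (decode w) d
    decode-dilation (b ∷ v) y with y Fin.≟ 0F
    ... | yes refl = cong (λ z → lookup (decode (b ∷ v)) (x₀ ⊕ z)) (⊗-zeroʳ (g ↑ d))
    ... | no  y≢0  = trans (decode-off b v (⊗-≢0 (↑-≢0 d g≢0) y≢0))
      (trans (cong (lookup v) (orbit-index-cong (trans (log-g↑-⊗ d∣N d y≢0) (trans (cong (_% d) (ℕ.+-comm d _)) ([m+n]%n≡m%n _ d)))))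
        (sym (decode-off b v y≢0)))

    encode-decode : ∀ w → encode (decode w) ≡ w
    encode-decode (b ∷ v) = cong₂ _∷_ (decode-centre b v)
      (lookup-ext λ r → trans (Vec.lookup∘tabulate _ r)
        (trans (decode-off b v (↑-≢0 (toℕ r) g≢0)) (cong (lookup v) (index r))))
      where
      index : ∀ r → orbit-index (g ↑ toℕ r) ≡ r
      index r = Fin.toℕ-injective (begin
        toℕ (orbit-index (g ↑ toℕ r))              ≡⟨ Fin.toℕ-fromℕ< _ ⟩
        log (g ↑ toℕ r) % d                        ≡⟨ m∣n⇒o%n%m≡o%m d ∣units∣ _ d∣N ⟨
        log (g ↑ toℕ r) % ∣units∣ % d              ≡⟨ cong (_% d) (g↑-injective _ _ (g↑log (↑-≢0 (toℕ r) g≢0))) ⟩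
        toℕ r % ∣units∣ % d                        ≡⟨ m∣n⇒o%n%m≡o%m d ∣units∣ _ d∣N ⟩
        toℕ r % d                                  ≡⟨ m<n⇒m%n≡m (Fin.toℕ<n r) ⟩
        toℕ r                                      ∎)
        where open ≡-Reasoning

    decode-encode : ∀ u → Dilation x₀ u d → decode (encode u) ≡ u
    decode-encode u E = lookup-ext λ x → subst (λ x → lookup (decode (encode u)) x ≡ lookup u x) (x+[y-x]≡y x₀ x) (at (x ⊕ (⊖ x₀)))
      where
      open ≡-Reasoning
      at : ∀ y → lookup (decode (encode u)) (x₀ ⊕ y) ≡ lookup u (x₀ ⊕ y)
      at y with y Fin.≟ 0F
      ... | yes refl = subst (λ x → lookup (decode (encode u)) x ≡ lookup u x) (sym (⊕-identityʳ x₀)) (decode-centre _ _)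
      ... | no  y≢0  = begin
        lookup (decode (encode u)) (x₀ ⊕ y)
          ≡⟨ decode-off _ _ y≢0 ⟩
        lookup (tabulate (λ r → lookup u (x₀ ⊕ (g ↑ toℕ r)))) (orbit-index y)
          ≡⟨ Vec.lookup∘tabulate _ (orbit-index y) ⟩
        lookup u (x₀ ⊕ (g ↑ toℕ (orbit-index y)))
          ≡⟨ cong (λ r → lookup u (x₀ ⊕ (g ↑ r))) (Fin.toℕ-fromℕ< (m%n<n (log y) d)) ⟩
        lookup u (x₀ ⊕ (g ↑ (log y % d)))
          ≡⟨ dilation-* x₀ u (log y / d) {d} E (g ↑ (log y % d)) ⟨
        lookup u (x₀ ⊕ ((g ↑ (log y / d * d)) ⊗ (g ↑ (log y % d))))
          ≡⟨ cong (λ z → lookup u (x₀ ⊕ z)) (trans (⊗-comm _ _) (trans (sym (^-homo-* g (log y % d) (log y / d * d)))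
               (trans (cong (g ↑_) (sym (m≡m%n+[m/n]*n (log y) d))) (g↑log y≢0)))) ⟩
        lookup u (x₀ ⊕ y) ∎

    count-dilation : ∑ (bitvecs p) (𝟙 ∘ dilation? x₀ d) ≡ 2 ^ suc d
    count-dilation = count-by-bijection (dilation? x₀ d) encode decode decode-dilation encode-decode decode-encode

    pointed-dilation? : Decidable (λ u → Dilation x₀ u d × lookup u x₀ ≡ false)
    pointed-dilation? u = dilation? x₀ d u ×-dec (lookup u x₀ Bool.≟ false)

    count-pointed-dilation : ∑ (bitvecs p) (𝟙 ∘ pointed-dilation?) ≡ 2 ^ d
    count-pointed-dilation = count-by-bijection pointed-dilation? (tail ∘ encode) (decode ∘ (false ∷_))
      (λ v → decode-dilation (false ∷ v) , decode-centre false v)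
      (λ v → cong tail (encode-decode (false ∷ v)))
      (λ u (E , z) → trans (cong (λ b → decode (b ∷ tail (encode u))) (sym z)) (decode-encode u E))

-- Orbits of the affine group on pairs of subsets of ℤ/p

module Configurations {p : ℕ} (𝔽 : FieldStructure p) where

  open InvariantSubsets 𝔽 public

  scale : F → Vec Bool p → Vec Bool p
  scale k A = tabulate (λ x → lookup A (k ⊗ x))

  affine : F → F → Vec Bool p → Vec Bool p
  affine k c B = tabulate (λ x → lookup B (k ⊗ x ⊕ c))

  lookup-scale : ∀ k A x → lookup (scale k A) x ≡ lookup A (k ⊗ x)
  lookup-scale k A x = Vec.lookup∘tabulate _ x

  lookup-affine : ∀ k c B x → lookup (affine k c B) x ≡ lookup B (k ⊗ x ⊕ c)
  lookup-affine k c B x = Vec.lookup∘tabulate _ x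

  Symmetric : Vec Bool p → Set
  Symmetric A = lookup A 0F ≡ false × (∀ x → lookup A (⊖ x) ≡ lookup A x)

  symmetric? : Decidable Symmetric
  symmetric? A = (lookup A 0F Bool.≟ false) ×-dec Fin.all? (λ x → lookup A (⊖ x) Bool.≟ lookup A x)

  Empty : Vec Bool p → Set
  Empty u = ∀ x → lookup u x ≡ false

  empty? : Decidable Empty
  empty? u = Fin.all? (λ x → lookup u x Bool.≟ false)

  ∅ : Vec Bool p
  ∅ = replicate p false

  empty⇒∅ : ∀ {u} → Empty u → ∅ ≡ u
  empty⇒∅ em = lookup-ext (λ x → trans (Vec.lookup-replicate x false) (sym (em x)))

  ∅-empty : Empty ∅
  ∅-empty x = Vec.lookup-replicate x false

  point : F → Vec Bool p
  point x₀ = tabulate (λ x → does (x Fin.≟ x₀))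

  lookup-point-≡ : ∀ x → lookup (point x) x ≡ true
  lookup-point-≡ x = trans (Vec.lookup∘tabulate _ x) (dec-true (x Fin.≟ x) refl)

  lookup-point-≢ : ∀ {x₀ x} → x ≢ x₀ → lookup (point x₀) x ≡ false
  lookup-point-≢ {x₀} {x} ne = trans (Vec.lookup∘tabulate _ x) (dec-false (x Fin.≟ x₀) ne)

  point-true : ∀ {x₀ x} → lookup (point x₀) x ≡ true → x ≡ x₀
  point-true {x₀} {x} eq with x Fin.≟ x₀
  ... | yes x≡ = x≡
  ... | no  x≢ = contradiction (trans (sym eq) (lookup-point-≢ x≢)) λ ()

  Singleton : Vec Bool p → Set
  Singleton u = ∃ λ x₀ → point x₀ ≡ u

  singleton? : Decidable Singleton
  singleton? u = Fin.any? (λ x₀ → point x₀ ≟ᵛ u)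

  singleton⇒¬empty : ∀ {u} → Singleton u → ¬ Empty u
  singleton⇒¬empty (x₀ , refl) em = contradiction (trans (sym (em x₀)) (lookup-point-≡ x₀)) λ ()

  Configuration : Set
  Configuration = Vec Bool p × Vec Bool p

  _≟ᶜ_ : DecidableEquality Configuration
  _≟ᶜ_ = Product.≡-dec _≟ᵛ_ _≟ᵛ_

  -- Exactly the configurations whose Cayley graph is connected.
  Joined : Configuration → Set
  Joined (A , B) = ¬ Empty B × ¬ (Empty A × Singleton B)

  joined? : Decidable Joined
  joined? (A , B) = ¬? (empty? B) ×-dec ¬? (empty? A ×-dec singleton? B)

  symmetrics : List (Vec Bool p)
  symmetrics = filter symmetric? (bitvecs p)

  ∈-symmetrics⁺ : ∀ {A} → Symmetric A → A ∈ symmetrics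
  ∈-symmetrics⁺ = ∈-filter⁺ symmetric? (∈-bitvecs _)

  ∈-symmetrics⁻ : ∀ {A} → A ∈ symmetrics → Symmetric A
  ∈-symmetrics⁻ A∈ = proj₂ (∈-filter⁻ symmetric? {xs = bitvecs p} A∈)

  symmetrics-unique : Unique symmetrics
  symmetrics-unique = Unique.filter⁺ symmetric? (bitvecs-unique p)

  configurations : List Configuration
  configurations = cartesianProduct symmetrics (bitvecs p)

  joinedConfigurations : List Configuration
  joinedConfigurations = filter joined? configurations

  joined-unique : Unique joinedConfigurations
  joined-unique = Unique.filter⁺ joined? (Unique.cartesianProduct⁺ symmetrics-unique (bitvecs-unique p))

  ∈-joined⁺ : ∀ {A B} → Symmetric A → Joined (A , B) → (A , B) ∈ joinedConfigurations
  ∈-joined⁺ sym-A j = ∈-filter⁺ joined? (∈-cartesianProduct⁺ (∈-symmetrics⁺ sym-A) (∈-bitvecs _)) j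

  ∈-joined⁻ : ∀ {A B} → (A , B) ∈ joinedConfigurations → Symmetric A × Joined (A , B)
  ∈-joined⁻ AB∈ with ∈-filter⁻ joined? {xs = configurations} AB∈
  ... | AB∈' , j = ∈-symmetrics⁻ (proj₁ (∈-cartesianProduct⁻ symmetrics (bitvecs p) AB∈')) , j

  recipF : F → F
  recipF k with k Fin.≟ 0F
  ... | yes _   = 0F
  ... | no  k≢0 = proj₁ (inverse k k≢0)

  recipF-inverse : ∀ {k} → k ≢ 0F → k ⊗ recipF k ≡ 1F
  recipF-inverse {k} k≢0 with k Fin.≟ 0F
  ... | yes k≡0 = contradiction k≡0 k≢0
  ... | no  ne  = proj₂ (inverse k ne)

  recipF-≢0 : ∀ {k} → k ≢ 0F → recipF k ≢ 0F
  recipF-≢0 {k} k≢0 eq = 1≢0 (trans (sym (recipF-inverse k≢0)) (trans (cong (k ⊗_) eq) (⊗-zeroʳ k)))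

  k⊗[k⁻¹⊗z]≡z : ∀ {k} → k ≢ 0F → ∀ z → k ⊗ (recipF k ⊗ z) ≡ z
  k⊗[k⁻¹⊗z]≡z {k} k≢0 z =
    trans (sym (⊗-assoc k (recipF k) z)) (trans (cong (_⊗ z) (recipF-inverse k≢0)) (⊗-identityˡ z))

  k⁻¹⊗[k⊗z]≡z : ∀ {k} → k ≢ 0F → ∀ z → recipF k ⊗ (k ⊗ z) ≡ z
  k⁻¹⊗[k⊗z]≡z {k} k≢0 z = trans (sym (⊗-assoc (recipF k) k z))
    (trans (cong (_⊗ z) (trans (⊗-comm (recipF k) k) (recipF-inverse k≢0))) (⊗-identityˡ z))

  Affine : Set
  Affine = F × F

  -- The multipliers are listed as powers of g, so that the sum over them becomes the sum over
  -- exponents i in `N′`.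
  affineMaps : List Affine
  affineMaps = cartesianProduct powers (allFin p)

  ∈-affineMaps⁺ : ∀ {k c} → k ≢ 0F → (k , c) ∈ affineMaps
  ∈-affineMaps⁺ k≢0 = ∈-cartesianProduct⁺ (units⊆powers k≢0) (∈-allFin _)

  ∈-affineMaps⁻ : ∀ {k c} → (k , c) ∈ affineMaps → k ≢ 0F
  ∈-affineMaps⁻ kc∈ = ∈-units⁻ (powers⊆units (proj₁ (∈-cartesianProduct⁻ powers (allFin p) kc∈)))

  affineMaps-unique : Unique affineMaps
  affineMaps-unique = Unique.cartesianProduct⁺ powers-unique (Unique.allFin⁺ p)

  act : Affine → Configuration → Configuration
  act (k , c) (A , B) = scale k A , affine k c B

  infixl 7 _∙_
  -- Subsets are acted on by substitution, which reverses composition: `g ∙ h` is the map applying g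
  -- and then h, and for this product `act` is a left action.
  _∙_ : Affine → Affine → Affine
  (k , c) ∙ (k' , c') = k' ⊗ k , k' ⊗ c ⊕ c'

  ε : Affine
  ε = 1F , 0F

  _⁻¹ : Affine → Affine
  (k , c) ⁻¹ = recipF k , recipF k ⊗ (⊖ c)

  act-cong : ∀ {k c k' c'} → k ≡ k' → c ≡ c' → ∀ x → act (k , c) x ≡ act (k' , c') x
  act-cong refl refl x = refl

  act-ε : ∀ x → act ε x ≡ x
  act-ε (A , B) = cong₂ _,_
    (lookup-ext (λ x → trans (lookup-scale 1F A x) (cong (lookup A) (⊗-identityˡ x))))
    (lookup-ext (λ x → trans (lookup-affine 1F 0F B x) (cong (lookup B) (trans (⊕-identityʳ _) (⊗-identityˡ x)))))

  act-∙ : ∀ g h x → act (g ∙ h) x ≡ act g (act h x)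
  act-∙ (k , c) (k' , c') (A , B) = cong₂ _,_
    (lookup-ext λ x → trans (lookup-scale (k' ⊗ k) A x) (trans (cong (lookup A) (⊗-assoc k' k x))
      (sym (trans (lookup-scale k (scale k' A) x) (lookup-scale k' A (k ⊗ x))))))
    (lookup-ext λ x → trans (lookup-affine (k' ⊗ k) (k' ⊗ c ⊕ c') B x) (trans (cong (lookup B) (lemma x))
      (sym (trans (lookup-affine k c (affine k' c' B) x) (lookup-affine k' c' B (k ⊗ x ⊕ c))))))
    where
    open SemiringSolver commutativeSemiring
    lemma : ∀ x → k' ⊗ k ⊗ x ⊕ (k' ⊗ c ⊕ c') ≡ k' ⊗ (k ⊗ x ⊕ c) ⊕ c'
    lemma = solve 5 (λ k c k' c' x → k' :* k :* x :+ (k' :* c :+ c') := k' :* (k :* x :+ c) :+ c') refl k c k' c'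

  act-⁻¹ : ∀ {g} → g ∈ affineMaps → ∀ x → act (g ⁻¹) (act g x) ≡ x
  act-⁻¹ {k , c} g∈ x = trans (sym (act-∙ ((k , c) ⁻¹) (k , c) x)) (trans
    (act-cong (recipF-inverse k≢0) (trans (cong (_⊕ c) (k⊗[k⁻¹⊗z]≡z k≢0 (⊖ c))) (⊖-inverseˡ c)) x) (act-ε x))
    where
    k≢0 : k ≢ 0F
    k≢0 = ∈-affineMaps⁻ g∈

  ∙-closed : ∀ {g h} → g ∈ affineMaps → h ∈ affineMaps → g ∙ h ∈ affineMaps
  ∙-closed g∈ h∈ = ∈-affineMaps⁺ (⊗-≢0 (∈-affineMaps⁻ h∈) (∈-affineMaps⁻ g∈))

  ⁻¹-closed : ∀ {g} → g ∈ affineMaps → g ⁻¹ ∈ affineMaps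
  ⁻¹-closed g∈ = ∈-affineMaps⁺ (recipF-≢0 (∈-affineMaps⁻ g∈))

  ∑-translate : ∀ {g} → g ∈ affineMaps → (f : Affine → ℕ) → ∑ affineMaps (λ h → f (h ∙ g)) ≡ ∑ affineMaps f
  ∑-translate {k , c} g∈ = ∑-bijection _≟_ _≟_ affineMaps-unique affineMaps-unique (_∙ (k , c)) (_∙ ((k , c) ⁻¹))
    (λ h∈ → ∙-closed h∈ g∈) (λ h∈ → ∙-closed h∈ (⁻¹-closed g∈))
    (λ {(j , e)} _ → cong₂ _,_ (k⁻¹⊗[k⊗z]≡z k≢0 j) (begin
      recipF k ⊗ (k ⊗ e ⊕ c) ⊕ recipF k ⊗ (⊖ c)   ≡⟨ ⊗-distribˡ (recipF k) (k ⊗ e ⊕ c) (⊖ c) ⟨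
      recipF k ⊗ (k ⊗ e ⊕ c ⊕ (⊖ c))              ≡⟨ cong (recipF k ⊗_) (trans (⊕-assoc (k ⊗ e) c (⊖ c))
                                                       (trans (cong (k ⊗ e ⊕_) (⊖-inverseʳ c)) (⊕-identityʳ (k ⊗ e)))) ⟩
      recipF k ⊗ (k ⊗ e)                          ≡⟨ k⁻¹⊗[k⊗z]≡z k≢0 e ⟩
      e                                           ∎))
    (λ {(j , e)} _ → cong₂ _,_ (k⊗[k⁻¹⊗z]≡z k≢0 j) (begin
      k ⊗ (recipF k ⊗ e ⊕ recipF k ⊗ (⊖ c)) ⊕ c   ≡⟨ cong (_⊕ c) (trans (cong (k ⊗_) (sym (⊗-distribˡ (recipF k) e (⊖ c)))) (k⊗[k⁻¹⊗z]≡z k≢0 (e ⊕ (⊖ c)))) ⟩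
      e ⊕ (⊖ c) ⊕ c                               ≡⟨ ⊕-assoc e (⊖ c) c ⟩
      e ⊕ ((⊖ c) ⊕ c)                             ≡⟨ trans (cong (e ⊕_) (⊖-inverseˡ c)) (⊕-identityʳ e) ⟩
      e                                           ∎))
    where
    open ≡-Reasoning
    k≢0 : k ≢ 0F
    k≢0 = ∈-affineMaps⁻ g∈
    _≟_ : DecidableEquality Affine
    _≟_ = Product.≡-dec Fin._≟_ Fin._≟_

  open Burnside _≟ᶜ_ affineMaps act _∙_ ε _⁻¹ (∈-affineMaps⁺ 1≢0) ∙-closed ⁻¹-closed act-ε act-∙ act-⁻¹ ∑-translate
    using (_~_; ~-sym; stab; Closed; Transversal; transversal) public

  joined-closed : Closed joinedConfigurations
  joined-closed {A , B} {k , c} g∈ AB∈ with ∈-joined⁻ AB∈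
  ... | (A0 , A-sym) , ¬emptyB , ¬thin = ∈-joined⁺ (zero-false , neg) (¬empty , ¬thin')
    where
    open RingProperties ring using (-‿distribʳ-*)
    k≢0 : k ≢ 0F
    k≢0 = ∈-affineMaps⁻ g∈
    zero-false : lookup (scale k A) 0F ≡ false
    zero-false = trans (lookup-scale k A 0F) (trans (cong (lookup A) (⊗-zeroʳ k)) A0)
    neg : ∀ x → lookup (scale k A) (⊖ x) ≡ lookup (scale k A) x
    neg x = trans (lookup-scale k A (⊖ x)) (trans (cong (lookup A) (sym (-‿distribʳ-* k x)))
      (trans (A-sym (k ⊗ x)) (sym (lookup-scale k A x))))
    preimage : F → F
    preimage y = recipF k ⊗ (y ⊕ (⊖ c))
    image-preimage : ∀ y → k ⊗ preimage y ⊕ c ≡ y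
    image-preimage y = trans (cong (_⊕ c) (k⊗[k⁻¹⊗z]≡z k≢0 (y ⊕ (⊖ c))))
      (trans (⊕-assoc y (⊖ c) c) (trans (cong (y ⊕_) (⊖-inverseˡ c)) (⊕-identityʳ y)))
    ¬empty : ¬ Empty (affine k c B)
    ¬empty em = ¬emptyB λ y → trans (cong (lookup B) (sym (image-preimage y)))
      (trans (sym (lookup-affine k c B (preimage y))) (em (preimage y)))
    ¬thin' : ¬ (Empty (scale k A) × Singleton (affine k c B))
    ¬thin' (emA , x₀ , pt) = ¬thin (emptyA , k ⊗ x₀ ⊕ c , lookup-ext at)
      where
      emptyA : Empty A
      emptyA y = trans (cong (lookup A) (sym (k⊗[k⁻¹⊗z]≡z k≢0 y)))
        (trans (sym (lookup-scale k A (recipF k ⊗ y))) (emA (recipF k ⊗ y)))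
      B-at : ∀ y → lookup B y ≡ lookup (point x₀) (preimage y)
      B-at y = trans (cong (lookup B) (sym (image-preimage y)))
        (trans (sym (lookup-affine k c B (preimage y))) (cong (λ u → lookup u (preimage y)) (sym pt)))
      at : ∀ y → lookup (point (k ⊗ x₀ ⊕ c)) y ≡ lookup B y
      at y with preimage y Fin.≟ x₀
      ... | yes refl = trans (trans (cong (lookup (point _)) (sym (image-preimage y))) (lookup-point-≡ _))
                         (sym (trans (B-at y) (lookup-point-≡ _)))
      ... | no  ne   = trans (lookup-point-≢ (λ { refl → ne (trans (cong (recipF k ⊗_) (trans (⊕-assoc (k ⊗ x₀) c (⊖ c))
                           (trans (cong (k ⊗ x₀ ⊕_) (⊖-inverseʳ c)) (⊕-identityʳ _)))) (k⁻¹⊗[k⊗z]≡z k≢0 x₀)) }))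
                         (sym (trans (B-at y) (lookup-point-≢ ne)))

  representatives : Transversal joinedConfigurations
  representatives = transversal joinedConfigurations joined-unique joined-closed

-- Fixed points of affine maps and Burnside's sum

module OrbitCount {p : ℕ} (𝔽 : FieldStructure p) (m : ℕ) .{{_ : NonZero m}} where

  open Configurations 𝔽

  ∑-allFin-const : ∀ c → ∑ (allFin p) (λ _ → c) ≡ p * c
  ∑-allFin-const c = trans (∑-const (allFin p) c) (cong (_* c) {length (allFin p)} {p} (List.length-tabulate id))

  fixedA : F → Vec Bool p → ℕ
  fixedA k A = 𝟙 (scale k A ≟ᵛ A)

  fixedB : F → F → Vec Bool p → ℕ
  fixedB k c B = 𝟙 (affine k c B ≟ᵛ B)

  stab-product : ∀ A B → stab (A , B) ≡ ∑ powers (λ k → ∑ (allFin p) (λ c → fixedA k A * fixedB k c B))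
  stab-product A B = trans (∑-cartesianProduct powers (allFin p) _)
    (∑-cong′ powers λ k → ∑-cong′ (allFin p) λ c →
      trans (𝟙-cong ((scale k A , affine k c B) ≟ᶜ (A , B)) ((scale k A ≟ᵛ A) ×-dec (affine k c B ≟ᵛ B))
              Product.,-injective (λ (a , b) → cong₂ _,_ a b))
            (𝟙-× (scale k A ≟ᵛ A) (affine k c B ≟ᵛ B)))

  -- The other half of Burnside's lemma: exchanging summations turns stabilisers into fixed points,
  -- and a product weight lets the sums over A and over B separate. The weights serve to single out
  -- the two families of pairs that are not joined, each given by a condition on A times a condition
  -- on B.
  ∑-weighted-stab : ∀ (α β : Vec Bool p → ℕ) →
    ∑ configurations (λ (A , B) → α A * β B * stab (A , B)) ≡
    ∑ powers (λ k → ∑ (allFin p) (λ c → ∑ symmetrics (λ A → α A * fixedA k A) * ∑ (bitvecs p) (λ B → β B * fixedB k c B)))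
  ∑-weighted-stab α β = begin
    ∑ configurations (λ (A , B) → α A * β B * stab (A , B))
      ≡⟨ ∑-cartesianProduct symmetrics (bitvecs p) _ ⟩
    ∑ symmetrics (λ A → ∑ (bitvecs p) (λ B → α A * β B * stab (A , B)))
      ≡⟨ ∑-cong′ symmetrics (λ A → trans (∑-cong′ (bitvecs p) (expand A)) (swap₂ (bitvecs p) _)) ⟩
    ∑ symmetrics (λ A → ∑ powers (λ k → ∑ (allFin p) (λ c → ∑ (bitvecs p) (λ B → α A * fixedA k A * (β B * fixedB k c B)))))
      ≡⟨ swap₂ symmetrics _ ⟩
    ∑ powers (λ k → ∑ (allFin p) (λ c → ∑ symmetrics (λ A → ∑ (bitvecs p) (λ B → α A * fixedA k A * (β B * fixedB k c B)))))
      ≡⟨ ∑-cong′ powers (λ k → ∑-cong′ (allFin p) (λ c → trans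
           (∑-cong′ symmetrics (λ A → ∑-*ˡ (bitvecs p) (α A * fixedA k A) (λ B → β B * fixedB k c B)))
           (∑-*ʳ symmetrics (∑ (bitvecs p) (λ B → β B * fixedB k c B)) (λ A → α A * fixedA k A)))) ⟩
    ∑ powers (λ k → ∑ (allFin p) (λ c → ∑ symmetrics (λ A → α A * fixedA k A) * ∑ (bitvecs p) (λ B → β B * fixedB k c B)))
      ∎
    where
    open ≡-Reasoning
    swap₂ : ∀ {X : Set} (xs : List X) (f : X → F → F → ℕ) →
            ∑ xs (λ x → ∑ powers (λ k → ∑ (allFin p) (f x k))) ≡ ∑ powers (λ k → ∑ (allFin p) (λ c → ∑ xs (λ x → f x k c)))
    swap₂ xs f = trans (∑-swap xs powers (λ x k → ∑ (allFin p) (f x k)))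
      (∑-cong′ powers (λ k → ∑-swap xs (allFin p) (λ x → f x k)))
    rearrange : ∀ a b c d → a * b * (c * d) ≡ a * c * (b * d)
    rearrange = solve-∀
    expand : ∀ A B → α A * β B * stab (A , B) ≡ ∑ powers (λ k → ∑ (allFin p) (λ c → α A * fixedA k A * (β B * fixedB k c B)))
    expand A B = begin
      α A * β B * stab (A , B)
        ≡⟨ cong (α A * β B *_) (stab-product A B) ⟩
      α A * β B * ∑ powers (λ k → ∑ (allFin p) (λ c → fixedA k A * fixedB k c B))
        ≡⟨ ∑-*ˡ powers (α A * β B) (λ k → ∑ (allFin p) (λ c → fixedA k A * fixedB k c B)) ⟨
      ∑ powers (λ k → α A * β B * ∑ (allFin p) (λ c → fixedA k A * fixedB k c B))
        ≡⟨ ∑-cong′ powers (λ k → trans (sym (∑-*ˡ (allFin p) (α A * β B) (λ c → fixedA k A * fixedB k c B)))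
             (∑-cong′ (allFin p) (λ c → rearrange (α A) (β B) (fixedA k A) (fixedB k c B)))) ⟩
      ∑ powers (λ k → ∑ (allFin p) (λ c → α A * fixedA k A * (β B * fixedB k c B)))
        ∎

  -- The two excluded families are disjoint because a singleton is nonempty. The factor `1 *` gives
  -- the middle term the shape α A * β B of `∑-weighted-stab`.
  joined-partition : ∀ A B →
    1 ≡ 𝟙 (joined? (A , B)) + 1 * 𝟙 (empty? B) + 𝟙 (empty? A) * 𝟙 (singleton? B)
  joined-partition A B = lemma (empty? A) (empty? B) (singleton? B) singleton⇒¬empty
    where
    lemma : ∀ {EA EB SB : Set} (ea : Dec EA) (eb : Dec EB) (sb : Dec SB) → (SB → ¬ EB) →
      1 ≡ 𝟙 (¬? eb ×-dec ¬? (ea ×-dec sb)) + 1 * 𝟙 eb + 𝟙 ea * 𝟙 sb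
    lemma (yes _) (yes e) (yes s) h = contradiction e (h s)
    lemma (no _)  (yes e) (yes s) h = contradiction e (h s)
    lemma (yes _) (yes _) (no _)  h = refl
    lemma (no _)  (yes _) (no _)  h = refl
    lemma (yes _) (no _)  (yes _) h = refl
    lemma (no _)  (no _)  (yes _) h = refl
    lemma (yes _) (no _)  (no _)  h = refl
    lemma (no _)  (no _)  (no _)  h = refl

  private
    total emptyTotal singletonTotal : ℕ
    total          = ∑ configurations (λ (A , B) → 1 * 1 * stab (A , B))
    emptyTotal     = ∑ configurations (λ (A , B) → 1 * 𝟙 (empty? B) * stab (A , B))
    singletonTotal = ∑ configurations (λ (A , B) → 𝟙 (empty? A) * 𝟙 (singleton? B) * stab (A , B))

  total-partition : total ≡ ∑ joinedConfigurations stab + emptyTotal + singletonTotal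
  total-partition = begin
    total
      ≡⟨ ∑-cong′ configurations (λ (A , B) → split A B) ⟩
    ∑ configurations (λ x → j x + e x + s x)
      ≡⟨ trans (∑-+ configurations (λ x → j x + e x) s) (cong (_+ singletonTotal) (∑-+ configurations j e)) ⟩
    ∑ configurations j + emptyTotal + singletonTotal
      ≡⟨ cong (λ t → t + emptyTotal + singletonTotal) (∑-filter joined? configurations stab) ⟨
    ∑ joinedConfigurations stab + emptyTotal + singletonTotal
      ∎
    where
    open ≡-Reasoning
    j e s : Configuration → ℕ
    j x       = 𝟙 (joined? x) * stab x
    e (A , B) = 1 * 𝟙 (empty? B) * stab (A , B)
    s (A , B) = 𝟙 (empty? A) * 𝟙 (singleton? B) * stab (A , B)
    split : ∀ A B → 1 * 1 * stab (A , B) ≡ j (A , B) + e (A , B) + s (A , B)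
    split A B = trans (cong (_* stab (A , B)) (joined-partition A B))
      (distrib (𝟙 (joined? (A , B))) (1 * 𝟙 (empty? B)) (𝟙 (empty? A) * 𝟙 (singleton? B)) (stab (A , B)))
      where
      distrib : ∀ a b c t → (a + b + c) * t ≡ a * t + b * t + c * t
      distrib = solve-∀

  fixed-∅B : ∀ k c → ∑ (bitvecs p) (λ B → 𝟙 (empty? B) * fixedB k c B) ≡ 1
  fixed-∅B k c = begin
    ∑ (bitvecs p) (λ B → 𝟙 (empty? B) * fixedB k c B)
      ≡⟨ ∑-cong′ (bitvecs p) (λ B → cong (_* fixedB k c B) (𝟙-cong (empty? B) (∅ ≟ᵛ B) empty⇒∅ (λ { refl → ∅-empty }))) ⟩
    ∑ (bitvecs p) (λ B → 𝟙 (∅ ≟ᵛ B) * fixedB k c B)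
      ≡⟨ ∑-indicator _≟ᵛ_ (bitvecs-unique p) (∈-bitvecs ∅) (fixedB k c) ⟩
    fixedB k c ∅
      ≡⟨ 𝟙-yes (affine k c ∅ ≟ᵛ ∅) (lookup-ext (λ x → trans (lookup-affine k c ∅ x) (trans (∅-empty _) (sym (∅-empty x))))) ⟩
    1 ∎
    where open ≡-Reasoning

  fixed-∅A : ∀ k → ∑ symmetrics (λ A → 𝟙 (empty? A) * fixedA k A) ≡ 1
  fixed-∅A k = begin
    ∑ symmetrics (λ A → 𝟙 (empty? A) * fixedA k A)
      ≡⟨ ∑-cong′ symmetrics (λ A → cong (_* fixedA k A) (𝟙-cong (empty? A) (∅ ≟ᵛ A) empty⇒∅ (λ { refl → ∅-empty }))) ⟩
    ∑ symmetrics (λ A → 𝟙 (∅ ≟ᵛ A) * fixedA k A)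
      ≡⟨ ∑-indicator _≟ᵛ_ symmetrics-unique (∈-symmetrics⁺ (∅-empty 0F , λ x → trans (∅-empty (⊖ x)) (sym (∅-empty x)))) (fixedA k) ⟩
    fixedA k ∅
      ≡⟨ 𝟙-yes (scale k ∅ ≟ᵛ ∅) (lookup-ext (λ x → trans (lookup-scale k ∅ x) (trans (∅-empty _) (sym (∅-empty x))))) ⟩
    1 ∎
    where open ≡-Reasoning

  -- A singleton is fixed exactly when its point is, and x₀ = k x₀ + c holds for a single c. As an
  -- indicator in c it sums to 1.
  fixed-point : ∀ {k} → k ≢ 0F → ∀ c x₀ → fixedB k c (point x₀) ≡ 𝟙 (x₀ ⊕ (⊖ (k ⊗ x₀)) Fin.≟ c)
  fixed-point {k} k≢0 c x₀ = 𝟙-cong (affine k c (point x₀) ≟ᵛ point x₀) (x₀ ⊕ (⊖ (k ⊗ x₀)) Fin.≟ c) to from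
    where
    to : affine k c (point x₀) ≡ point x₀ → x₀ ⊕ (⊖ (k ⊗ x₀)) ≡ c
    to eq = trans (cong (_⊕ (⊖ (k ⊗ x₀))) (sym fixed)) (xyx⁻¹≈y (k ⊗ x₀) c)
      where
      fixed : k ⊗ x₀ ⊕ c ≡ x₀
      fixed = point-true (trans (sym (lookup-affine k c (point x₀) x₀))
        (trans (cong (λ u → lookup u x₀) eq) (lookup-point-≡ x₀)))
    from : x₀ ⊕ (⊖ (k ⊗ x₀)) ≡ c → affine k c (point x₀) ≡ point x₀
    from refl = lookup-ext λ x → trans (lookup-affine k c' (point x₀) x) (at x)
      where
      c' : F
      c' = x₀ ⊕ (⊖ (k ⊗ x₀))
      fixes : k ⊗ x₀ ⊕ c' ≡ x₀
      fixes = x+[y-x]≡y (k ⊗ x₀) x₀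
      at : ∀ x → lookup (point x₀) (k ⊗ x ⊕ c') ≡ lookup (point x₀) x
      at x with x Fin.≟ x₀
      ... | yes refl = cong (lookup (point x₀)) fixes
      ... | no  ne   = trans (lookup-point-≢ (λ eq → ne (⊗-cancelˡ k k≢0 (∙-cancelʳ c' _ _ (trans eq (sym fixes))))))
                         (sym (lookup-point-≢ ne))

  point-injective : ∀ {x y} → point x ≡ point y → x ≡ y
  point-injective {x} {y} eq = point-true (trans (cong (λ u → lookup u x) (sym eq)) (lookup-point-≡ x))

  𝟙-singleton : ∀ B → 𝟙 (singleton? B) ≡ ∑ (allFin p) (λ x₀ → 𝟙 (point x₀ ≟ᵛ B))
  𝟙-singleton B = lemma (singleton? B)
    where
    lemma : (d : Dec (Singleton B)) → 𝟙 d ≡ ∑ (allFin p) (λ x₀ → 𝟙 (point x₀ ≟ᵛ B))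
    lemma (yes (x₀ , refl)) = sym (trans
      (∑-cong′ (allFin p) (λ x → 𝟙-cong (point x ≟ᵛ point x₀) (x₀ Fin.≟ x) (sym ∘ point-injective) (λ { refl → refl })))
      (∑-indicator-1 Fin._≟_ (Unique.allFin⁺ p) (∈-allFin x₀)))
    lemma (no ¬s) = sym (∑-zero (allFin p) (λ {x} _ → 𝟙-no (point x ≟ᵛ B) (λ eq → ¬s (x , eq))))

  fixed-singletons : ∀ {k} → k ≢ 0F → ∀ c →
    ∑ (bitvecs p) (λ B → 𝟙 (singleton? B) * fixedB k c B) ≡ ∑ (allFin p) (λ x₀ → 𝟙 (x₀ ⊕ (⊖ (k ⊗ x₀)) Fin.≟ c))
  fixed-singletons {k} k≢0 c = begin
    ∑ (bitvecs p) (λ B → 𝟙 (singleton? B) * fixedB k c B)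
      ≡⟨ ∑-cong′ (bitvecs p) (λ B → trans (cong (_* fixedB k c B) (𝟙-singleton B)) (sym (∑-*ʳ (allFin p) (fixedB k c B) (λ x₀ → 𝟙 (point x₀ ≟ᵛ B))))) ⟩
    ∑ (bitvecs p) (λ B → ∑ (allFin p) (λ x₀ → 𝟙 (point x₀ ≟ᵛ B) * fixedB k c B))
      ≡⟨ ∑-swap (bitvecs p) (allFin p) (λ B x₀ → 𝟙 (point x₀ ≟ᵛ B) * fixedB k c B) ⟩
    ∑ (allFin p) (λ x₀ → ∑ (bitvecs p) (λ B → 𝟙 (point x₀ ≟ᵛ B) * fixedB k c B))
      ≡⟨ ∑-cong′ (allFin p) (λ x₀ → trans (∑-indicator _≟ᵛ_ (bitvecs-unique p) (∈-bitvecs (point x₀)) (fixedB k c)) (fixed-point k≢0 c x₀)) ⟩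
    ∑ (allFin p) (λ x₀ → 𝟙 (x₀ ⊕ (⊖ (k ⊗ x₀)) Fin.≟ c))
      ∎
    where open ≡-Reasoning

  -- For each multiplier and each point exactly one c fixes the point. The total is the order of the
  -- affine group, so this family is a single orbit: the final 1 of the formula.
  singletonTotal≡ : singletonTotal ≡ ∣units∣ * p
  singletonTotal≡ = begin
    singletonTotal
      ≡⟨ ∑-weighted-stab (𝟙 ∘ empty?) (𝟙 ∘ singleton?) ⟩
    ∑ powers (λ k → ∑ (allFin p) (λ c → ∑ symmetrics (λ A → 𝟙 (empty? A) * fixedA k A) * ∑ (bitvecs p) (λ B → 𝟙 (singleton? B) * fixedB k c B)))
      ≡⟨ ∑-cong powers (λ {k} k∈ → trans (∑-cong′ (allFin p) (λ c → trans
           (cong₂ _*_ (fixed-∅A k) (fixed-singletons (∈-units⁻ (powers⊆units k∈)) c)) (ℕ.*-identityˡ _))) (per-k k)) ⟩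
    ∑ powers (λ _ → p)
      ≡⟨ ∑-const powers p ⟩
    length powers * p
      ≡⟨ cong (_* p) (trans (List.length-map (g ↑_) (upTo ∣units∣)) (List.length-upTo ∣units∣)) ⟩
    ∣units∣ * p ∎
    where
    open ≡-Reasoning
    per-k : ∀ k → ∑ (allFin p) (λ c → ∑ (allFin p) (λ x₀ → 𝟙 (x₀ ⊕ (⊖ (k ⊗ x₀)) Fin.≟ c))) ≡ p
    per-k k = trans (∑-swap (allFin p) (allFin p) (λ c x₀ → 𝟙 (x₀ ⊕ (⊖ (k ⊗ x₀)) Fin.≟ c)))
      (trans (∑-cong′ (allFin p) (λ x₀ → ∑-indicator-1 Fin._≟_ (Unique.allFin⁺ p) (∈-allFin (x₀ ⊕ (⊖ (k ⊗ x₀))))))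
        (trans (∑-1 (allFin p)) (List.length-tabulate id)))

  ∑-powers : ∀ (f : F → ℕ) → ∑ powers f ≡ ∑ (upTo ∣units∣) (λ i → f (g ↑ i))
  ∑-powers = ∑-map (g ↑_) (upTo ∣units∣)

  module _ (N≡m+m : ∣units∣ ≡ m + m) where

    private
      m∣N : m ∣ ∣units∣
      m∣N = divides 2 (trans N≡m+m (cong (m +_) (sym (ℕ.+-identityʳ m))))

      gcd-m-nonZero : ∀ i → NonZero (gcd i m)
      gcd-m-nonZero i = ≢-nonZero (GCD.gcd[m,n]≢0 i m (inj₂ (≢-nonZero⁻¹ m)))

      gcd-N-nonZero : ∀ i → NonZero (gcd i ∣units∣)
      gcd-N-nonZero i = ≢-nonZero (GCD.gcd[m,n]≢0 i ∣units∣ (inj₂ (≢-nonZero⁻¹ ∣units∣)))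

    -- Negation is multiplication by g ↑ m, so symmetry and invariance under g ↑ i amount to invariance under g ↑ gcd i m.
    fixedA-count : ∀ i → ∑ symmetrics (fixedA (g ↑ i)) ≡ 2 ^ gcd i m
    fixedA-count i = trans (∑-filter symmetric? (bitvecs p) (fixedA (g ↑ i)))
      (trans (∑-cong′ (bitvecs p) equivalent) (count-pointed-dilation 0F (gcd i m) d∣N))
      where
      open RingProperties ring using (-1*x≈-x)
      instance
        _ = gcd-m-nonZero i
      d∣N : gcd i m ∣ ∣units∣
      d∣N = ∣-trans (GCD.gcd[m,n]∣n i m) m∣N
      g↑m⊗ : ∀ y → (g ↑ m) ⊗ y ≡ ⊖ y
      g↑m⊗ y = trans (cong (_⊗ y) (g↑half≡-1 m N≡m+m)) (-1*x≈-x y)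
      centred : ∀ A e → (∀ y → lookup A ((g ↑ e) ⊗ y) ≡ lookup A y) → Dilation 0F A e
      centred A e h y = trans (cong (lookup A) (⊕-identityˡ _)) (trans (h y) (cong (lookup A) (sym (⊕-identityˡ y))))
      uncentred : ∀ A e → Dilation 0F A e → ∀ y → lookup A ((g ↑ e) ⊗ y) ≡ lookup A y
      uncentred A e h y = trans (cong (lookup A) (sym (⊕-identityˡ _))) (trans (h y) (cong (lookup A) (⊕-identityˡ y)))
      equivalent : ∀ A → 𝟙 (symmetric? A) * fixedA (g ↑ i) A ≡ 𝟙 (pointed-dilation? 0F (gcd i m) d∣N A)
      equivalent A = trans (sym (𝟙-× (symmetric? A) (scale (g ↑ i) A ≟ᵛ A)))
        (𝟙-cong (symmetric? A ×-dec (scale (g ↑ i) A ≟ᵛ A)) (pointed-dilation? 0F (gcd i m) d∣N A) to from)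
        where
        to : Symmetric A × scale (g ↑ i) A ≡ A → Dilation 0F A (gcd i m) × lookup A 0F ≡ false
        to ((A0 , A-sym) , inv) = dilation-gcd 0F A i m
          (centred A i (λ y → trans (sym (lookup-scale (g ↑ i) A y)) (cong (λ u → lookup u y) inv)))
          (centred A m (λ y → trans (cong (lookup A) (g↑m⊗ y)) (A-sym y))) , A0
        from : Dilation 0F A (gcd i m) × lookup A 0F ≡ false → Symmetric A × scale (g ↑ i) A ≡ A
        from (dil , A0) = (A0 , λ x → trans (cong (lookup A) (sym (g↑m⊗ x)))
            (uncentred A m (dilation-∣ 0F A (GCD.gcd[m,n]∣n i m) dil) x)) ,
          lookup-ext λ x → trans (lookup-scale (g ↑ i) A x) (uncentred A i (dilation-∣ 0F A (GCD.gcd[m,n]∣m i m) dil) x)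

    -- Every translation part c leaves B = ∅ alone, whence the factor p. Divided by the order of the
    -- affine group this total becomes `Nc′`.
    emptyTotal≡ : emptyTotal ≡ p * ∑ (upTo ∣units∣) (λ i → 2 ^ gcd i m)
    emptyTotal≡ = begin
      emptyTotal
        ≡⟨ ∑-weighted-stab (λ _ → 1) (𝟙 ∘ empty?) ⟩
      ∑ powers (λ k → ∑ (allFin p) (λ c → ∑ symmetrics (λ A → 1 * fixedA k A) * ∑ (bitvecs p) (λ B → 𝟙 (empty? B) * fixedB k c B)))
        ≡⟨ ∑-cong′ powers (λ k → trans (∑-cong′ (allFin p) (λ c → trans
             (cong₂ _*_ (∑-cong′ symmetrics (λ A → ℕ.*-identityˡ (fixedA k A))) (fixed-∅B k c)) (ℕ.*-identityʳ (∑ symmetrics (fixedA k)))))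
             (∑-allFin-const (∑ symmetrics (fixedA k)))) ⟩
      ∑ powers (λ k → p * ∑ symmetrics (fixedA k))
        ≡⟨ trans (∑-*ˡ powers p (λ k → ∑ symmetrics (fixedA k))) (cong (p *_) (∑-powers (λ k → ∑ symmetrics (fixedA k)))) ⟩
      p * ∑ (upTo ∣units∣) (λ i → ∑ symmetrics (fixedA (g ↑ i)))
        ≡⟨ cong (p *_) (∑-cong′ (upTo ∣units∣) fixedA-count) ⟩
      p * ∑ (upTo ∣units∣) (λ i → 2 ^ gcd i m) ∎
      where open ≡-Reasoning

    -- With k = g^i ≠ 1 the map has the fixed point x₀ = c / (1 - k), about which it is the
    -- homothety of ratio k. Since g^∣units∣ = 1, invariance under g^i is invariance under the gcd
    -- exponent.
    fixedB-count : ∀ i c → g ↑ i ≢ 1F → ∑ (bitvecs p) (fixedB (g ↑ i) c) ≡ 2 ^ suc (gcd i ∣units∣)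
    fixedB-count i c k≢1 = trans (∑-cong′ (bitvecs p) equivalent)
      (count-dilation x₀ (gcd i ∣units∣) (GCD.gcd[m,n]∣n i ∣units∣))
      where
      open ≡-Reasoning
      instance
        _ = gcd-N-nonZero i
      k δ x₀ : F
      k = g ↑ i
      δ = 1F ⊕ (⊖ k)
      x₀ = recipF δ ⊗ c
      δ≢0 : δ ≢ 0F
      δ≢0 eq = k≢1 (trans (sym (⊕-identityʳ k)) (trans (cong (k ⊕_) (sym eq)) (x+[y-x]≡y k 1F)))
      fixes : k ⊗ x₀ ⊕ c ≡ x₀
      fixes = begin
        k ⊗ x₀ ⊕ c          ≡⟨ cong (k ⊗ x₀ ⊕_) (k⊗[k⁻¹⊗z]≡z δ≢0 c) ⟨
        k ⊗ x₀ ⊕ δ ⊗ x₀     ≡⟨ ⊗-distribʳ x₀ k δ ⟨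
        (k ⊕ δ) ⊗ x₀        ≡⟨ cong (_⊗ x₀) (x+[y-x]≡y k 1F) ⟩
        1F ⊗ x₀             ≡⟨ ⊗-identityˡ x₀ ⟩
        x₀                  ∎
      recentre : ∀ y → k ⊗ (x₀ ⊕ y) ⊕ c ≡ x₀ ⊕ k ⊗ y
      recentre y = begin
        k ⊗ (x₀ ⊕ y) ⊕ c         ≡⟨ solve 4 (λ k x y c → k :* (x :+ y) :+ c := (k :* x :+ c) :+ k :* y) refl k x₀ y c ⟩
        k ⊗ x₀ ⊕ c ⊕ k ⊗ y       ≡⟨ cong (_⊕ k ⊗ y) fixes ⟩
        x₀ ⊕ k ⊗ y               ∎
        where open SemiringSolver commutativeSemiring
      equivalent : ∀ B → fixedB k c B ≡ 𝟙 (dilation? x₀ (gcd i ∣units∣) B)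
      equivalent B = 𝟙-cong (affine k c B ≟ᵛ B) (dilation? x₀ (gcd i ∣units∣) B) to from
        where
        to : affine k c B ≡ B → Dilation x₀ B (gcd i ∣units∣)
        to inv = dilation-gcd x₀ B i ∣units∣ (λ y → trans (cong (lookup B) (sym (recentre y)))
          (trans (sym (lookup-affine k c B (x₀ ⊕ y))) (cong (λ u → lookup u (x₀ ⊕ y)) inv))) (dilation-N x₀ B)
        from : Dilation x₀ B (gcd i ∣units∣) → affine k c B ≡ B
        from dil = lookup-ext λ x → trans (lookup-affine k c B x)
          (subst (λ x → lookup B (k ⊗ x ⊕ c) ≡ lookup B x) (x+[y-x]≡y x₀ x)
            (trans (cong (lookup B) (recentre (x ⊕ (⊖ x₀))))
              (dilation-∣ x₀ B {e = i} (GCD.gcd[m,n]∣m i ∣units∣) dil (x ⊕ (⊖ x₀)))))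

    -- A nonzero translation is transitive on ℤ/p, so only the empty and the full subset are
    -- invariant.
    translation-count : ∀ c → c ≢ 0F → ∑ (bitvecs p) (fixedB 1F c) ≡ 2
    translation-count c c≢0 = count-by-bijection (λ B → affine 1F c B ≟ᵛ B)
      (λ u → lookup u 0F ∷ []) (λ { (b ∷ []) → replicate p b })
      (λ { (b ∷ []) → lookup-ext λ x → trans (lookup-affine 1F c (replicate p b) x)
             (trans (Vec.lookup-replicate (1F ⊗ x ⊕ c) b) (sym (Vec.lookup-replicate x b))) })
      (λ { (b ∷ []) → cong (_∷ []) (Vec.lookup-replicate 0F b) })
      (λ u inv → lookup-ext λ x → trans (Vec.lookup-replicate x (lookup u 0F))
        (sym (translate-induction c≢0 (λ x → lookup u x ≡ lookup u 0F) (λ x eq → trans (invariant u inv x) eq) 0F x refl)))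
      where
      invariant : ∀ u → affine 1F c u ≡ u → ∀ x → lookup u (x ⊕ c) ≡ lookup u x
      invariant u inv x = trans (cong (λ z → lookup u (z ⊕ c)) (sym (⊗-identityˡ x)))
        (trans (sym (lookup-affine 1F c u x)) (cong (λ v → lookup v x) inv))

    identity-count : ∑ (bitvecs p) (fixedB 1F 0F) ≡ 2 ^ p
    identity-count = trans (∑-cong′ (bitvecs p) (λ B → 𝟙-yes (affine 1F 0F B ≟ᵛ B) (cong proj₂ (act-ε (B , B)))))
      (trans (∑-1 (bitvecs p)) (length-allVecs bools p))

    translations-count : ∑ (allFin p) (λ c → ∑ (bitvecs p) (fixedB 1F c)) ≡ 2 ^ p + ∣units∣ * 2
    translations-count = begin
      ∑ (allFin p) (λ c → ∑ (bitvecs p) (fixedB 1F c))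
        ≡⟨ ∑-cong′ (allFin p) split ⟩
      ∑ (allFin p) (λ c → 𝟙 (0F Fin.≟ c) * 2 ^ p + 𝟙 (¬? (c Fin.≟ 0F)) * 2)
        ≡⟨ ∑-+ (allFin p) (λ c → 𝟙 (0F Fin.≟ c) * 2 ^ p) (λ c → 𝟙 (¬? (c Fin.≟ 0F)) * 2) ⟩
      ∑ (allFin p) (λ c → 𝟙 (0F Fin.≟ c) * 2 ^ p) + ∑ (allFin p) (λ c → 𝟙 (¬? (c Fin.≟ 0F)) * 2)
        ≡⟨ cong₂ _+_ (∑-indicator Fin._≟_ (Unique.allFin⁺ p) (∈-allFin 0F) (λ _ → 2 ^ p))
             (trans (∑-*ʳ (allFin p) 2 (λ c → 𝟙 (¬? (c Fin.≟ 0F)))) (cong (_* 2) (sym (length-filter (λ c → ¬? (c Fin.≟ 0F)) (allFin p))))) ⟩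
      2 ^ p + ∣units∣ * 2 ∎
      where
      open ≡-Reasoning
      split : ∀ c → ∑ (bitvecs p) (fixedB 1F c) ≡ 𝟙 (0F Fin.≟ c) * 2 ^ p + 𝟙 (¬? (c Fin.≟ 0F)) * 2
      split c = lemma (c Fin.≟ 0F)
        where
        lemma : (d : Dec (c ≡ 0F)) → ∑ (bitvecs p) (fixedB 1F c) ≡ 𝟙 (0F Fin.≟ c) * 2 ^ p + 𝟙 (¬? d) * 2
        lemma (yes refl) = trans identity-count (sym (trans (ℕ.+-identityʳ _)
          (trans (cong (_* 2 ^ p) (𝟙-yes (0F Fin.≟ 0F) refl)) (ℕ.*-identityˡ (2 ^ p)))))
        lemma (no c≢0)   = trans (translation-count c c≢0) (sym (cong (λ b → b * 2 ^ p + 2) (𝟙-no (0F Fin.≟ c) (c≢0 ∘ sym))))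

    private
      gcdSum : ℕ
      gcdSum = ∑ (upTo ∣units∣) (λ i → 2 ^ gcd i m * 2 ^ gcd i ∣units∣)

    -- The count for i ≠ 0 fails for multiplier 1, where the maps are translations. The generic
    -- value at i = 0 is added on the left and the true one on the right, which avoids subtraction
    -- in ℕ.
    total≡ : total + 2 ^ m * (p * 2 ^ suc ∣units∣) ≡ 2 * p * gcdSum + 2 ^ m * (2 ^ p + ∣units∣ * 2)
    total≡ = begin
      total + a
        ≡⟨ cong (_+ a) (trans (∑-weighted-stab (λ _ → 1) (λ _ → 1)) (∑-powers _)) ⟩
      ∑ (upTo N) t + a
        ≡⟨ cong (∑ (upTo N) t +_) (∑-indicator ℕ._≟_ (Unique.upTo⁺ N) 0∈ (λ _ → a)) ⟨
      ∑ (upTo N) t + ∑ (upTo N) (λ i → 𝟙 (0 ℕ.≟ i) * a)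
        ≡⟨ ∑-+ (upTo N) t (λ i → 𝟙 (0 ℕ.≟ i) * a) ⟨
      ∑ (upTo N) (λ i → t i + 𝟙 (0 ℕ.≟ i) * a)
        ≡⟨ ∑-cong (upTo N) (λ {i} i∈ → pointwise i (∈-upTo⁻ i∈)) ⟩
      ∑ (upTo N) (λ i → 2 * p * e i + 𝟙 (0 ℕ.≟ i) * b)
        ≡⟨ ∑-+ (upTo N) (λ i → 2 * p * e i) (λ i → 𝟙 (0 ℕ.≟ i) * b) ⟩
      ∑ (upTo N) (λ i → 2 * p * e i) + ∑ (upTo N) (λ i → 𝟙 (0 ℕ.≟ i) * b)
        ≡⟨ cong₂ _+_ (∑-*ˡ (upTo N) (2 * p) e) (∑-indicator ℕ._≟_ (Unique.upTo⁺ N) 0∈ (λ _ → b)) ⟩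
      2 * p * gcdSum + b ∎
      where
      open ≡-Reasoning
      N a b : ℕ
      N = ∣units∣
      a = 2 ^ m * (p * 2 ^ suc N)
      b = 2 ^ m * (2 ^ p + N * 2)
      t e : ℕ → ℕ
      t i = ∑ (allFin p) (λ c → ∑ symmetrics (λ A → 1 * fixedA (g ↑ i) A) * ∑ (bitvecs p) (λ B → 1 * fixedB (g ↑ i) c B))
      e i = 2 ^ gcd i m * 2 ^ gcd i N
      0∈ : 0 ∈ upTo N
      0∈ = ∈-upTo⁺ (ℕ.n≢0⇒n>0 (≢-nonZero⁻¹ N))
      t≡ : ∀ i → t i ≡ 2 ^ gcd i m * ∑ (allFin p) (λ c → ∑ (bitvecs p) (fixedB (g ↑ i) c))
      t≡ i = trans (∑-cong′ (allFin p) (λ c → cong₂ _*_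
          (trans (∑-cong′ symmetrics (λ A → ℕ.*-identityˡ (fixedA (g ↑ i) A))) (fixedA-count i))
          (∑-cong′ (bitvecs p) (λ B → ℕ.*-identityˡ (fixedB (g ↑ i) c B)))))
        (∑-*ˡ (allFin p) (2 ^ gcd i m) (λ c → ∑ (bitvecs p) (fixedB (g ↑ i) c)))
      pointwise : ∀ i → i < N → t i + 𝟙 (0 ℕ.≟ i) * a ≡ 2 * p * e i + 𝟙 (0 ℕ.≟ i) * b
      pointwise zero _ = begin
        t 0 + 1 * a
          ≡⟨ cong₂ _+_ (t≡ 0) (ℕ.*-identityˡ a) ⟩
        2 ^ gcd 0 m * ∑ (allFin p) (λ c → ∑ (bitvecs p) (fixedB 1F c)) + a
          ≡⟨ cong₂ (λ d s → 2 ^ d * s + a) (GCD.gcd-identityˡ m) translations-count ⟩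
        b + 2 ^ m * (p * (2 * 2 ^ N))
          ≡⟨ rearrange b (2 ^ m) p (2 ^ N) ⟩
        2 * p * (2 ^ m * 2 ^ N) + 1 * b
          ≡⟨ cong₂ (λ d d' → 2 * p * (2 ^ d * 2 ^ d') + 1 * b) (GCD.gcd-identityˡ m) (GCD.gcd-identityˡ N) ⟨
        2 * p * e 0 + 1 * b ∎
        where
        rearrange : ∀ b x p y → b + x * (p * (2 * y)) ≡ 2 * p * (x * y) + 1 * b
        rearrange = solve-∀
      pointwise i@(suc _) i<N = cong (_+ 0) (begin
        t i
          ≡⟨ t≡ i ⟩
        2 ^ gcd i m * ∑ (allFin p) (λ c → ∑ (bitvecs p) (fixedB (g ↑ i) c))
          ≡⟨ cong (2 ^ gcd i m *_) (trans (∑-cong′ (allFin p) (λ c → fixedB-count i c k≢1)) (∑-allFin-const (2 * 2 ^ gcd i N))) ⟩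
        2 ^ gcd i m * (p * (2 * 2 ^ gcd i N))
          ≡⟨ rearrange (2 ^ gcd i m) p (2 ^ gcd i N) ⟩
        2 * p * e i ∎)
        where
        rearrange : ∀ x p y → x * (p * (2 * y)) ≡ 2 * p * (x * y)
        rearrange = solve-∀
        k≢1 : g ↑ i ≢ 1F
        k≢1 eq with trans (sym (m<n⇒m%n≡m i<N)) (g↑-injective i 0 eq)
        ... | i≡0%N = ℕ.1+n≢0 (trans i≡0%N (m<n⇒m%n≡m (ℕ.n≢0⇒n>0 (≢-nonZero⁻¹ N))))

    orbit-count : let r = length (Transversal.reps representatives) in
      ∣units∣ * p * r + p * ∑ (upTo ∣units∣) (λ i → 2 ^ gcd i m) + ∣units∣ * p + 2 ^ m * (p * 2 ^ suc ∣units∣) ≡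
      2 * p * ∑ (upTo ∣units∣) (λ i → 2 ^ gcd i m * 2 ^ gcd i ∣units∣) + 2 ^ m * (2 ^ p + ∣units∣ * 2)
    orbit-count = trans (cong (_+ 2 ^ m * (p * 2 ^ suc ∣units∣)) (sym total-expand)) total≡
      where
      length-affineMaps : length affineMaps ≡ ∣units∣ * p
      length-affineMaps = trans (length-cartesianProductWith _,_ powers (allFin p))
        (cong₂ _*_ (trans (List.length-map (g ↑_) (upTo ∣units∣)) (List.length-upTo ∣units∣)) (List.length-tabulate id))
      total-expand : total ≡ ∣units∣ * p * length (Transversal.reps representatives)
                             + p * ∑ (upTo ∣units∣) (λ i → 2 ^ gcd i m) + ∣units∣ * p
      total-expand = trans total-partition (cong₂ _+_ (cong₂ _+_
        (trans (Transversal.count representatives) (cong (_* length (Transversal.reps representatives)) length-affineMaps))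
        emptyTotal≡) singletonTotal≡)

-- Totient sums

∑-upTo-suc : ∀ n (f : ℕ → ℕ) → ∑ (upTo (suc n)) f ≡ f 0 + ∑ (upTo n) (f ∘ suc)
∑-upTo-suc n f = cong (f 0 +_) (trans (cong (λ xs → ∑ xs f) (sym (List.map-upTo suc n))) (∑-map suc (upTo n) f))

∑-upTo-+ : ∀ a b (f : ℕ → ℕ) → ∑ (upTo (a + b)) f ≡ ∑ (upTo a) f + ∑ (upTo b) (f ∘ (a +_))
∑-upTo-+ zero    b f = refl
∑-upTo-+ (suc a) b f = begin
  ∑ (upTo (suc a + b)) f                                         ≡⟨ ∑-upTo-suc (a + b) f ⟩
  f 0 + ∑ (upTo (a + b)) (f ∘ suc)                               ≡⟨ cong (f 0 +_) (∑-upTo-+ a b (f ∘ suc)) ⟩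
  f 0 + (∑ (upTo a) (f ∘ suc) + ∑ (upTo b) (f ∘ (suc a +_)))     ≡⟨ ℕ.+-assoc (f 0) _ _ ⟨
  f 0 + ∑ (upTo a) (f ∘ suc) + ∑ (upTo b) (f ∘ (suc a +_))       ≡⟨ cong (_+ ∑ (upTo b) (f ∘ (suc a +_))) (∑-upTo-suc a f) ⟨
  ∑ (upTo (suc a)) f + ∑ (upTo b) (f ∘ (suc a +_))               ∎
  where open ≡-Reasoning

-- `Φ` counts among 1, ..., n whereas Burnside's sum runs over 0, ..., n - 1; for gcd with n the two
-- ends agree.
∑-upTo-rotate : ∀ n (f : ℕ → ℕ) → f n ≡ f 0 → ∑ (upTo n) (f ∘ suc) ≡ ∑ (upTo n) f
∑-upTo-rotate n f fn≡f0 = ℕ.+-cancelˡ-≡ (f 0) _ _ (begin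
  f 0 + ∑ (upTo n) (f ∘ suc)          ≡⟨ ∑-upTo-suc n f ⟨
  ∑ (upTo (suc n)) f                  ≡⟨ cong (λ k → ∑ (upTo k) f) (ℕ.+-comm 1 n) ⟩
  ∑ (upTo (n + 1)) f                  ≡⟨ ∑-upTo-+ n 1 f ⟩
  ∑ (upTo n) f + (f (n + 0) + 0)      ≡⟨ cong (∑ (upTo n) f +_) (trans (ℕ.+-identityʳ _) (trans (cong f (ℕ.+-identityʳ n)) fn≡f0)) ⟩
  ∑ (upTo n) f + f 0                  ≡⟨ ℕ.+-comm _ (f 0) ⟩
  f 0 + ∑ (upTo n) f                  ∎)
  where open ≡-Reasoning

gcd[n+i,n]≡gcd[i,n] : ∀ n i → gcd (n + i) n ≡ gcd i n
gcd[n+i,n]≡gcd[i,n] n i = ∣-antisym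
  (GCD.gcd-greatest (∣m+n∣m⇒∣n (GCD.gcd[m,n]∣m (n + i) n) (GCD.gcd[m,n]∣n (n + i) n)) (GCD.gcd[m,n]∣n (n + i) n))
  (GCD.gcd-greatest (∣m∣n⇒∣m+n (GCD.gcd[m,n]∣n i n) (GCD.gcd[m,n]∣m i n)) (GCD.gcd[m,n]∣n i n))

gcd[n,n]≡gcd[0,n] : ∀ n → gcd n n ≡ gcd 0 n
gcd[n,n]≡gcd[0,n] n = trans (cong (λ k → gcd k n) (sym (ℕ.+-identityʳ n))) (gcd[n+i,n]≡gcd[i,n] n 0)

-- Exponents run below `∣units∣` = 2m, but gcd with m has period m: this is the factor 2 in `Nc′`.
∑-gcd-double : ∀ n (f : ℕ → ℕ) → ∑ (upTo (n + n)) (λ i → f (gcd i n)) ≡ 2 * ∑ (upTo n) (λ i → f (gcd i n))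
∑-gcd-double n f = trans (∑-upTo-+ n n (λ i → f (gcd i n)))
  (cong (∑ (upTo n) (λ i → f (gcd i n)) +_)
    (trans (∑-cong′ (upTo n) (λ i → cong f (gcd[n+i,n]≡gcd[i,n] n i))) (sym (ℕ.+-identityʳ _))))

-- Among 1, ..., d e the numbers whose gcd with d e is e are the j e with j coprime to d. The
-- condition is multiplied by d to match `totient-sum`, where the cofactor e has no name; `pred` and
-- `suc` pass between numbers and list indices.
totient-count : ∀ d e → .{{_ : NonZero d}} .{{_ : NonZero e}} →
  ∑ (upTo (d * e)) (λ i → 𝟙 (d * gcd (suc i) (d * e) ℕ.≟ d * e)) ≡ Φ d
totient-count d e = begin
  ∑ (upTo (d * e)) (λ i → 𝟙 (P? i))          ≡⟨ length-filter P? (upTo (d * e)) ⟨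
  length (filter P? (upTo (d * e)))          ≡⟨ ∑-1 (filter P? (upTo (d * e))) ⟨
  ∑ (filter P? (upTo (d * e))) (λ _ → 1)     ≡⟨ ∑-bijection ℕ._≟_ ℕ._≟_ (Unique.filter⁺ P? (Unique.upTo⁺ (d * e))) (Unique.filter⁺ Q? (Unique.upTo⁺ d))
                                                  shrink grow shrink∈ grow∈ grow-shrink shrink-grow (λ _ → 1) ⟩
  ∑ (filter Q? (upTo d)) (λ _ → 1)           ≡⟨ ∑-1 (filter Q? (upTo d)) ⟩
  Φ d                                        ∎
  where
  open ≡-Reasoning
  P? : Decidable (λ i → d * gcd (suc i) (d * e) ≡ d * e)
  P? i = d * gcd (suc i) (d * e) ℕ.≟ d * e
  Q? : Decidable (λ j → gcd (suc j) d ≡ 1)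
  Q? j = gcd (suc j) d ℕ.≟ 1
  shrink grow : ℕ → ℕ
  shrink i = pred (suc i / e)
  grow j = pred (suc j * e)
  suc-grow : ∀ j → suc (grow j) ≡ suc j * e
  suc-grow j = ℕ.suc-pred (suc j * e) {{ℕ.m*n≢0 (suc j) e}}
  gcd-scale : ∀ a → gcd (a * e) (d * e) ≡ e * gcd a d
  gcd-scale a = trans (cong₂ gcd (ℕ.*-comm a e) (ℕ.*-comm d e)) (sym (GCD.c*gcd[m,n]≡gcd[cm,cn] e a d))
  factor : ∀ i → d * gcd (suc i) (d * e) ≡ d * e → ∃ λ j → suc i ≡ suc j * e
  factor i eq with subst (_∣ suc i) (ℕ.*-cancelˡ-≡ _ e d eq) (GCD.gcd[m,n]∣m (suc i) (d * e))
  ... | divides (suc j) h = j , h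
  shrink≡ : ∀ i j → suc i ≡ suc j * e → shrink i ≡ j
  shrink≡ i j h = cong pred (trans (cong (_/ e) h) (m*n/n≡m (suc j) e))
  shrink∈ : ∀ {i} → i ∈ filter P? (upTo (d * e)) → shrink i ∈ filter Q? (upTo d)
  shrink∈ {i} i∈ with ∈-filter⁻ P? {xs = upTo (d * e)} i∈
  ... | i∈' , eq with factor i eq
  ...   | j , h = subst (_∈ filter Q? (upTo d)) (sym (shrink≡ i j h)) (∈-filter⁺ Q? (∈-upTo⁺ j<d) coprime)
    where
    j<d : j < d
    j<d = ℕ.*-cancelʳ-≤ (suc j) d e (subst (_≤ d * e) h (∈-upTo⁻ i∈'))
    coprime : gcd (suc j) d ≡ 1
    coprime = ℕ.*-cancelˡ-≡ _ 1 e (begin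
      e * gcd (suc j) d          ≡⟨ gcd-scale (suc j) ⟨
      gcd (suc j * e) (d * e)    ≡⟨ cong (λ k → gcd k (d * e)) h ⟨
      gcd (suc i) (d * e)        ≡⟨ ℕ.*-cancelˡ-≡ _ e d eq ⟩
      e                          ≡⟨ ℕ.*-identityʳ e ⟨
      e * 1                      ∎)
  grow∈ : ∀ {j} → j ∈ filter Q? (upTo d) → grow j ∈ filter P? (upTo (d * e))
  grow∈ {j} j∈ with ∈-filter⁻ Q? {xs = upTo d} j∈
  ... | j∈' , coprime = ∈-filter⁺ P? (∈-upTo⁺ (subst (_≤ d * e) (sym (suc-grow j)) (ℕ.*-monoˡ-≤ e (∈-upTo⁻ j∈')))) (cong (d *_) (begin
      gcd (suc (grow j)) (d * e)   ≡⟨ cong (λ k → gcd k (d * e)) (suc-grow j) ⟩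
      gcd (suc j * e) (d * e)      ≡⟨ gcd-scale (suc j) ⟩
      e * gcd (suc j) d            ≡⟨ cong (e *_) coprime ⟩
      e * 1                        ≡⟨ ℕ.*-identityʳ e ⟩
      e                            ∎))
  grow-shrink : ∀ {i} → i ∈ filter P? (upTo (d * e)) → grow (shrink i) ≡ i
  grow-shrink {i} i∈ with factor i (proj₂ (∈-filter⁻ P? {xs = upTo (d * e)} i∈))
  ... | j , h = trans (cong grow (shrink≡ i j h)) (ℕ.suc-injective (trans (suc-grow j) (sym h)))
  shrink-grow : ∀ {j} → j ∈ filter Q? (upTo d) → shrink (grow j) ≡ j
  shrink-grow {j} _ = shrink≡ (grow j) j (suc-grow j)

-- Group the i by d = m / gcd(i, m), a value taken Φ(d) times; the gcd is then m / d.
totient-sum : ∀ m .{{_ : NonZero m}} (f : ℕ → ℕ) →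
  ∑ (filter (λ k → suc k ∣? m) (upTo m)) (λ k → Φ (suc k) * f (m / suc k)) ≡ ∑ (upTo m) (λ i → f (gcd i m))
totient-sum m f = begin
  ∑ K (λ k → Φ (suc k) * f (m / suc k))
    ≡⟨ ∑-cong K (λ {k} k∈ → trans (cong (_* f (m / suc k)) (sym (count k (proj₂ (∈-filter⁻ K? {xs = upTo m} k∈)))))
         (sym (∑-*ʳ (upTo m) (f (m / suc k)) (λ i → 𝟙 (suc k * gcd (suc i) m ℕ.≟ m))))) ⟩
  ∑ K (λ k → ∑ (upTo m) (λ i → 𝟙 (suc k * gcd (suc i) m ℕ.≟ m) * f (m / suc k)))
    ≡⟨ ∑-swap K (upTo m) (λ k i → 𝟙 (suc k * gcd (suc i) m ℕ.≟ m) * f (m / suc k)) ⟩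
  ∑ (upTo m) (λ i → ∑ K (λ k → 𝟙 (suc k * gcd (suc i) m ℕ.≟ m) * f (m / suc k)))
    ≡⟨ ∑-cong′ (upTo m) (λ i → codivisor i (GCD.gcd[m,n]∣n (suc i) m)) ⟩
  ∑ (upTo m) (λ i → f (gcd (suc i) m))
    ≡⟨ ∑-upTo-rotate m (λ i → f (gcd i m)) (cong f (gcd[n,n]≡gcd[0,n] m)) ⟩
  ∑ (upTo m) (λ i → f (gcd i m)) ∎
  where
  open ≡-Reasoning
  K? : Decidable (λ k → suc k ∣ m)
  K? k = suc k ∣? m
  K : List ℕ
  K = filter K? (upTo m)
  count : ∀ k → suc k ∣ m → ∑ (upTo m) (λ i → 𝟙 (suc k * gcd (suc i) m ℕ.≟ m)) ≡ Φ (suc k)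
  count k (divides e m≡) = trans (cong (λ m → ∑ (upTo m) (λ i → 𝟙 (suc k * gcd (suc i) m ℕ.≟ m))) m≡d*e)
    (totient-count (suc k) e)
    where
    m≡d*e : m ≡ suc k * e
    m≡d*e = trans m≡ (ℕ.*-comm e (suc k))
    instance
      e-nonZero : NonZero e
      e-nonZero = ℕ.m*n≢0⇒m≢0 e {{subst NonZero m≡ (≢-nonZero (≢-nonZero⁻¹ m))}}
  codivisor : ∀ i → gcd (suc i) m ∣ m → ∑ K (λ k → 𝟙 (suc k * gcd (suc i) m ℕ.≟ m) * f (m / suc k)) ≡ f (gcd (suc i) m)
  codivisor i (divides zero m≡)    = contradiction m≡ (≢-nonZero⁻¹ m)
  codivisor i (divides (suc q) m≡) = begin
    ∑ K (λ k → 𝟙 (suc k * G ℕ.≟ m) * f (m / suc k))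
      ≡⟨ ∑-cong′ K (λ k → cong (_* f (m / suc k)) (𝟙-cong (suc k * G ℕ.≟ m) (q ℕ.≟ k)
           (λ eq → ℕ.suc-injective (ℕ.*-cancelʳ-≡ (suc q) (suc k) G (trans (sym m≡) (sym eq)))) (λ { refl → sym m≡ }))) ⟩
    ∑ K (λ k → 𝟙 (q ℕ.≟ k) * f (m / suc k))
      ≡⟨ ∑-indicator ℕ._≟_ (Unique.filter⁺ K? (Unique.upTo⁺ m)) q∈ (λ k → f (m / suc k)) ⟩
    f (m / suc q)
      ≡⟨ cong f (trans (cong (_/ suc q) (trans m≡ (ℕ.*-comm (suc q) G))) (m*n/n≡m G (suc q))) ⟩
    f G ∎
    where
    G : ℕ
    G = gcd (suc i) m
    instance
      G-nonZero : NonZero G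
      G-nonZero = ≢-nonZero (GCD.gcd[m,n]≢0 (suc i) m (inj₁ λ ()))
    q∈ : q ∈ K
    q∈ = ∈-filter⁺ K? (∈-upTo⁺ (∣⇒≤ q+1∣m)) q+1∣m
      where
      q+1∣m : suc q ∣ m
      q+1∣m = divides G (trans m≡ (ℕ.*-comm (suc q) G))

-- The closed formula

private
  toℚᵘ-toℚ : ∀ n → toℚᵘ (toℚ n) ℚᵘ.≃ mkℚᵘ (ℤ.+ n) 0
  toℚᵘ-toℚ n = ℚ.toℚᵘ-fromℚᵘ (mkℚᵘ (ℤ.+ n) 0)

toℚ-+ : ∀ a b → toℚ (a + b) ≡ toℚ a ℚ.+ toℚ b
toℚ-+ a b = ℚ.toℚᵘ-injective (ℚᵘ.≃-trans (toℚᵘ-toℚ (a + b)) (ℚᵘ.≃-sym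
  (ℚᵘ.≃-trans (ℚ.toℚᵘ-homo-+ (toℚ a) (toℚ b)) (ℚᵘ.≃-trans (ℚᵘ.+-cong (toℚᵘ-toℚ a) (toℚᵘ-toℚ b))
    (*≡* (cong (ℤ._* ℤ.+ 1) (cong₂ ℤ._+_ (ℤ.*-identityʳ (ℤ.+ a)) (ℤ.*-identityʳ (ℤ.+ b)))))))))

toℚ-* : ∀ a b → toℚ (a * b) ≡ toℚ a ℚ.* toℚ b
toℚ-* a b = ℚ.toℚᵘ-injective (ℚᵘ.≃-trans (toℚᵘ-toℚ (a * b)) (ℚᵘ.≃-sym
  (ℚᵘ.≃-trans (ℚ.toℚᵘ-homo-* (toℚ a) (toℚ b)) (ℚᵘ.≃-trans (ℚᵘ.*-cong (toℚᵘ-toℚ a) (toℚᵘ-toℚ b))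
    (*≡* (cong (ℤ._* ℤ.+ 1) (sym (ℤ.pos-* a b))))))))

recip-inverse : ∀ n → recip (suc n) ℚ.* toℚ (suc n) ≡ 1ℚ
recip-inverse n = ℚ.toℚᵘ-injective (ℚᵘ.≃-trans (ℚ.toℚᵘ-homo-* (recip (suc n)) (toℚ (suc n)))
  (ℚᵘ.≃-trans (ℚᵘ.*-cong (ℚ.toℚᵘ-fromℚᵘ (mkℚᵘ (ℤ.+ 1) n)) (toℚᵘ-toℚ (suc n)))
    (*≡* (trans (ℤ.*-identityʳ _) (trans (ℤ.*-identityˡ (ℤ.+ suc n))
      (sym (trans (ℤ.*-identityˡ _) (cong ℤ.+_ (ℕ.*-identityʳ (suc n))))))))))

-- Division of the orbit equation by n p. In the application t = 2, n = p - 1, D is the divisor sum,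
-- E the gcd sum, V = 2^((p+1)/2) and Y = 2^((3p-1)/2).
solve-orbit-equation : ∀ t R D E V Y n p rn rp → p ≡ n ℚ.+ 1ℚ → rp ℚ.* p ≡ 1ℚ → rn ℚ.* n ≡ 1ℚ →
  n ℚ.* p ℚ.* R ℚ.+ p ℚ.* (t ℚ.* D) ℚ.+ n ℚ.* p ℚ.+ p ℚ.* Y ≡ t ℚ.* p ℚ.* E ℚ.+ Y ℚ.+ n ℚ.* V →
  R ≡ rp ℚ.* (V - Y) ℚ.+ t ℚ.* rn ℚ.* E - t ℚ.* rn ℚ.* D - 1ℚ
solve-orbit-equation t R D E V Y n p rn rp p≡ rp-inv rn-inv eq = begin
  R
    ≡⟨ trans (sym (ℚ.*-identityˡ R)) (cong (ℚ._* R) (sym (cong₂ ℚ._*_ rp-inv rn-inv))) ⟩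
  rp ℚ.* p ℚ.* (rn ℚ.* n) ℚ.* R
    ≡⟨ solve 10 (λ t R D E V Y n p rn rp →
         rp :* p :* (rn :* n) :* R :=
         rp :* rn :* (n :* p :* R :+ p :* (t :* D) :+ n :* p :+ p :* Y :- p :* (t :* D) :- n :* p :- p :* Y)) refl t R D E V Y n p rn rp ⟩
  rp ℚ.* rn ℚ.* (n ℚ.* p ℚ.* R ℚ.+ p ℚ.* (t ℚ.* D) ℚ.+ n ℚ.* p ℚ.+ p ℚ.* Y - p ℚ.* (t ℚ.* D) - n ℚ.* p - p ℚ.* Y)
    -- Only the p multiplying Y is replaced by n + 1: then Y - (n + 1) Y = - n Y, and n cancels from
    -- this term as well.
    ≡⟨ cong₂ (λ l q → rp ℚ.* rn ℚ.* (l - p ℚ.* (t ℚ.* D) - n ℚ.* p - q ℚ.* Y)) eq p≡ ⟩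
  rp ℚ.* rn ℚ.* (t ℚ.* p ℚ.* E ℚ.+ Y ℚ.+ n ℚ.* V - p ℚ.* (t ℚ.* D) - n ℚ.* p - (n ℚ.+ 1ℚ) ℚ.* Y)
    ≡⟨ solve 9 (λ t D E V Y n p rn rp →
         rp :* rn :* (t :* p :* E :+ Y :+ n :* V :- p :* (t :* D) :- n :* p :- (n :+ con 1ℚ) :* Y) :=
         rp :* (rn :* n) :* (V :- Y) :+ t :* rn :* (rp :* p) :* E :- t :* rn :* (rp :* p) :* D :- (rp :* p) :* (rn :* n)) refl t D E V Y n p rn rp ⟩
  rp ℚ.* (rn ℚ.* n) ℚ.* (V - Y) ℚ.+ t ℚ.* rn ℚ.* (rp ℚ.* p) ℚ.* E - t ℚ.* rn ℚ.* (rp ℚ.* p) ℚ.* D - (rp ℚ.* p) ℚ.* (rn ℚ.* n)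
    ≡⟨ cong₂ (λ a b → rp ℚ.* b ℚ.* (V - Y) ℚ.+ t ℚ.* rn ℚ.* a ℚ.* E - t ℚ.* rn ℚ.* a ℚ.* D - a ℚ.* b) rp-inv rn-inv ⟩
  rp ℚ.* 1ℚ ℚ.* (V - Y) ℚ.+ t ℚ.* rn ℚ.* 1ℚ ℚ.* E - t ℚ.* rn ℚ.* 1ℚ ℚ.* D - 1ℚ
    ≡⟨ cong₂ (λ a b → a ℚ.* (V - Y) ℚ.+ b ℚ.* E - b ℚ.* D - 1ℚ) (ℚ.*-identityʳ rp) (ℚ.*-identityʳ (t ℚ.* rn)) ⟩
  rp ℚ.* (V - Y) ℚ.+ t ℚ.* rn ℚ.* E - t ℚ.* rn ℚ.* D - 1ℚ ∎
  where
  open ≡-Reasoning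
  open ℚ.+-*-Solver

closed-formula : ∀ m .{{_ : NonZero m}} {n p} r → n ≡ m + m → p ≡ suc n →
  n * p * r + p * ∑ (upTo n) (λ i → 2 ^ gcd i m) + n * p + 2 ^ m * (p * 2 ^ suc n) ≡
  2 * p * ∑ (upTo n) (λ i → 2 ^ gcd i m * 2 ^ gcd i n) + 2 ^ m * (2 ^ p + n * 2) →
  toℚ r ≡ N′ p - Nc′ p - toℚ 1
closed-formula m r refl refl eq = trans
  (solve-orbit-equation (toℚ 2) (toℚ r) (toℚ T) (toℚ E) (toℚ V) (toℚ Y) (toℚ n) (toℚ p) (recip n) (recip p)
    (trans (cong toℚ (ℕ.+-comm 1 n)) (toℚ-+ n 1)) (recip-inverse n) recip-n equation)
  (cong₂ (λ x y → x - y - 1ℚ)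
    (cong₂ (λ x y → recip p ℚ.* x ℚ.+ toℚ 2 ℚ.* recip n ℚ.* toℚ y)
      (cong₂ (λ a b → toℚ (2 ^ a) - toℚ (2 ^ b)) (sym half-p+1) (sym half-3p-1))
      (∑-cong′ (upTo n) (λ i → trans (sym (ℕ.^-distribˡ-+-* 2 (gcd i m) (gcd i n)))
        (cong (λ d → 2 ^ (d + gcd i n)) (sym (half-gcd i))))))
    (cong (λ k → toℚ 2 ℚ.* recip n ℚ.* toℚ (∑ (filter (λ j → suc j ∣? k) (upTo k)) (λ j → Φ (suc j) * 2 ^ (k / suc j)))) (sym half-n)))
  where
  n p T E V Y : ℕ
  n = m + m
  p = suc n
  T = ∑ (filter (λ k → suc k ∣? m) (upTo m)) (λ k → Φ (suc k) * 2 ^ (m / suc k))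
  E = ∑ (upTo n) (λ i → 2 ^ gcd i m * 2 ^ gcd i n)
  V = 2 ^ suc m
  Y = 2 ^ (m + p)
  n≡2*m : n ≡ 2 * m
  n≡2*m = cong (m +_) (sym (ℕ.+-identityʳ m))
  halve : ∀ k → (2 * k) / 2 ≡ k
  halve k = trans (cong (_/ 2) (ℕ.*-comm 2 k)) (m*n/n≡m k 2)
  half-n : n / 2 ≡ m
  half-n = trans (cong (_/ 2) n≡2*m) (halve m)
  half-p+1 : (p + 1) / 2 ≡ suc m
  half-p+1 = trans (cong (_/ 2) (lemma m)) (halve (suc m))
    where
    lemma : ∀ m → suc (m + m) + 1 ≡ 2 * suc m
    lemma = solve-∀
  half-3p-1 : (3 * p ∸ 1) / 2 ≡ m + p
  half-3p-1 = trans (cong (λ k → (k ∸ 1) / 2) (lemma m)) (halve (m + p))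
    where
    lemma : ∀ m → 3 * suc (m + m) ≡ suc (2 * (m + suc (m + m)))
    lemma = solve-∀
  half-gcd : ∀ i → gcd (2 * i) n / 2 ≡ gcd i m
  half-gcd i = trans (cong (λ k → gcd (2 * i) k / 2) n≡2*m) (GCD.gcd[cm,cn]/c≡gcd[m,n] 2 i m)
  recip-n : recip n ℚ.* toℚ n ≡ 1ℚ
  recip-n = subst (λ k → recip k ℚ.* toℚ k ≡ 1ℚ) (ℕ.suc-pred n {{nz}}) (recip-inverse (pred n))
    where
    nz : NonZero n
    nz = ≢-nonZero (λ n≡0 → ≢-nonZero⁻¹ m (ℕ.m+n≡0⇒m≡0 m n≡0))
  equation-ℕ : n * p * r + p * (2 * T) + n * p + p * Y ≡ 2 * p * E + Y + n * V
  equation-ℕ = begin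
    n * p * r + p * (2 * T) + n * p + p * Y
      ≡⟨ cong₂ (λ x y → n * p * r + p * x + n * p + p * y)
           (trans (cong (2 *_) (totient-sum m (2 ^_))) (sym (∑-gcd-double m (2 ^_)))) (ℕ.^-distribˡ-+-* 2 m p) ⟩
    n * p * r + p * S + n * p + p * (2 ^ m * 2 ^ p)
      ≡⟨ lemma₁ (n * p * r + p * S + n * p) p (2 ^ m) (2 ^ p) ⟩
    n * p * r + p * S + n * p + 2 ^ m * (p * 2 ^ p)
      ≡⟨ eq ⟩
    2 * p * E + 2 ^ m * (2 ^ p + n * 2)
      ≡⟨ lemma₂ (2 * p * E) (2 ^ m) (2 ^ p) n ⟩
    2 * p * E + 2 ^ m * 2 ^ p + n * (2 * 2 ^ m)
      ≡⟨ cong (λ y → 2 * p * E + y + n * V) (ℕ.^-distribˡ-+-* 2 m p) ⟨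
    2 * p * E + Y + n * V ∎
    where
    open ≡-Reasoning
    S : ℕ
    S = ∑ (upTo n) (λ i → 2 ^ gcd i m)
    lemma₁ : ∀ a p x y → a + p * (x * y) ≡ a + x * (p * y)
    lemma₁ = solve-∀
    lemma₂ : ∀ a x y n → a + x * (y + n * 2) ≡ a + x * y + n * (2 * x)
    lemma₂ = solve-∀
  equation : toℚ n ℚ.* toℚ p ℚ.* toℚ r ℚ.+ toℚ p ℚ.* (toℚ 2 ℚ.* toℚ T) ℚ.+ toℚ n ℚ.* toℚ p ℚ.+ toℚ p ℚ.* toℚ Y ≡
             toℚ 2 ℚ.* toℚ p ℚ.* toℚ E ℚ.+ toℚ Y ℚ.+ toℚ n ℚ.* toℚ V
  equation = begin
    toℚ n ℚ.* toℚ p ℚ.* toℚ r ℚ.+ toℚ p ℚ.* (toℚ 2 ℚ.* toℚ T) ℚ.+ toℚ n ℚ.* toℚ p ℚ.+ toℚ p ℚ.* toℚ Y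
      ≡⟨ cong₂ ℚ._+_ (cong₂ ℚ._+_ (cong₂ ℚ._+_ (triple n p r) (trans (toℚ-* p (2 * T)) (cong (toℚ p ℚ.*_) (toℚ-* 2 T)))) (toℚ-* n p)) (toℚ-* p Y) ⟨
    toℚ (n * p * r) ℚ.+ toℚ (p * (2 * T)) ℚ.+ toℚ (n * p) ℚ.+ toℚ (p * Y)
      ≡⟨ trans (toℚ-+ (n * p * r + p * (2 * T) + n * p) (p * Y)) (cong (ℚ._+ toℚ (p * Y))
           (trans (toℚ-+ (n * p * r + p * (2 * T)) (n * p)) (cong (ℚ._+ toℚ (n * p)) (toℚ-+ (n * p * r) (p * (2 * T)))))) ⟨
    toℚ (n * p * r + p * (2 * T) + n * p + p * Y)
      ≡⟨ cong toℚ equation-ℕ ⟩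
    toℚ (2 * p * E + Y + n * V)
      ≡⟨ trans (toℚ-+ (2 * p * E + Y) (n * V)) (cong (ℚ._+ toℚ (n * V)) (toℚ-+ (2 * p * E) Y)) ⟩
    toℚ (2 * p * E) ℚ.+ toℚ Y ℚ.+ toℚ (n * V)
      ≡⟨ cong₂ (λ a b → a ℚ.+ toℚ Y ℚ.+ b) (triple 2 p E) (toℚ-* n V) ⟩
    toℚ 2 ℚ.* toℚ p ℚ.* toℚ E ℚ.+ toℚ Y ℚ.+ toℚ n ℚ.* toℚ V ∎
    where
    open ≡-Reasoning
    triple : ∀ a b c → toℚ (a * b * c) ≡ toℚ a ℚ.* toℚ b ℚ.* toℚ c
    triple a b c = trans (toℚ-* (a * b) c) (cong (ℚ._* toℚ c) (toℚ-* a b))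

-- The dihedral group and normalising isomorphisms

module Dihedral {p : ℕ} (𝔽 : FieldStructure p) where

  open InvariantSubsets 𝔽 hiding (encode; decode) public
  open AbelianGroupProperties +-abelianGroup using (⁻¹-∙-comm; ⁻¹-involutive)
  open SemiringSolver commutativeSemiring

  infixl 7 _✶_
  -- The multiplication `_·_` over the abstract field operations; `·≡✶` identifies the two.
  _✶_ : D p → D p → D p
  (a , false) ✶ (c , d) = a ⊕ c , d
  (a , true)  ✶ (c , d) = a ⊕ ⊖ c , not d

  e : D p
  e = 0F , false

  dinv : D p → D p
  dinv (a , false) = ⊖ a , false
  dinv (a , true)  = a , true

  ρ : F → D p
  ρ a = a , false

  a-[b-c]≡a-b+c : ∀ a b c → a ⊕ ⊖ (b ⊕ ⊖ c) ≡ a ⊕ ⊖ b ⊕ c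
  a-[b-c]≡a-b+c a b c = trans (cong (a ⊕_) (trans (sym (⁻¹-∙-comm b (⊖ c))) (cong (⊖ b ⊕_) (⁻¹-involutive c))))
    (sym (⊕-assoc a (⊖ b) c))

  a-[b+c]≡a-b-c : ∀ a b c → a ⊕ ⊖ (b ⊕ c) ≡ a ⊕ ⊖ b ⊕ ⊖ c
  a-[b+c]≡a-b-c a b c = trans (cong (a ⊕_) (sym (⁻¹-∙-comm b c))) (sym (⊕-assoc a (⊖ b) (⊖ c)))

  ✶-assoc : ∀ x y z → (x ✶ y) ✶ z ≡ x ✶ (y ✶ z)
  ✶-assoc (a , false) (b , false) (c , _) = cong (_, _) (⊕-assoc a b c)
  ✶-assoc (a , false) (b , true)  (c , _) = cong (_, _) (⊕-assoc a b (⊖ c))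
  ✶-assoc (a , true)  (b , false) (c , _) = cong (_, _) (sym (a-[b+c]≡a-b-c a b c))
  ✶-assoc (a , true)  (b , true)  (c , d) = cong₂ _,_ (sym (a-[b-c]≡a-b+c a b c)) (sym (Bool.not-involutive d))

  ✶-identityˡ : ∀ x → e ✶ x ≡ x
  ✶-identityˡ (a , _) = cong (_, _) (⊕-identityˡ a)

  -0≡0 : ⊖ 0F ≡ 0F
  -0≡0 = trans (sym (⊕-identityˡ (⊖ 0F))) (⊖-inverseʳ 0F)

  ✶-identityʳ : ∀ x → x ✶ e ≡ x
  ✶-identityʳ (a , false) = cong (_, _) (⊕-identityʳ a)
  ✶-identityʳ (a , true)  = cong (_, _) (trans (cong (a ⊕_) -0≡0) (⊕-identityʳ a))

  ✶-inverseˡ : ∀ x → dinv x ✶ x ≡ e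
  ✶-inverseˡ (a , false) = cong (_, _) (⊖-inverseˡ a)
  ✶-inverseˡ (a , true)  = cong (_, _) (⊖-inverseʳ a)

  ✶-inverseʳ : ∀ x → x ✶ dinv x ≡ e
  ✶-inverseʳ (a , false) = cong (_, _) (⊖-inverseʳ a)
  ✶-inverseʳ (a , true)  = cong (_, _) (⊖-inverseʳ a)

  dihedralGroup : Group 0ℓ 0ℓ
  dihedralGroup = record
    { _∙_ = _✶_ ; ε = e ; _⁻¹ = dinv
    ; isGroup = record
      { isMonoid = record
        { isSemigroup = record
          { isMagma = record { isEquivalence = isEquivalence ; ∙-cong = cong₂ _✶_ }
          ; assoc = ✶-assoc }
        ; identity = ✶-identityˡ , ✶-identityʳ }
      ; inverse = ✶-inverseˡ , ✶-inverseʳ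
      ; ⁻¹-cong = cong dinv } }

  open GroupProperties dihedralGroup using ()
    renaming (∙-cancelˡ to ✶-cancelˡ; ∙-cancelʳ to ✶-cancelʳ; ⁻¹-anti-homo-∙ to dinv-✶) public

  x✶d✶d⁻¹≡x : ∀ x d → x ✶ d ✶ dinv d ≡ x
  x✶d✶d⁻¹≡x x d = trans (✶-assoc x d (dinv d)) (trans (cong (x ✶_) (✶-inverseʳ d)) (✶-identityʳ x))

  x✶d⁻¹✶d≡x : ∀ x d → x ✶ dinv d ✶ d ≡ x
  x✶d⁻¹✶d≡x x d = trans (✶-assoc x (dinv d) d) (trans (cong (x ✶_) (✶-inverseˡ d)) (✶-identityʳ x))

  ρ-swap : ∀ x a b → x ✶ ρ a ✶ ρ b ≡ x ✶ ρ b ✶ ρ a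
  ρ-swap x a b = trans (✶-assoc x (ρ a) (ρ b)) (trans (cong (λ c → x ✶ ρ c) (⊕-comm a b)) (sym (✶-assoc x (ρ b) (ρ a))))

  ρ-fixes : ∀ x a → x ✶ ρ a ≡ x → a ≡ 0F
  ρ-fixes x a eq = cong proj₁ (✶-cancelˡ x (ρ a) e (trans eq (sym (✶-identityʳ x))))

  same-block : ∀ {a b β} → ∃ λ w → (a , β) ✶ ρ w ≡ (b , β)
  same-block {a} {b} {false} = b ⊕ ⊖ a , cong (_, false) (x+[y-x]≡y a b)
  same-block {a} {b} {true}  = a ⊕ ⊖ b , cong (_, true) (trans (a-[b-c]≡a-b+c a a b) (trans (cong (_⊕ b) (⊖-inverseʳ a)) (⊕-identityˡ b)))

  reflection≡ : ∀ x → (0F , true) ✶ ρ (⊖ x) ≡ (x , true)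
  reflection≡ x = cong (_, true) (trans (⊕-identityˡ _) (⁻¹-involutive x))

  _≟ᵈ_ : DecidableEquality (D p)
  _≟ᵈ_ = Product.≡-dec Fin._≟_ Bool._≟_

  allD? : ∀ {P : D p → Set} → Decidable P → Dec (∀ x → P x)
  allD? P? = map′ (λ { (f , t) (x , false) → f x ; (f , t) (x , true) → t x }) (λ h → (λ x → h (x , false)) , (λ x → h (x , true)))
    (Fin.all? (λ x → P? (x , false)) ×-dec Fin.all? (λ x → P? (x , true)))

  elements : List (D p)
  elements = cartesianProduct (allFin p) bools

  elements-unique : Unique elements
  elements-unique = Unique.cartesianProduct⁺ (Unique.allFin⁺ p) bools-unique

  ∈-elements : ∀ x → x ∈ elements
  ∈-elements (x , b) = ∈-cartesianProduct⁺ (∈-allFin x) (bools-complete b)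

  length-elements : length elements ≡ p * 2
  length-elements = trans (length-cartesianProductWith _,_ (allFin p) bools) (cong (_* 2) {length (allFin p)} {p} (List.length-tabulate id))

  adj : Subset p → D p → D p → Bool
  adj S g h = S (h ✶ dinv g)

  -- Adjacency depends on h g⁻¹ only, so right translations are automorphisms of every Cayley graph.
  -- Hence the translations of isomorphisms all act from the right.
  adj-translate : ∀ S g h d → adj S (g ✶ d) (h ✶ d) ≡ adj S g h
  adj-translate S g h d = cong S (trans (cong (h ✶ d ✶_) (dinv-✶ g d))
    (trans (sym (✶-assoc (h ✶ d) (dinv d) (dinv g))) (cong (_✶ dinv g) (x✶d✶d⁻¹≡x h d))))

  adj-e : ∀ S h → adj S e h ≡ S h
  adj-e S h = cong S (trans (cong (h ✶_) (cong (_, false) -0≡0)) (✶-identityʳ h))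

  -- Self-maps of D p are stored as tables so that propositional equality is pointwise and decidable.
  Table : Set
  Table = Vec (D p) p × Vec (D p) p

  apply : Table → D p → D p
  apply (u , v) (x , false) = lookup u x
  apply (u , v) (x , true)  = lookup v x

  encode : (D p → D p) → Table
  encode f = tabulate (λ x → f (x , false)) , tabulate (λ x → f (x , true))

  apply-encode : ∀ f x → apply (encode f) x ≡ f x
  apply-encode f (x , false) = Vec.lookup∘tabulate _ x
  apply-encode f (x , true)  = Vec.lookup∘tabulate _ x

  table-ext : ∀ {c c'} → (∀ x → apply c x ≡ apply c' x) → c ≡ c'
  table-ext eq = cong₂ _,_ (lookup-ext (λ x → eq (x , false))) (lookup-ext (λ x → eq (x , true)))

  _≟ᵗ_ : DecidableEquality Table
  _≟ᵗ_ = Product.≡-dec (Vec.≡-dec _≟ᵈ_) (Vec.≡-dec _≟ᵈ_)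

  tables : List Table
  tables = cartesianProduct (allVecs elements p) (allVecs elements p)

  tables-unique : Unique tables
  tables-unique = Unique.cartesianProduct⁺ (allVecs-unique elements-unique p) (allVecs-unique elements-unique p)

  ∈-tables : ∀ c → c ∈ tables
  ∈-tables (u , v) = ∈-cartesianProduct⁺ (allVecs-complete ∈-elements u) (allVecs-complete ∈-elements v)

  -- On the finite set `D p` injectivity already gives bijectivity, and it is decidable for tables
  -- without mentioning an inverse.
  IsIso : Subset p → Subset p → (D p → D p) → Set
  IsIso S T f = (∀ g h → adj S g h ≡ adj T (f g) (f h)) × (∀ g h → f g ≡ f h → g ≡ h)

  isIso? : ∀ S T → Decidable (IsIso S T ∘ apply)
  isIso? S T c = allD? (λ g → allD? (λ h → adj S g h Bool.≟ adj T (apply c g) (apply c h))) ×-dec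
                 allD? (λ g → allD? (λ h → (apply c g ≟ᵈ apply c h) →-dec (g ≟ᵈ h)))

  IsIso-resp : ∀ {S T f f'} → (∀ x → f x ≡ f' x) → IsIso S T f → IsIso S T f'
  IsIso-resp {S} {T} eq (adj-f , inj) =
    (λ g h → trans (adj-f g h) (cong₂ (adj T) (eq g) (eq h))) ,
    (λ g h fg≡fh → inj g h (trans (eq g) (trans fg≡fh (sym (eq h)))))

  isos : Subset p → Subset p → List Table
  isos S T = filter (isIso? S T) tables

  isos-unique : ∀ S T → Unique (isos S T)
  isos-unique S T = Unique.filter⁺ (isIso? S T) tables-unique

  ∈-isos⁺ : ∀ {S T c} → IsIso S T (apply c) → c ∈ isos S T
  ∈-isos⁺ {S} {T} {c} = ∈-filter⁺ (isIso? S T) (∈-tables c)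

  ∈-isos⁻ : ∀ {S T c} → c ∈ isos S T → IsIso S T (apply c)
  ∈-isos⁻ {S} {T} c∈ = proj₂ (∈-filter⁻ (isIso? S T) {xs = tables} c∈)

  -- The group ⟨τ⟩ × D₂ₚ, of order 2p², acting on tables by translation after and before.
  Shift : Set
  Shift = F × D p

  shift : Shift → Table → Table
  shift (j , d) c = encode (λ x → apply c (x ✶ d) ✶ ρ j)

  apply-shift : ∀ j d c x → apply (shift (j , d) c) x ≡ apply c (x ✶ d) ✶ ρ j
  apply-shift j d c x = apply-encode (λ x → apply c (x ✶ d) ✶ ρ j) x

  shifts : List Shift
  shifts = cartesianProduct (allFin p) elements

  shifts-unique : Unique shifts
  shifts-unique = Unique.cartesianProduct⁺ (Unique.allFin⁺ p) elements-unique

  ∈-shifts : ∀ s → s ∈ shifts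
  ∈-shifts (j , d) = ∈-cartesianProduct⁺ (∈-allFin j) (∈-elements d)

  _◇_ : Shift → Shift → Shift
  (j , d) ◇ (j' , d') = j' ⊕ j , d ✶ d'

  sε : Shift
  sε = 0F , e

  sinv : Shift → Shift
  sinv (j , d) = ⊖ j , dinv d

  shift-ε : ∀ c → shift sε c ≡ c
  shift-ε c = table-ext (λ x → trans (apply-shift 0F e c x) (trans (✶-identityʳ _) (cong (apply c) (✶-identityʳ x))))

  shift-◇ : ∀ s s' c → shift (s ◇ s') c ≡ shift s (shift s' c)
  shift-◇ (j , d) (j' , d') c = table-ext λ x → begin
    apply (shift (j' ⊕ j , d ✶ d') c) x           ≡⟨ apply-shift (j' ⊕ j) (d ✶ d') c x ⟩
    apply c (x ✶ (d ✶ d')) ✶ ρ (j' ⊕ j)           ≡⟨ cong (λ y → apply c y ✶ ρ (j' ⊕ j)) (✶-assoc x d d') ⟨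
    apply c (x ✶ d ✶ d') ✶ (ρ j' ✶ ρ j)           ≡⟨ ✶-assoc _ (ρ j') (ρ j) ⟨
    apply c (x ✶ d ✶ d') ✶ ρ j' ✶ ρ j             ≡⟨ cong (_✶ ρ j) (apply-shift j' d' c (x ✶ d)) ⟨
    apply (shift (j' , d') c) (x ✶ d) ✶ ρ j       ≡⟨ apply-shift j d (shift (j' , d') c) x ⟨
    apply (shift (j , d) (shift (j' , d') c)) x   ∎
    where open ≡-Reasoning

  sinv-◇ : ∀ s → sinv s ◇ s ≡ sε
  sinv-◇ (j , d) = cong₂ _,_ (⊖-inverseʳ j) (✶-inverseˡ d)

  shift-sinv : ∀ {s} → s ∈ shifts → ∀ c → shift (sinv s) (shift s c) ≡ c
  shift-sinv {s} _ c = trans (sym (shift-◇ (sinv s) s c)) (trans (cong (λ s → shift s c) (sinv-◇ s)) (shift-ε c))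

  ∑-shifts : ∀ {s} → s ∈ shifts → (f : Shift → ℕ) → ∑ shifts (λ s' → f (s' ◇ s)) ≡ ∑ shifts f
  ∑-shifts {j , d} _ = ∑-bijection _≟_ _≟_ shifts-unique shifts-unique (_◇ (j , d)) (_◇ (⊖ j , dinv d))
    (λ _ → ∈-shifts _) (λ _ → ∈-shifts _)
    (λ {(i , c)} _ → cong₂ _,_ (trans (sym (⊕-assoc (⊖ j) j i)) (trans (cong (_⊕ i) (⊖-inverseˡ j)) (⊕-identityˡ i))) (x✶d✶d⁻¹≡x c d))
    (λ {(i , c)} _ → cong₂ _,_ (trans (sym (⊕-assoc j (⊖ j) i)) (trans (cong (_⊕ i) (⊖-inverseʳ j)) (⊕-identityˡ i))) (x✶d⁻¹✶d≡x c d))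
    where
    _≟_ : DecidableEquality Shift
    _≟_ = Product.≡-dec Fin._≟_ _≟ᵈ_

  module Shifts = Burnside _≟ᵗ_ shifts shift _◇_ sε sinv (∈-shifts sε) (λ _ _ → ∈-shifts _) (λ _ → ∈-shifts _)
    shift-ε shift-◇ shift-sinv ∑-shifts
  open Shifts using (Closed) public
  open Shifts using (stab; module Transversal; transversal)

  -- With trivial stabilisers Burnside's sum is just the number of tables.
  free⇒∣ : ∀ {cs} → Unique cs → Closed cs → (∀ {c s} → c ∈ cs → shift s c ≡ c → s ≡ sε) → length shifts ∣ length cs
  free⇒∣ {cs} uq cl free = divides (length reps) (begin
    length cs                   ≡⟨ ∑-1 cs ⟨
    ∑ cs (λ _ → 1)              ≡⟨ ∑-cong cs (λ c∈ → sym (stab≡1 c∈)) ⟩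
    ∑ cs stab                   ≡⟨ count ⟩
    length shifts * length reps ≡⟨ ℕ.*-comm (length shifts) (length reps) ⟩
    length reps * length shifts ∎)
    where
    open ≡-Reasoning
    open Transversal (transversal cs uq cl)
    _≟_ : DecidableEquality Shift
    _≟_ = Product.≡-dec Fin._≟_ _≟ᵈ_
    stab≡1 : ∀ {c} → c ∈ cs → stab c ≡ 1
    stab≡1 {c} c∈ = trans (∑-cong′ shifts (λ s → 𝟙-cong (shift s c ≟ᵗ c) (sε ≟ s) (sym ∘ free c∈) (λ { refl → shift-ε c })))
      (∑-indicator-1 _≟_ shifts-unique (∈-shifts sε))

  shift-iso : ∀ {S T c} j d → IsIso S T (apply c) → IsIso S T (apply (shift (j , d) c))
  shift-iso {S} {T} {c} j d (adj-c , inj) = IsIso-resp {S} {T} (λ x → sym (apply-shift j d c x))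
    ((λ g h → trans (sym (adj-translate S g h d)) (trans (adj-c (g ✶ d) (h ✶ d)) (sym (adj-translate T _ _ (ρ j))))) ,
     (λ g h eq → ✶-cancelʳ d g h (inj _ _ (✶-cancelʳ (ρ j) _ _ eq))))

  -- `f` turns right translation by τ into right translation by τ^k. Consequently it maps cosets of
  -- ⟨τ⟩ into cosets of ⟨τ⟩, affinely on each.
  Normalises : F → (D p → D p) → Set
  Normalises k f = ∀ x → f (x ✶ ρ 1F) ≡ f x ✶ ρ k

  Normalising : Table → Set
  Normalising c = ∃ λ k → Normalises k (apply c)

  normalising? : Decidable Normalising
  normalising? c = Fin.any? (λ k → allD? (λ x → apply c (x ✶ ρ 1F) ≟ᵈ (apply c x ✶ ρ k)))

  normalises-all : ∀ {k f} → Normalises k f → ∀ b x → f (x ✶ ρ b) ≡ f x ✶ ρ (k ⊗ b)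
  normalises-all {k} {f} norm b = translate-induction 1≢0 (λ b → ∀ x → f (x ✶ ρ b) ≡ f x ✶ ρ (k ⊗ b)) next 0F b base
    where
    open ≡-Reasoning
    base : ∀ x → f (x ✶ ρ 0F) ≡ f x ✶ ρ (k ⊗ 0F)
    base x = trans (cong f (✶-identityʳ x)) (sym (trans (cong (λ z → f x ✶ ρ z) (⊗-zeroʳ k)) (✶-identityʳ (f x))))
    next : ∀ b → (∀ x → f (x ✶ ρ b) ≡ f x ✶ ρ (k ⊗ b)) → ∀ x → f (x ✶ ρ (b ⊕ 1F)) ≡ f x ✶ ρ (k ⊗ (b ⊕ 1F))
    next b ih x = begin
      f (x ✶ (ρ b ✶ ρ 1F))            ≡⟨ cong f (✶-assoc x (ρ b) (ρ 1F)) ⟨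
      f (x ✶ ρ b ✶ ρ 1F)              ≡⟨ norm (x ✶ ρ b) ⟩
      f (x ✶ ρ b) ✶ ρ k               ≡⟨ cong (_✶ ρ k) (ih x) ⟩
      f x ✶ ρ (k ⊗ b) ✶ ρ k           ≡⟨ ✶-assoc (f x) (ρ (k ⊗ b)) (ρ k) ⟩
      f x ✶ ρ (k ⊗ b ⊕ k)             ≡⟨ cong (λ z → f x ✶ ρ z) (solve 2 (λ k b → k :* b :+ k := k :* (b :+ con 1)) refl k b) ⟩
      f x ✶ ρ (k ⊗ (b ⊕ 1F))          ∎

  -- Needed so that the isomorphisms that are not normalising are closed under shifts. Passing a
  -- rotation across a reflection inverts it, so in that case the multiplier changes sign.
  shift-normalising : ∀ j d {c} → Normalising c → Normalising (shift (j , d) c)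
  shift-normalising j d {c} (k , norm) = proj₁ (commute d) , λ x → begin
    apply (shift (j , d) c) (x ✶ ρ 1F)             ≡⟨ apply-shift j d c (x ✶ ρ 1F) ⟩
    apply c (x ✶ ρ 1F ✶ d) ✶ ρ j                   ≡⟨ cong (_✶ ρ j) (proj₂ (commute d) x) ⟩
    apply c (x ✶ d) ✶ ρ (proj₁ (commute d)) ✶ ρ j  ≡⟨ ρ-swap (apply c (x ✶ d)) (proj₁ (commute d)) j ⟩
    apply c (x ✶ d) ✶ ρ j ✶ ρ (proj₁ (commute d))  ≡⟨ cong (_✶ ρ (proj₁ (commute d))) (apply-shift j d c x) ⟨
    apply (shift (j , d) c) x ✶ ρ (proj₁ (commute d)) ∎
    where
    open ≡-Reasoning
    commute : ∀ d → ∃ λ k' → ∀ x → apply c (x ✶ ρ 1F ✶ d) ≡ apply c (x ✶ d) ✶ ρ k'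
    commute (a , false) = k , λ x → trans (cong (apply c) (ρ-swap x 1F a)) (norm (x ✶ ρ a))
    commute (a , true) = k ⊗ ⊖ 1F , λ x → trans (cong (apply c) (flip x)) (normalises-all norm (⊖ 1F) (x ✶ (a , true)))
      where
      flip : ∀ x → x ✶ ρ 1F ✶ (a , true) ≡ x ✶ (a , true) ✶ ρ (⊖ 1F)
      flip x = trans (✶-assoc x (ρ 1F) (a , true)) (trans
        (cong (λ z → x ✶ (z , true)) (trans (⊕-comm 1F a) (cong (a ⊕_) (sym (⁻¹-involutive 1F)))))
        (sym (✶-assoc x (a , true) (ρ (⊖ 1F)))))

  module _ (2≢0 : OddCharacteristic) where

    double≡0 : ∀ a → a ⊕ a ≡ 0F → a ≡ 0F
    double≡0 a eq = ⊗-cancelˡ (1F ⊕ 1F) 2≢0 (trans (solve 1 (λ a → (con 1 :+ con 1) :* a := a :+ a) refl a)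
      (trans eq (sym (⊗-zeroʳ (1F ⊕ 1F)))))

    -- A shift fixing an injective table pairs an element of D₂ₚ with a rotation; as p is odd it is a rotation too,
    -- and if nontrivial it generates ⟨τ⟩.
    stabiliser : ∀ c → (∀ g h → apply c g ≡ apply c h → g ≡ h) → ∀ s → shift s c ≡ c → s ≡ sε ⊎ Normalising c
    stabiliser c inj (j , a , true) fix = contradiction (trans (sym (cong proj₂ d≡e)) refl) λ ()
      where
      open ≡-Reasoning
      d : D p
      d = a , true
      fixed : ∀ x → apply c (x ✶ d) ✶ ρ j ≡ apply c x
      fixed x = trans (sym (apply-shift j d c x)) (cong (λ c → apply c x) fix)
      j≡0 : j ≡ 0F
      -- A reflection is its own inverse, so applying `fixed` twice returns to the start with the
      -- rotation 2j on the right.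
      j≡0 = double≡0 j (ρ-fixes (apply c e) (j ⊕ j) (begin
        apply c e ✶ (ρ j ✶ ρ j)                   ≡⟨ ✶-assoc (apply c e) (ρ j) (ρ j) ⟨
        apply c e ✶ ρ j ✶ ρ j                     ≡⟨ cong (λ x → apply c x ✶ ρ j ✶ ρ j) (x✶d✶d⁻¹≡x e d) ⟨
        apply c (e ✶ d ✶ d) ✶ ρ j ✶ ρ j           ≡⟨ cong (_✶ ρ j) (fixed (e ✶ d)) ⟩
        apply c (e ✶ d) ✶ ρ j                     ≡⟨ fixed e ⟩
        apply c e                                 ∎))
      d≡e : d ≡ e
      d≡e = trans (sym (✶-identityˡ d)) (inj (e ✶ d) e (trans (sym (✶-identityʳ _))
        (trans (cong (λ j → apply c (e ✶ d) ✶ ρ j) (sym j≡0)) (fixed e))))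
    stabiliser c inj (j , a , false) fix with a Fin.≟ 0F
    ... | yes refl = inj₁ (cong (_, e) (ρ-fixes (apply c e) j (trans (cong (λ x → apply c x ✶ ρ j) (sym (✶-identityʳ e)))
            (trans (sym (apply-shift j e c e)) (cong (λ c → apply c e) fix)))))
    ... | no a≢0 = inj₂ (translate-induction a≢0 (λ b → ∃ λ k → ∀ x → apply c (x ✶ ρ b) ≡ apply c x ✶ ρ k) next 0F 1F
            (0F , λ x → trans (cong (apply c) (✶-identityʳ x)) (sym (✶-identityʳ _))))
      where
      open ≡-Reasoning
      fixed : ∀ x → apply c (x ✶ ρ a) ✶ ρ j ≡ apply c x
      fixed x = trans (sym (apply-shift j (ρ a) c x)) (cong (λ c → apply c x) fix)
      next : ∀ b → (∃ λ k → ∀ x → apply c (x ✶ ρ b) ≡ apply c x ✶ ρ k) → ∃ λ k → ∀ x → apply c (x ✶ ρ (b ⊕ a)) ≡ apply c x ✶ ρ k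
      next b (k , h) = k ⊕ ⊖ j , λ x → begin
        apply c (x ✶ (ρ b ✶ ρ a))                     ≡⟨ cong (apply c) (✶-assoc x (ρ b) (ρ a)) ⟨
        apply c (x ✶ ρ b ✶ ρ a)                       ≡⟨ x✶d✶d⁻¹≡x _ (ρ j) ⟨
        apply c (x ✶ ρ b ✶ ρ a) ✶ ρ j ✶ ρ (⊖ j)       ≡⟨ cong (_✶ ρ (⊖ j)) (fixed (x ✶ ρ b)) ⟩
        apply c (x ✶ ρ b) ✶ ρ (⊖ j)                   ≡⟨ cong (_✶ ρ (⊖ j)) (h x) ⟩
        apply c x ✶ ρ k ✶ ρ (⊖ j)                     ≡⟨ ✶-assoc (apply c x) (ρ k) (ρ (⊖ j)) ⟩
        apply c x ✶ ρ (k ⊕ ⊖ j)                       ∎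

-- Isomorphic Cayley graphs are related by a group automorphism

module NormalisingIsomorphisms {p : ℕ} (𝔽 : FieldStructure p) (2≢0 : FieldStructure.OddCharacteristic 𝔽) where

  open Dihedral 𝔽
  open AbelianGroupProperties +-abelianGroup using (⁻¹-involutive)
  open RingProperties ring using (-‿distribˡ-*; -‿distribʳ-*)

  record Related (S T : Subset p) : Set where
    constructor related
    field
      κ γ         : F
      κ≢0         : κ ≢ 0F
      rotations   : ∀ x → S (x , false) ≡ T (κ ⊗ x , false)
      reflections : ∀ x → S (x , true) ≡ T (κ ⊗ x ⊕ γ , true)

  module NormalisingIso {S T : Subset p} {f : D p → D p} (iso : IsIso S T f) {k : F} (norm : Normalises k f) where

    private
      adj-f = proj₁ iso
      inj = proj₂ iso

    k≢0 : k ≢ 0F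
    k≢0 k≡0 = 1≢0 (ρ-fixes e 1F (inj (e ✶ ρ 1F) e (trans (norm e) (trans (cong (λ k → f e ✶ ρ k) k≡0) (✶-identityʳ (f e))))))

    divide : ∀ w → ∃ λ w' → k ⊗ w' ≡ w
    divide w with inverse k k≢0
    ... | k⁻¹ , inv = k⁻¹ ⊗ w , trans (sym (⊗-assoc k k⁻¹ w)) (trans (cong (_⊗ w) inv) (⊗-identityˡ w))

    rotation≡ : ∀ x → f (ρ x) ≡ f e ✶ ρ (k ⊗ x)
    rotation≡ x = trans (cong f (sym (✶-identityˡ (ρ x)))) (normalises-all norm x e)

    reflection-image : ∀ x → f (x , true) ≡ f (0F , true) ✶ ρ (k ⊗ ⊖ x)
    reflection-image x = trans (cong f (sym (reflection≡ x))) (normalises-all norm (⊖ x) (0F , true))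

    -- Since multiples of k exhaust ℤ/p, the images of the rotations fill the whole block of `f e`.
    -- The image of a reflection in that block would contradict injectivity.
    swaps-blocks : proj₂ (f (0F , true)) ≡ not (proj₂ (f e))
    swaps-blocks = Bool.¬-not (λ same → collide (same-block-images same))
      where
      same-block-images : proj₂ (f (0F , true)) ≡ proj₂ (f e) → ∃ λ w → f e ✶ ρ w ≡ f (0F , true)
      same-block-images eq with f (0F , true) | f e
      same-block-images refl | b , β | a , .β = same-block
      collide : (∃ λ w → f e ✶ ρ w ≡ f (0F , true)) → ⊥
      collide (w , eq) with divide w
      ... | w' , kw'≡w with inj (0F , true) (ρ w') (trans (sym eq) (trans (cong (λ w → f e ✶ ρ w) (sym kw'≡w)) (sym (rotation≡ w'))))
      ...   | ()

  -- Following f by right translation by (f e)⁻¹ makes it fix the identity without changing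
  -- adjacency, so S x = T (f x (f e)⁻¹), and this composite is affine on each block. If f e is a
  -- reflection, the translation inverts rotations, whence the multiplier - k.
  normalising-iso⇒related : ∀ {S T f k} → IsIso S T f → Normalises k f → Related S T
  normalising-iso⇒related {S} {T} {f} {k} iso@(adj-f , inj) norm = go (f e) refl (f (0F , true)) refl
    where
    open NormalisingIso {S} {T} {f} iso {k} norm
    open ≡-Reasoning
    image : ∀ x → S x ≡ T (f x ✶ dinv (f e))
    image x = trans (sym (adj-e S x)) (adj-f e x)
    go : ∀ y → f e ≡ y → ∀ z → f (0F , true) ≡ z → Related S T
    go (a , α) fe (b , β) fs with trans (sym (cong proj₂ fs)) (trans swaps-blocks (cong (not ∘ proj₂) fe))
    go (a , false) fe (b , true) fs | refl = related k (b ⊕ ⊖ (⊖ a)) k≢0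
      (λ x → trans (image (ρ x)) (cong T (begin
        f (ρ x) ✶ dinv (f e)                         ≡⟨ cong₂ (λ y z → y ✶ dinv z) (trans (rotation≡ x) (cong (_✶ ρ (k ⊗ x)) fe)) fe ⟩
        (a ⊕ k ⊗ x ⊕ ⊖ a , false)                    ≡⟨ cong (_, false) (xyx⁻¹≈y a (k ⊗ x)) ⟩
        (k ⊗ x , false)                              ∎)))
      (λ x → trans (image (x , true)) (cong T (begin
        f (x , true) ✶ dinv (f e)                    ≡⟨ cong₂ (λ y z → y ✶ dinv z) (trans (reflection-image x) (cong (_✶ ρ (k ⊗ ⊖ x)) fs)) fe ⟩
        (b ⊕ ⊖ (k ⊗ ⊖ x) ⊕ ⊖ (⊖ a) , true)           ≡⟨ cong (λ z → b ⊕ z ⊕ ⊖ (⊖ a) , true) (trans (cong ⊖_ (sym (-‿distribʳ-* k x))) (⁻¹-involutive (k ⊗ x))) ⟩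
        (b ⊕ k ⊗ x ⊕ ⊖ (⊖ a) , true)                 ≡⟨ cong (_, true) (trans (cong (_⊕ ⊖ (⊖ a)) (⊕-comm b (k ⊗ x))) (⊕-assoc (k ⊗ x) b (⊖ (⊖ a)))) ⟩
        (k ⊗ x ⊕ (b ⊕ ⊖ (⊖ a)) , true)               ∎)))
    go (a , true) fe (b , false) fs | refl = related (⊖ k) (b ⊕ a) (λ eq → k≢0 (trans (sym (⁻¹-involutive k)) (trans (cong ⊖_ eq) -0≡0)))
      (λ x → trans (image (ρ x)) (cong T (begin
        f (ρ x) ✶ dinv (f e)                         ≡⟨ cong₂ (λ y z → y ✶ dinv z) (trans (rotation≡ x) (cong (_✶ ρ (k ⊗ x)) fe)) fe ⟩
        (a ⊕ ⊖ (k ⊗ x) ⊕ ⊖ a , false)                ≡⟨ cong (_, false) (trans (xyx⁻¹≈y a (⊖ (k ⊗ x))) (-‿distribˡ-* k x)) ⟩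
        (⊖ k ⊗ x , false)                            ∎)))
      (λ x → trans (image (x , true)) (cong T (begin
        f (x , true) ✶ dinv (f e)                    ≡⟨ cong₂ (λ y z → y ✶ dinv z) (trans (reflection-image x) (cong (_✶ ρ (k ⊗ ⊖ x)) fs)) fe ⟩
        (b ⊕ k ⊗ ⊖ x ⊕ a , true)                     ≡⟨ cong (λ z → b ⊕ z ⊕ a , true) (trans (sym (-‿distribʳ-* k x)) (-‿distribˡ-* k x)) ⟩
        (b ⊕ ⊖ k ⊗ x ⊕ a , true)                     ≡⟨ cong (_, true) (trans (cong (_⊕ a) (⊕-comm b (⊖ k ⊗ x))) (⊕-assoc (⊖ k ⊗ x) b a)) ⟩
        (⊖ k ⊗ x ⊕ (b ⊕ a) , true)                   ∎)))

  ConstantReflections : Subset p → Set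
  ConstantReflections S = ∀ x y → S (x , true) ≡ S (y , true)

  constantReflections? : Decidable ConstantReflections
  constantReflections? S = Fin.all? (λ x → Fin.all? (λ y → S (x , true) Bool.≟ S (y , true)))

  module _ {S : Subset p} (nonconstant : ¬ ConstantReflections S) where

    -- Two normalising automorphisms with the same multiplier and the same value at e differ by a
    -- translation of the reflections, under which the reflections in S would be invariant.
    normalising-determined : ∀ {f f' k} → IsIso S S f → IsIso S S f' → Normalises k f → Normalises k f' →
                             f e ≡ f' e → ∀ x → f x ≡ f' x
    normalising-determined {f} {f'} {k} iso@(adj-f , _) iso'@(adj-f' , _) norm norm' fe≡ = agree
      where
      module M = NormalisingIso {S} {S} {f} iso {k} norm
      module M' = NormalisingIso {S} {S} {f'} iso' {k} norm'
      open ≡-Reasoning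
      blocks : proj₂ (f (0F , true)) ≡ proj₂ (f' (0F , true))
      blocks = trans M.swaps-blocks (trans (cong (not ∘ proj₂) fe≡) (sym M'.swaps-blocks))
      translation : ∃ λ w → f (0F , true) ✶ ρ w ≡ f' (0F , true)
      translation with f (0F , true) | f' (0F , true) | blocks
      ... | b , β | b' , .β | refl = same-block
      w w' : F
      w = proj₁ translation
      w' = proj₁ (M.divide w)
      moved : ∀ x → f' (x , true) ≡ f (x ⊕ ⊖ w' , true)
      moved x = begin
        f' (x , true)                              ≡⟨ M'.reflection-image x ⟩
        f' (0F , true) ✶ ρ (k ⊗ ⊖ x)               ≡⟨ cong (_✶ ρ (k ⊗ ⊖ x)) (proj₂ translation) ⟨
        f (0F , true) ✶ ρ w ✶ ρ (k ⊗ ⊖ x)          ≡⟨ ✶-assoc (f (0F , true)) (ρ w) (ρ (k ⊗ ⊖ x)) ⟩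
        f (0F , true) ✶ ρ (w ⊕ k ⊗ ⊖ x)            ≡⟨ cong (λ z → f (0F , true) ✶ ρ z) (begin
          w ⊕ k ⊗ ⊖ x           ≡⟨ cong (_⊕ k ⊗ ⊖ x) (proj₂ (M.divide w)) ⟨
          k ⊗ w' ⊕ k ⊗ ⊖ x      ≡⟨ ⊗-distribˡ k w' (⊖ x) ⟨
          k ⊗ (w' ⊕ ⊖ x)        ≡⟨ cong (k ⊗_) (trans (⊕-comm w' (⊖ x)) (trans (sym (trans (a-[b-c]≡a-b+c 0F x w') (cong (_⊕ w') (⊕-identityˡ (⊖ x))))) (⊕-identityˡ _))) ⟩
          k ⊗ ⊖ (x ⊕ ⊖ w')      ∎) ⟩
        f (0F , true) ✶ ρ (k ⊗ ⊖ (x ⊕ ⊖ w'))       ≡⟨ M.reflection-image (x ⊕ ⊖ w') ⟨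
        f (x ⊕ ⊖ w' , true)                        ∎
      invariant : ∀ x → S (x , true) ≡ S (x ⊕ ⊖ w' , true)
      invariant x = begin
        S (x , true)                            ≡⟨ adj-e S (x , true) ⟨
        adj S e (x , true)                      ≡⟨ adj-f' e (x , true) ⟩
        adj S (f' e) (f' (x , true))            ≡⟨ cong₂ (adj S) (sym fe≡) (moved x) ⟩
        adj S (f e) (f (x ⊕ ⊖ w' , true))       ≡⟨ adj-f e (x ⊕ ⊖ w' , true) ⟨
        adj S e (x ⊕ ⊖ w' , true)               ≡⟨ adj-e S (x ⊕ ⊖ w' , true) ⟩
        S (x ⊕ ⊖ w' , true)                     ∎
      -w'≡0 : ⊖ w' ≡ 0F
      -w'≡0 = decidable-stable (⊖ w' Fin.≟ 0F) (λ ne → nonconstant (λ x y →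
        sym (translate-induction ne (λ y → S (y , true) ≡ S (x , true)) (λ y eq → trans (sym (invariant y)) eq) x y refl)))
      agree : ∀ x → f x ≡ f' x
      agree (x , false) = trans (M.rotation≡ x) (trans (cong (_✶ ρ (k ⊗ x)) fe≡) (sym (M'.rotation≡ x)))
      agree (x , true)  = sym (trans (moved x) (cong (λ z → f (z , true)) (trans (cong (x ⊕_) -w'≡0) (⊕-identityʳ x))))

    -- Fixes one multiplier for each table, so that automorphisms can be compared by it; `0F` is a
    -- default off the normalising tables.
    multiplier : (c : Table) → F
    multiplier c with normalising? c
    ... | yes (k , _) = k
    ... | no  _       = 0F

    multiplier-normalises : ∀ {c} → Normalising c → Normalises (multiplier c) (apply c)
    multiplier-normalises {c} n with normalising? c
    ... | yes (k , norm) = norm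
    ... | no  ¬n         = contradiction n ¬n

    normalisers : List Table
    normalisers = filter normalising? (isos S S)

    ∈-normalisers⁻ : ∀ {c} → c ∈ normalisers → IsIso S S (apply c) × Normalising c
    ∈-normalisers⁻ {c} c∈ with ∈-filter⁻ normalising? {xs = isos S S} c∈
    ... | c∈' , n = ∈-isos⁻ {S} {S} {c} c∈' , n

    -- There are 2p possible images of `e` and p - 1 nonzero multipliers, and by
    -- `normalising-determined` these two data determine the table.
    length-normalisers : length normalisers ≤ p * 2 * ∣units∣
    length-normalisers = subst (length normalisers ≤_)
      (trans (length-cartesianProductWith _,_ elements units) (cong (_* ∣units∣) length-elements))
      (length-injection _≟ᵗ_ (Product.≡-dec _≟ᵈ_ Fin._≟_) (Unique.filter⁺ normalising? (isos-unique S S))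
        (Unique.cartesianProduct⁺ elements-unique units-unique) (λ c → apply c e , multiplier c) into injective)
      where
      into : ∀ {c} → c ∈ normalisers → (apply c e , multiplier c) ∈ cartesianProduct elements units
      into {c} c∈ with ∈-normalisers⁻ c∈
      ... | iso , n = ∈-cartesianProduct⁺ (∈-elements _)
        (∈-units⁺ (NormalisingIso.k≢0 {S} {S} {apply c} iso (multiplier-normalises {c} n)))
      injective : ∀ {c c'} → c ∈ normalisers → c' ∈ normalisers →
                  (apply c e , multiplier c) ≡ (apply c' e , multiplier c') → c ≡ c'
      injective {c} {c'} c∈ c'∈ eq with ∈-normalisers⁻ c∈ | ∈-normalisers⁻ c'∈
      ... | iso , n | iso' , n' = table-ext (normalising-determined iso iso' (multiplier-normalises {c} n)
        (subst (λ k → Normalises k (apply c')) (sym (cong proj₂ eq)) (multiplier-normalises {c'} n')) (cong proj₁ eq))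

    identityTable : Table
    identityTable = encode id

    identity∈normalisers : identityTable ∈ normalisers
    identity∈normalisers = ∈-filter⁺ normalising? (∈-isos⁺ {S} {S} {identityTable}
        (IsIso-resp {S} {S} (λ x → sym (apply-encode id x)) ((λ _ _ → refl) , λ _ _ → id)))
      (1F , λ x → trans (apply-encode id (x ✶ ρ 1F)) (cong (_✶ ρ 1F) (sym (apply-encode id x))))

    length-shifts : length shifts ≡ p * (p * 2)
    length-shifts = trans (length-cartesianProductWith _,_ (allFin p) elements)
      (cong₂ _*_ {length (allFin p)} {p} (List.length-tabulate id) length-elements)

    -- By `stabiliser` the shifts act freely here. It is applied from S to T, where these are
    -- supposed to be all isomorphisms, and from S to itself, where they are taken away to leave the
    -- normalising automorphisms.
    non-normalising-∣ : ∀ {T} → length shifts ∣ length (filter (¬? ∘ normalising?) (isos S T))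
    non-normalising-∣ {T} = free⇒∣ (Unique.filter⁺ (¬? ∘ normalising?) (isos-unique S T)) closed free
      where
      split : ∀ {c} → c ∈ filter (¬? ∘ normalising?) (isos S T) → c ∈ isos S T × ¬ Normalising c
      split = ∈-filter⁻ (¬? ∘ normalising?) {xs = isos S T}
      closed : Closed (filter (¬? ∘ normalising?) (isos S T))
      closed {c} {j , d} _ c∈ = ∈-filter⁺ (¬? ∘ normalising?)
        (∈-isos⁺ {S} {T} {shift (j , d) c} (shift-iso {S} {T} {c} j d (∈-isos⁻ {S} {T} {c} (proj₁ (split c∈)))))
        (λ n → proj₂ (split c∈) (subst Normalising (shift-sinv (∈-shifts (j , d)) c) (shift-normalising (⊖ j) (dinv d) n)))
      free : ∀ {c s} → c ∈ filter (¬? ∘ normalising?) (isos S T) → shift s c ≡ c → s ≡ sε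
      free {c} {s} c∈ fix with stabiliser 2≢0 c (proj₂ (∈-isos⁻ {S} {T} {c} (proj₁ (split c∈)))) s fix
      ... | inj₁ s≡ε = s≡ε
      ... | inj₂ n   = contradiction n (proj₂ (split c∈))

    module _ {T : Subset p} {f f' : D p → D p} (f'f : ∀ x → f' (f x) ≡ x) (ff' : ∀ x → f (f' x) ≡ x)
             (adj-f : ∀ g h → adj S g h ≡ adj T (f g) (f h)) where

      ∣isos∣≡∣automorphisms∣ : length (isos S T) ≡ length (isos S S)
      ∣isos∣≡∣automorphisms∣ = trans (sym (∑-1 (isos S T))) (trans
        (∑-bijection _≟ᵗ_ _≟ᵗ_ (isos-unique S T) (isos-unique S S)
          (λ c → encode (f' ∘ apply c)) (λ c → encode (f ∘ apply c)) into out
          (λ {c} _ → table-ext (λ x → trans (apply-encode (f ∘ apply (encode (f' ∘ apply c))) x) (trans (cong f (apply-encode (f' ∘ apply c) x)) (ff' _))))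
          (λ {c} _ → table-ext (λ x → trans (apply-encode (f' ∘ apply (encode (f ∘ apply c))) x) (trans (cong f' (apply-encode (f ∘ apply c) x)) (f'f _))))
          (λ _ → 1)) (∑-1 (isos S S)))
        where
        adj-f' : ∀ g h → adj T g h ≡ adj S (f' g) (f' h)
        adj-f' g h = trans (cong₂ (adj T) (sym (ff' g)) (sym (ff' h))) (sym (adj-f (f' g) (f' h)))
        into : ∀ {c} → c ∈ isos S T → encode (f' ∘ apply c) ∈ isos S S
        into {c} c∈ with ∈-isos⁻ {S} {T} {c} c∈
        ... | adj-c , inj = ∈-isos⁺ {S} {S} {encode (f' ∘ apply c)} (IsIso-resp {S} {S} (λ x → sym (apply-encode (f' ∘ apply c) x))
          ((λ g h → trans (adj-c g h) (adj-f' _ _)) , (λ g h eq → inj g h (trans (sym (ff' _)) (trans (cong f eq) (ff' _))))))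
        out : ∀ {c} → c ∈ isos S S → encode (f ∘ apply c) ∈ isos S T
        out {c} c∈ with ∈-isos⁻ {S} {S} {c} c∈
        ... | adj-c , inj = ∈-isos⁺ {S} {T} {encode (f ∘ apply c)} (IsIso-resp {S} {T} (λ x → sym (apply-encode (f ∘ apply c) x))
          ((λ g h → trans (adj-c g h) (adj-f _ _)) , (λ g h eq → inj g h (trans (sym (f'f _)) (trans (cong f' eq) (f'f _))))))

      no-normalising-contradiction : ¬ Any Normalising (isos S T) → ⊥
      no-normalising-contradiction none = ℕ.<⇒≱ small (∣⇒≤ {{>-nonZero (∈-length identity∈normalisers)}} shifts∣normalisers)
        where
        q : ℕ
        q = length shifts
        all-non : filter (¬? ∘ normalising?) (isos S T) ≡ isos S T
        all-non = List.filter-all (¬? ∘ normalising?) (All.¬Any⇒All¬ (isos S T) none)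
        shifts∣automorphisms : q ∣ length (isos S S)
        shifts∣automorphisms = subst (q ∣_) (trans (cong length all-non) ∣isos∣≡∣automorphisms∣) (non-normalising-∣ {T})
        partition : length (filter (¬? ∘ normalising?) (isos S S)) + length normalisers ≡ length (isos S S)
        partition = trans (cong₂ _+_ (length-filter (¬? ∘ normalising?) (isos S S)) (length-filter normalising? (isos S S)))
          (trans (sym (∑-+ (isos S S) (𝟙 ∘ ¬? ∘ normalising?) (𝟙 ∘ normalising?)))
            (trans (∑-cong′ (isos S S) (λ c → one (normalising? c))) (∑-1 (isos S S))))
          where
          one : ∀ {P : Set} (d : Dec P) → 𝟙 (¬? d) + 𝟙 d ≡ 1
          one (yes _) = refl
          one (no _)  = refl
        shifts∣normalisers : q ∣ length normalisers
        shifts∣normalisers = ∣m+n∣m⇒∣n (subst (q ∣_) (sym partition) shifts∣automorphisms) (non-normalising-∣ {S})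
        p≡ : suc ∣units∣ ≡ p
        p≡ = trans suc∣units∣≡∣els∣ (List.length-tabulate id)
        small : length normalisers < q
        small = ℕ.≤-<-trans length-normalisers (subst (p * 2 * ∣units∣ <_) (trans (ℕ.*-comm (p * 2) p) (sym length-shifts))
          (ℕ.*-monoʳ-< (p * 2) {{>-nonZero (subst (0 <_) length-elements (∈-length (∈-elements e)))}} (ℕ.≤-reflexive p≡)))

      nonconstant⇒related : Related S T
      nonconstant⇒related with Any.any? normalising? (isos S T)
      ... | no none = ⊥-elim (no-normalising-contradiction none)
      ... | yes some with find some
      ...   | c , c∈ , k , norm = normalising-iso⇒related {S} {T} {apply c} (∈-isos⁻ {S} {T} {c} c∈) norm

-- Full sets of reflections: circulant graphs and their prisms

module Isomorphisms {p : ℕ} (𝔽 : FieldStructure p) (2≢0 : FieldStructure.OddCharacteristic 𝔽) where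

  open Dihedral 𝔽 public
  open NormalisingIsomorphisms 𝔽 2≢0 public
  open AbelianGroupProperties +-abelianGroup using (⁻¹-involutive)
  open RingProperties ring using (+-inverseˡ-unique)

  module _ {S T : Subset p} {f f' : D p → D p} (f'f : ∀ x → f' (f x) ≡ x) (ff' : ∀ x → f (f' x) ≡ x)
           (adj-f : ∀ g h → adj S g h ≡ adj T (f g) (f h))
           (S-full : ∀ x → S (x , true) ≡ true) (T-full : ∀ x → T (x , true) ≡ true) where

    adj-cross : ∀ {g h} → proj₂ g ≢ proj₂ h → adj T g h ≡ true
    adj-cross {a , false} {b , false} ne = contradiction refl ne
    adj-cross {a , false} {b , true}  ne = T-full _
    adj-cross {a , true}  {b , false} ne = T-full _
    adj-cross {a , true}  {b , true}  ne = contradiction refl ne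

    -- S is the complete graph. Distinct vertices have distinct images under f', so T is complete
    -- too, and the identity automorphism relates the two.
    complete-case : S e ≡ false → T e ≡ false → (∀ x → x ≢ 0F → S (x , false) ≡ true) → Related S T
    complete-case S0 T0 S-all = related 1F 0F 1≢0
      (λ x → trans (same x) (cong (λ y → T (y , false)) (sym (⊗-identityˡ x))))
      (λ x → trans (S-full x) (sym (T-full _)))
      where
      S-nontrivial : ∀ z → z ≢ e → S z ≡ true
      S-nontrivial (x , true)  _  = S-full x
      S-nontrivial (x , false) ne = S-all x (λ { refl → ne refl })
      same : ∀ x → S (x , false) ≡ T (x , false)
      same x with x Fin.≟ 0F
      ... | yes refl = trans S0 (sym T0)
      ... | no  x≢0  = trans (S-all x x≢0) (sym (begin
        T (ρ x)                              ≡⟨ adj-e T (ρ x) ⟨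
        adj T e (ρ x)                        ≡⟨ cong₂ (adj T) (ff' e) (ff' (ρ x)) ⟨
        adj T (f (f' e)) (f (f' (ρ x)))      ≡⟨ adj-f (f' e) (f' (ρ x)) ⟨
        S (f' (ρ x) ✶ dinv (f' e))           ≡⟨ S-nontrivial _ (λ eq → x≢0 (cong proj₁ (begin
          ρ x             ≡⟨ ff' (ρ x) ⟨
          f (f' (ρ x))    ≡⟨ cong f (✶-cancelʳ (dinv (f' e)) _ _ (trans eq (sym (✶-inverseʳ (f' e))))) ⟩
          f (f' e)        ≡⟨ ff' e ⟩
          e               ∎))) ⟩
        true                                 ∎))
        where open ≡-Reasoning

    -- A missing rotation makes the complement of the graph a disjoint union of two connected
    -- circulant graphs, so f permutes the two blocks and restricts to an isomorphism u of circulants,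
    -- which is then transported to the prisms over them.
    module _ {a : F} (a≢0 : a ≢ 0F) (Sa : S (a , false) ≡ false) where

      non-edge : ∀ x β → adj S (x , β) (x ⊕ a , β) ≡ false
      non-edge x false = trans (cong (λ z → S (z , false)) (xyx⁻¹≈y x a)) Sa
      non-edge x true  = trans (cong (λ z → S (z , false)) (xyx⁻¹≈y x a)) Sa

      block-next : ∀ x β → proj₂ (f (x ⊕ a , β)) ≡ proj₂ (f (x , β))
      block-next x β = decidable-stable (_ Bool.≟ _) (λ ne →
        contradiction (trans (sym (adj-cross (ne ∘ sym))) (trans (sym (adj-f (x , β) (x ⊕ a , β))) (non-edge x β))) λ ())

      block-constant : ∀ β x y → proj₂ (f (y , β)) ≡ proj₂ (f (x , β))
      block-constant β x y = translate-induction a≢0 (λ y → proj₂ (f (y , β)) ≡ proj₂ (f (x , β)))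
        (λ y eq → trans (block-next y β) eq) x y refl

      π : Bool
      π = proj₂ (f e)

      u u' : F → F
      u x = proj₁ (f (x , false))
      u' y = proj₁ (f' (y , π))

      f≡u : ∀ x → f (x , false) ≡ (u x , π)
      f≡u x = cong (u x ,_) (block-constant false 0F x)

      f'≡u' : ∀ y → f' (y , π) ≡ (u' y , false)
      f'≡u' y = cong (u' y ,_) (Bool.¬-not one-block)
        where
        -- Otherwise f would send the reflections into the block π along with the rotations, and
        -- miss the other block.
        one-block : proj₂ (f' (y , π)) ≡ true → ⊥
        one-block eq = Bool.not-¬ refl (begin
          π                          ≡⟨ everything (f' (0F , not π)) ⟨
          proj₂ (f (f' (0F , not π)))  ≡⟨ cong proj₂ (ff' (0F , not π)) ⟩
          not π                      ∎)
          where
          open ≡-Reasoning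
          everything : ∀ z → proj₂ (f z) ≡ π
          everything (x , false) = block-constant false 0F x
          everything (x , true)  = trans (block-constant true (u' y) x) (trans (cong (λ b → proj₂ (f (u' y , b))) (sym eq)) (cong proj₂ (ff' (y , π))))

      u'u : ∀ x → u' (u x) ≡ x
      u'u x = cong proj₁ (trans (cong f' (sym (f≡u x))) (f'f (x , false)))

      uu' : ∀ y → u (u' y) ≡ y
      uu' y = cong proj₁ (trans (cong f (sym (f'≡u' y))) (ff' (y , π)))

      circulant : ∀ x y → S (y ⊕ ⊖ x , false) ≡ T (u y ⊕ ⊖ u x , false)
      circulant x y = trans (adj-f (x , false) (y , false)) (trans (cong₂ (adj T) (f≡u x) (f≡u y)) (drop π))
        where
        drop : ∀ β → adj T (u x , β) (u y , β) ≡ T (u y ⊕ ⊖ u x , false)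
        drop false = refl
        drop true  = refl

      -- For symmetric `U` this is the circulant graph of `U` times an edge: the single reflection σ
      -- matches `(x , false)` with `(⊖ x , true)`.
      prism : Subset p → Subset p
      prism U (x , false) = U (x , false)
      prism U (x , true)  = does (x Fin.≟ 0F)

      -- The matching of a prism pairs x with `⊖ x`, so the action on reflections is conjugated by
      -- negation.
      lift : (F → F) → D p → D p
      lift v (x , false) = v x , false
      lift v (x , true)  = ⊖ v (⊖ x) , true

      lift-inverse : ∀ {v v' : F → F} → (∀ x → v' (v x) ≡ x) → ∀ x → lift v' (lift v x) ≡ x
      lift-inverse         v'v (x , false) = cong (_, false) (v'v x)
      lift-inverse {v' = v'} v'v (x , true) = cong (_, true)
        (trans (cong (λ z → ⊖ v' z) (⁻¹-involutive _)) (trans (cong ⊖_ (v'v (⊖ x))) (⁻¹-involutive x)))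

      does-cong : ∀ {x y} → (x ≡ 0F → y ≡ 0F) → (y ≡ 0F → x ≡ 0F) → does (x Fin.≟ 0F) ≡ does (y Fin.≟ 0F)
      does-cong {x} {y} to from with x Fin.≟ 0F
      ... | yes x≡0 = sym (dec-true (y Fin.≟ 0F) (to x≡0))
      ... | no  x≢0 = sym (dec-false (y Fin.≟ 0F) (x≢0 ∘ from))

      x+y≡0⇒-y≡x : ∀ {x y} → x ⊕ y ≡ 0F → ⊖ y ≡ x
      x+y≡0⇒-y≡x {x} {y} eq = sym (+-inverseˡ-unique x y eq)

      perfect-matching : ∀ x y → does (y ⊕ x Fin.≟ 0F) ≡ does (⊖ u (⊖ y) ⊕ u x Fin.≟ 0F)
      perfect-matching x y = does-cong
        (λ eq → trans (cong (λ z → ⊖ u (⊖ y) ⊕ u z) (sym (x+y≡0⇒-y≡x (trans (⊕-comm x y) eq)))) (⊖-inverseˡ (u (⊖ y))))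
        (λ eq → trans (cong (y ⊕_) (trans (sym (u'u x)) (trans (cong u' (sym (trans (sym (⁻¹-involutive _))
          (x+y≡0⇒-y≡x (trans (⊕-comm (u x) _) eq))))) (u'u (⊖ y))))) (⊖-inverseʳ y))

      lift-adj : ∀ g h → adj (prism S) g h ≡ adj (prism T) (lift u g) (lift u h)
      lift-adj (x , false) (y , false) = circulant x y
      lift-adj (x , false) (y , true)  = trans (cong (λ z → does (y ⊕ z Fin.≟ 0F)) (⁻¹-involutive x))
        (trans (perfect-matching x y) (cong (λ z → does (⊖ u (⊖ y) ⊕ z Fin.≟ 0F)) (sym (⁻¹-involutive (u x)))))
      lift-adj (x , true)  (y , false) = trans (cong (λ z → does (z Fin.≟ 0F)) (⊕-comm y x))
        (trans (perfect-matching y x) (cong (λ z → does (z Fin.≟ 0F)) (⊕-comm _ (u y))))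
      lift-adj (x , true)  (y , true)  = trans (cong (λ z → S (z , false)) (negate y x))
        (trans (circulant (⊖ y) (⊖ x)) (cong (λ z → T (z , false)) (sym (negate' (u (⊖ y)) (u (⊖ x))))))
        where
        negate : ∀ y x → y ⊕ ⊖ x ≡ ⊖ x ⊕ ⊖ (⊖ y)
        negate y x = trans (⊕-comm y (⊖ x)) (cong (⊖ x ⊕_) (sym (⁻¹-involutive y)))
        negate' : ∀ b a → ⊖ b ⊕ ⊖ (⊖ a) ≡ a ⊕ ⊖ b
        negate' b a = trans (cong (⊖ b ⊕_) (⁻¹-involutive a)) (⊕-comm (⊖ b) a)

      prism-nonconstant : ¬ ConstantReflections (prism S)
      prism-nonconstant const = contradiction
        (trans (sym (dec-true (0F Fin.≟ 0F) refl)) (trans (const 0F 1F) (dec-false (1F Fin.≟ 0F) 1≢0))) λ ()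

      -- A subset and its prism have the same rotations, so the multiplier found for the prisms
      -- serves; full sets of reflections fit any translation.
      circulant-case : Related S T
      circulant-case = related κ γ κ≢0 rotations (λ x → trans (S-full x) (sym (T-full _)))
        where open Related (nonconstant⇒related {prism S} prism-nonconstant {prism T} {lift u} {lift u'}
                              (lift-inverse u'u) (lift-inverse uu') lift-adj)

    full⇒related : S e ≡ false → T e ≡ false → Related S T
    full⇒related S0 T0 with Fin.any? (λ a → ¬? (a Fin.≟ 0F) ×-dec (S (a , false) Bool.≟ false))
    ... | yes (a , a≢0 , Sa) = circulant-case a≢0 Sa
    ... | no  none = complete-case S0 T0 (λ x x≢0 → Bool.¬-not (λ Sx → none (x , x≢0 , Sx)))

  isomorphic⇒related : ∀ {S T f f'} → (∀ x → f' (f x) ≡ x) → (∀ x → f (f' x) ≡ x) →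
    (∀ g h → adj S g h ≡ adj T (f g) (f h)) → S e ≡ false → T e ≡ false →
    (∃ λ x → S (x , true) ≡ true) → (∃ λ x → T (x , true) ≡ true) → Related S T
  isomorphic⇒related {S} {T} {f} {f'} f'f ff' adj-f S0 T0 (x , Sx) (y , Ty) = go (constantReflections? S) (constantReflections? T)
    where
    go : Dec (ConstantReflections S) → Dec (ConstantReflections T) → Related S T
    go (no S-nonconst) _ = nonconstant⇒related {S} S-nonconst {T} {f} {f'} f'f ff' adj-f
    -- Impossible: an automorphism relating T to S, found from the nonconstant T, would pull
    -- constancy back to T.
    go (yes S-const) (no T-nonconst) = contradiction T-const T-nonconst
      where
      open Related (nonconstant⇒related {T} T-nonconst {S} {f'} {f} ff' f'f
        (λ g h → trans (cong₂ (adj T) (sym (ff' g)) (sym (ff' h))) (sym (adj-f (f' g) (f' h)))))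
      T-const : ConstantReflections T
      T-const x y = trans (reflections x) (trans (S-const _ _) (sym (reflections y)))
    -- A constant set of reflections with one member is full.
    go (yes S-const) (yes T-const) = full⇒related {S} {T} {f} {f'} f'f ff' adj-f
      (λ z → trans (S-const z x) Sx) (λ z → trans (T-const z y) Ty) S0 T0

-- Classification of the connected Cayley graphs

module Classification {p : ℕ} (𝔽 : FieldStructure p)
  (2≢0 : FieldStructure.OddCharacteristic 𝔽) (agrees : FieldStructure.AgreesWithDefs 𝔽) where

  open Configurations 𝔽 using (Configuration; act; ∈-affineMaps⁺; ∈-affineMaps⁻; recipF; k⊗[k⁻¹⊗z]≡z; k⁻¹⊗[k⊗z]≡z;
    lookup-scale; lookup-affine; Symmetric; Joined; Empty; Singleton; point; lookup-point-≡; lookup-point-≢; point-true;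
    joinedConfigurations; ∈-joined⁺; ∈-joined⁻; representatives; _~_; ~-sym; module Transversal)
  open Isomorphisms 𝔽 2≢0
  open AbelianGroupProperties +-abelianGroup using (⁻¹-involutive; ⁻¹-injective)
  open RingProperties ring using (-‿distribʳ-*)
  open Transversal representatives

  private
    addF≡⊕ = proj₁ agrees
    negF≡⊖ = proj₁ (proj₂ agrees)
    toℕ-0F = proj₂ (proj₂ agrees)

  ·≡✶ : ∀ (x y : D p) → x · y ≡ x ✶ y
  ·≡✶ (a , false) (c , d) = cong (_, d) (addF≡⊕ a c)
  ·≡✶ (a , true)  (c , d) = cong (_, not d) (trans (addF≡⊕ a (negF c)) (cong (a ⊕_) (negF≡⊖ c)))

  inv≡dinv : ∀ (x : D p) → inv x ≡ dinv x
  inv≡dinv (a , false) = cong (_, false) (negF≡⊖ a)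
  inv≡dinv (a , true)  = refl

  Adj≡adj : ∀ S (g h : D p) → Adj S g h ≡ adj S g h
  Adj≡adj S g h = cong S (trans (·≡✶ h (inv g)) (cong (h ✶_) (inv≡dinv g)))

  subset : Configuration → Subset p
  subset (A , B) (x , false) = lookup A x
  subset (A , B) (x , true)  = lookup B x

  configuration : Subset p → Configuration
  configuration S = tabulate (λ x → S (x , false)) , tabulate (λ x → S (x , true))

  subset-configuration : ∀ S x → subset (configuration S) x ≡ S x
  subset-configuration S (x , false) = Vec.lookup∘tabulate _ x
  subset-configuration S (x , true)  = Vec.lookup∘tabulate _ x

  connectionSet⇒symmetric : ∀ {S} → ConnectionSet S → Symmetric (proj₁ (configuration S))
  connectionSet⇒symmetric {S} (S0 , S-inv) =
    trans (subset-configuration S e) (S0 0F toℕ-0F) ,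
    (λ x → trans (subset-configuration S (⊖ x , false)) (trans (cong (λ y → S (y , false)) (sym (negF≡⊖ x)))
      (trans (S-inv (x , false)) (sym (subset-configuration S (x , false))))))

  symmetric⇒connectionSet : ∀ {A B} → Symmetric A → ConnectionSet (subset (A , B))
  symmetric⇒connectionSet {A} {B} (A0 , A-sym) =
    (λ a a≡0 → trans (cong (lookup A) (Fin.toℕ-injective (trans a≡0 (sym toℕ-0F)))) A0) ,
    (λ { (x , false) → trans (cong (lookup A) (negF≡⊖ x)) (A-sym x) ; (x , true) → refl })

  nonempty : ∀ B → ¬ Empty B → ∃ λ b → lookup B b ≡ true
  nonempty B ¬empty with Fin.any? (λ b → lookup B b Bool.≟ true)
  ... | yes some = some
  ... | no  none = contradiction (λ x → Bool.¬-not (λ Bx → none (x , Bx))) ¬empty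

  -- Connectedness as propagation of a predicate from the end of an edge to its start; in the
  -- application `P` says that a fixed vertex can be reached.
  module _ {A B : Vec Bool p} (A0 : lookup A 0F ≡ false) (joined : Joined (A , B))
           {P : D p → Set} (back : ∀ g h → adj (subset (A , B)) g h ≡ true → P h → P g) where

    private
      S : Subset p
      S = subset (A , B)

      b₀ : F
      b₀ = proj₁ (nonempty B (proj₁ joined))

      Sb₀ : lookup B b₀ ≡ true
      Sb₀ = proj₂ (nonempty B (proj₁ joined))

    generator-back : ∀ s → S s ≡ true → ∀ g → P (s ✶ g) → P g
    generator-back s Ss g = back g (s ✶ g) (trans (cong S (x✶d✶d⁻¹≡x s g)) Ss)

    -- A nontrivial rotation generated by S: a rotation in S or, if there is none, the product τ^b σ
    -- τ^(b₀) σ = τ^(b - b₀) of two distinct reflections. With B nonempty, only A = ∅ and ∣B∣ = 1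
    -- offers neither.
    translation-back : ∃ λ a → a ≢ 0F × (∀ g → P (ρ a ✶ g) → P g)
    translation-back with Fin.any? (λ a → lookup A a Bool.≟ true)
    ... | yes (a , Aa) = a , (λ { refl → contradiction (trans (sym Aa) A0) λ () }) , generator-back (ρ a) Aa
    ... | no  none with Fin.any? (λ b → ¬? (b Fin.≟ b₀) ×-dec (lookup B b Bool.≟ true))
    ...   | yes (b , b≢b₀ , Bb) = b ⊕ ⊖ b₀ ,
              (λ eq → b≢b₀ (trans (sym (⊕-identityʳ b)) (trans (cong (b ⊕_) (sym (⊖-inverseˡ b₀)))
                (trans (sym (⊕-assoc b (⊖ b₀) b₀)) (trans (cong (_⊕ b₀) eq) (⊕-identityˡ b₀)))))) ,
              (λ g Pg → generator-back (b₀ , true) Sb₀ g (generator-back (b , true) Bb ((b₀ , true) ✶ g) (subst P (✶-assoc (b , true) (b₀ , true) g) Pg)))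
    ...   | no  alone = contradiction ((λ x → Bool.¬-not (λ Ax → none (x , Ax))) , b₀ , lookup-ext at) (proj₂ joined)
      where
      at : ∀ x → lookup (point b₀) x ≡ lookup B x
      at x with x Fin.≟ b₀
      ... | yes refl = trans (lookup-point-≡ b₀) (sym Sb₀)
      ... | no  x≢b₀ = trans (lookup-point-≢ x≢b₀) (sym (Bool.¬-not (λ Bx → alone (x , x≢b₀ , Bx))))

    within-block : ∀ β x y → P (x , β) → P (y , β)
    within-block β x y with translation-back
    ... | a , a≢0 , tr = translate-induction (λ -a≡0 → a≢0 (⁻¹-injective (trans -a≡0 (sym -0≡0))))
      (λ x → P (x , β)) (λ x Px → tr (x ⊕ ⊖ a , β) (subst (λ z → P (z , β)) (sym (x+[y-x]≡y a x)) Px)) x y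

    everywhere : ∀ g h → P g → P h
    everywhere (x , β) (y , β') Pg with β Bool.≟ β'
    ... | yes refl = within-block β x y Pg
    ... | no  ne   = generator-back (b₀ , true) Sb₀ (y , β')
      (subst (λ b → P (b₀ ⊕ ⊖ y , b)) (Bool.¬-not ne) (within-block β x (b₀ ⊕ ⊖ y) Pg))

  joined⇒connected : ∀ {A B} → Symmetric A → Joined (A , B) → Connected (subset (A , B))
  joined⇒connected {A} {B} sym-A joined g h = everywhere {A} {B} (proj₁ sym-A) joined {λ z → Reach (subset (A , B)) z h}
    (λ g k adj-gk → step (trans (Adj≡adj (subset (A , B)) g k) adj-gk)) h g here

  reach-invariant : ∀ S (Q : D p → Set) → (∀ g h → adj S g h ≡ true → Q g → Q h) → ∀ {g h} → Reach S g h → Q g → Q h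
  reach-invariant S Q fwd here Qg = Qg
  reach-invariant S Q fwd (step {g} {h} adj-gh reach) Qg =
    reach-invariant S Q fwd reach (fwd g h (trans (sym (Adj≡adj S g h)) adj-gh) Qg)

  -- Each excluded configuration leaves a proper set of vertices closed under edges: the rotations
  -- if B = ∅, and the two vertices e and τ^(x₀) σ if that reflection is all of S.
  connected⇒joined : ∀ {S} → Connected S → Joined (configuration S)
  connected⇒joined {S} conn = ¬empty , ¬thin
    where
    S-rotation : ∀ x → lookup (proj₁ (configuration S)) x ≡ S (x , false)
    S-rotation x = subset-configuration S (x , false)
    S-reflection : ∀ x → lookup (proj₂ (configuration S)) x ≡ S (x , true)
    S-reflection x = subset-configuration S (x , true)
    ¬empty : ¬ Empty (proj₂ (configuration S))
    ¬empty em with reach-invariant S (λ g → proj₂ g ≡ false) same-block-edge (conn e (0F , true)) refl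
      where
      same-block-edge : ∀ g h → adj S g h ≡ true → proj₂ g ≡ false → proj₂ h ≡ false
      same-block-edge (x , false) (y , false) _  _ = refl
      same-block-edge (x , false) (y , true) adj _ = contradiction (trans (sym adj) (trans (sym (S-reflection _)) (em _))) λ ()
    ... | ()
    ¬thin : ¬ (Empty (proj₁ (configuration S)) × Singleton (proj₂ (configuration S)))
    ¬thin (emA , x₀ , pt) with reach-invariant S (λ g → g ≡ e ⊎ g ≡ (x₀ , true)) single-edge (conn e (ρ 1F)) (inj₁ refl)
      where
      no-rotation : ∀ {x} → S (x , false) ≡ true → ⊥
      no-rotation {x} Sx = contradiction (trans (sym Sx) (trans (sym (S-rotation x)) (emA x))) λ ()
      only-x₀ : ∀ {x} → S (x , true) ≡ true → x ≡ x₀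
      only-x₀ {x} Sx = point-true (trans (cong (λ v → lookup v x) pt) (trans (S-reflection x) Sx))
      single-edge : ∀ g h → adj S g h ≡ true → g ≡ e ⊎ g ≡ (x₀ , true) → h ≡ e ⊎ h ≡ (x₀ , true)
      single-edge g (y , false) adj-gh (inj₁ refl) = ⊥-elim (no-rotation adj-gh)
      single-edge g (y , true)  adj-gh (inj₁ refl) = inj₂ (cong (_, true) (only-x₀ (trans (sym (adj-e S (y , true))) adj-gh)))
      single-edge g (y , true)  adj-gh (inj₂ refl) = ⊥-elim (no-rotation adj-gh)
      single-edge g (y , false) adj-gh (inj₂ refl) = inj₁ (cong (_, false)
        (∙-cancelʳ x₀ y 0F (trans (only-x₀ adj-gh) (sym (⊕-identityˡ x₀)))))
    ... | inj₁ eq = 1≢0 (cong proj₁ eq)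
    ... | inj₂ ()

  -- The group automorphism with parameters (k, c) is itself the isomorphism. Subsets are compared
  -- pointwise, since a function agrees only pointwise with the one rebuilt from its bit vectors.
  ~⇒GraphIso : ∀ x y S T → (∀ g → subset x g ≡ T g) → (∀ g → subset y g ≡ S g) → x ~ y → GraphIso S T
  ~⇒GraphIso (A , B) y S T x≡T y≡S ((k , c) , g∈ , refl) = φ , φ' , φ'φ , φφ' , λ g h →
    trans (Adj≡adj S g h) (trans (sym (y≡S _)) (trans (transport (h ✶ dinv g)) (trans (cong (subset (A , B)) (φ-hom g h))
      (trans (x≡T _) (sym (Adj≡adj T (φ g) (φ h)))))))
    where
    open ≡-Reasoning
    k≢0 : k ≢ 0F
    k≢0 = ∈-affineMaps⁻ g∈
    φ φ' : D p → D p
    φ (x , false) = k ⊗ x , false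
    φ (x , true)  = k ⊗ x ⊕ c , true
    φ' (x , false) = recipF k ⊗ x , false
    φ' (x , true)  = recipF k ⊗ (x ⊕ ⊖ c) , true
    φ'φ : ∀ x → φ' (φ x) ≡ x
    φ'φ (x , false) = cong (_, false) (k⁻¹⊗[k⊗z]≡z k≢0 x)
    φ'φ (x , true)  = cong (_, true) (trans (cong (recipF k ⊗_) (trans (⊕-assoc (k ⊗ x) c (⊖ c))
      (trans (cong (k ⊗ x ⊕_) (⊖-inverseʳ c)) (⊕-identityʳ (k ⊗ x))))) (k⁻¹⊗[k⊗z]≡z k≢0 x))
    φφ' : ∀ x → φ (φ' x) ≡ x
    φφ' (x , false) = cong (_, false) (k⊗[k⁻¹⊗z]≡z k≢0 x)
    φφ' (x , true)  = cong (_, true) (trans (cong (_⊕ c) (k⊗[k⁻¹⊗z]≡z k≢0 (x ⊕ ⊖ c)))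
      (trans (⊕-assoc x (⊖ c) c) (trans (cong (x ⊕_) (⊖-inverseˡ c)) (⊕-identityʳ x))))
    transport : ∀ z → subset (act (k , c) (A , B)) z ≡ subset (A , B) (φ z)
    transport (x , false) = lookup-scale k A x
    transport (x , true)  = lookup-affine k c B x
    k[b-a] : ∀ b a → k ⊗ (b ⊕ ⊖ a) ≡ k ⊗ b ⊕ ⊖ (k ⊗ a)
    k[b-a] b a = trans (⊗-distribˡ k b (⊖ a)) (cong (k ⊗ b ⊕_) (sym (-‿distribʳ-* k a)))
    φ-hom : ∀ g h → φ (h ✶ dinv g) ≡ φ h ✶ dinv (φ g)
    φ-hom (a , false) (b , false) = cong (_, false) (k[b-a] b a)
    φ-hom (a , true)  (b , false) = cong (_, true) (trans (cong (_⊕ c) (⊗-distribˡ k b a)) (⊕-assoc (k ⊗ b) (k ⊗ a) c))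
    φ-hom (a , false) (b , true)  = cong (_, true) (begin
      k ⊗ (b ⊕ ⊖ (⊖ a)) ⊕ c             ≡⟨ cong (λ z → k ⊗ (b ⊕ z) ⊕ c) (⁻¹-involutive a) ⟩
      k ⊗ (b ⊕ a) ⊕ c                   ≡⟨ solve 4 (λ k b a c → k :* (b :+ a) :+ c := (k :* b :+ c) :+ k :* a) refl k b a c ⟩
      k ⊗ b ⊕ c ⊕ k ⊗ a                 ≡⟨ cong (k ⊗ b ⊕ c ⊕_) (⁻¹-involutive (k ⊗ a)) ⟨
      k ⊗ b ⊕ c ⊕ ⊖ (⊖ (k ⊗ a))         ∎)
      where open SemiringSolver commutativeSemiring
    φ-hom (a , true)  (b , true)  = cong (_, false) (begin
      k ⊗ (b ⊕ ⊖ a)                     ≡⟨ k[b-a] b a ⟩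
      k ⊗ b ⊕ ⊖ (k ⊗ a)                 ≡⟨ cong (_⊕ ⊖ (k ⊗ a)) (trans (⊕-assoc (k ⊗ b) c (⊖ c)) (trans (cong (k ⊗ b ⊕_) (⊖-inverseʳ c)) (⊕-identityʳ (k ⊗ b)))) ⟨
      k ⊗ b ⊕ c ⊕ ⊖ c ⊕ ⊖ (k ⊗ a)       ≡⟨ a-[b+c]≡a-b-c (k ⊗ b ⊕ c) c (k ⊗ a) ⟨
      k ⊗ b ⊕ c ⊕ ⊖ (c ⊕ k ⊗ a)         ≡⟨ cong (λ z → k ⊗ b ⊕ c ⊕ ⊖ z) (⊕-comm c (k ⊗ a)) ⟩
      k ⊗ b ⊕ c ⊕ ⊖ (k ⊗ a ⊕ c)         ∎)

  -- The orbit relation runs from y to x because the action substitutes into subsets: y pulled back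
  -- along the automorphism is x.
  GraphIso⇒~ : ∀ {x y} → x ∈ joinedConfigurations → y ∈ joinedConfigurations → GraphIso (subset x) (subset y) → y ~ x
  GraphIso⇒~ {A , B} {A' , B'} x∈ y∈ (f , f' , f'f , ff' , adj-f) with ∈-joined⁻ x∈ | ∈-joined⁻ y∈
  ... | (A0 , _) , ¬emptyB , _ | (A'0 , _) , ¬emptyB' , _ = orbit (isomorphic⇒related {subset (A , B)} {subset (A' , B')} {f} {f'} f'f ff'
      (λ g h → trans (sym (Adj≡adj (subset (A , B)) g h)) (trans (adj-f g h) (Adj≡adj (subset (A' , B')) (f g) (f h))))
      A0 A'0 (nonempty B ¬emptyB) (nonempty B' ¬emptyB'))
    where
    orbit : Related (subset (A , B)) (subset (A' , B')) → (A' , B') ~ (A , B)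
    orbit (related κ γ κ≢0 rot ref) = (κ , γ) , ∈-affineMaps⁺ κ≢0 , cong₂ _,_
      (lookup-ext (λ x → trans (lookup-scale κ A' x) (sym (rot x))))
      (lookup-ext (λ x → trans (lookup-affine κ γ B' x) (sym (ref x))))

  classification : NumConnCayleyUpToIso p (length reps)
  classification = map subset reps , List.length-map subset reps , conn-cayley , pairwise , cover
    where
    conn-cayley : All ConnCayley (map subset reps)
    conn-cayley = All.map⁺ (All.map (λ x∈ → let sym-A , joined = ∈-joined⁻ x∈ in
      symmetric⇒connectionSet sym-A , joined⇒connected sym-A joined) reps⊆)
    pairwise : AllPairs (λ S T → ¬ GraphIso S T) (map subset reps)
    pairwise = AllPairs.map⁺ (separate reps⊆ distinct)
      where
      separate : ∀ {xs} → All (_∈ joinedConfigurations) xs → AllPairs (λ x y → ¬ (x ~ y)) xs →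
                 AllPairs (λ x y → ¬ GraphIso (subset x) (subset y)) xs
      separate []         []         = []
      separate (x∈ ∷ xs∈) (x≁ ∷ xs≁) =
        All.zipWith (λ (y∈ , x≁y) iso → x≁y (~-sym (GraphIso⇒~ x∈ y∈ iso))) (xs∈ , x≁) ∷ separate xs∈ xs≁
    cover : ∀ S → ConnCayley S → Any (GraphIso S) (map subset reps)
    cover S (cs , conn) = Any.map⁺ (Any.map
      (λ {y} x~y → ~⇒GraphIso y (configuration S) S (subset y) (λ _ → refl) (subset-configuration S) (~-sym x~y))
      (covers {configuration S} (∈-joined⁺ (connectionSet⇒symmetric cs) (connected⇒joined conn))))

-- Odd primes and the final count

residueField : ∀ n → Prime (suc n) → FieldStructure (suc n)
residueField n pr = record
  { isCommutativeRing = isCommutativeRing ; 1≢0 = 1F≢0F pr ; inverse = inverse pr ; translate-induction = translate-induction pr }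
  where open Residues n

even-or-odd : ∀ n → ∃ λ m → n ≡ m + m ⊎ n ≡ suc (m + m)
even-or-odd zero = 0 , inj₁ refl
even-or-odd (suc n) with even-or-odd n
... | m , inj₁ refl = m , inj₂ refl
... | m , inj₂ refl = suc m , inj₁ (cong suc (sym (ℕ.+-suc m m)))

prime-odd : ∀ {p} → Prime p → ¬ (2 ∣ p) → ∃ λ m → NonZero m × p ≡ suc (m + m)
prime-odd {p} pr 2∤p with even-or-odd p
... | m     , inj₁ refl = contradiction (divides m (trans (cong (m +_) (sym (ℕ.+-identityʳ m))) (ℕ.*-comm 2 m))) 2∤p
... | zero  , inj₂ refl = contradiction pr Prime.¬prime[1]
... | suc m , inj₂ eq   = suc m , _ , eq

odd-prime-field : ∀ m .{{_ : NonZero m}} {p} → p ≡ suc (m + m) → Prime p →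
  Σ (FieldStructure p) λ 𝔽 → FieldStructure.OddCharacteristic 𝔽 × FieldStructure.AgreesWithDefs 𝔽
odd-prime-field m refl pr = residueField (m + m) pr , odd , (λ _ _ → refl) , (λ _ → refl) , refl
  where
  open ≡-Reasoning
  open Residues (m + m)
  0<m : 0 < m
  0<m = ℕ.n≢0⇒n>0 (≢-nonZero⁻¹ m)
  odd : 1F ⊕ 1F ≢ 0F
  odd eq = contradiction (begin
    2                    ≡⟨ m<n⇒m%n≡m (s≤s (ℕ.+-mono-≤ 0<m 0<m)) ⟨
    2 % suc (m + m)      ≡⟨ toℕ-[] 2 ⟨
    toℕ [ 2 ]            ≡⟨ cong toℕ (trans (sym ([]-+ 1 1)) eq) ⟩
    toℕ 0F               ≡⟨ toℕ-[] 0 ⟩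
    0                    ∎) λ ()

count-connected : ∀ m .{{_ : NonZero m}} {p} → p ≡ suc (m + m) → (𝔽 : FieldStructure p) →
  FieldStructure.OddCharacteristic 𝔽 → FieldStructure.AgreesWithDefs 𝔽 →
  Σ ℕ λ N → NumConnCayleyUpToIso p N × (toℚ N ≡ N′ p - Nc′ p - toℚ 1)
count-connected m {p} p≡ 𝔽 odd agrees = length reps , Classification.classification 𝔽 odd agrees ,
  closed-formula m (length reps) ∣units∣≡m+m (sym suc∣units∣≡p) (OrbitCount.orbit-count 𝔽 m ∣units∣≡m+m)
  where
  open Configurations 𝔽 using (∣units∣; suc∣units∣≡∣els∣; representatives; module Transversal)
  open Transversal representatives using (reps)
  suc∣units∣≡p : suc ∣units∣ ≡ p
  suc∣units∣≡p = trans suc∣units∣≡∣els∣ (List.length-tabulate id)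
  ∣units∣≡m+m : ∣units∣ ≡ m + m
  ∣units∣≡m+m = ℕ.suc-injective (trans suc∣units∣≡p p≡)

theorem4p5 : (p : ℕ) → Prime p → ¬ (2 ∣ p) →
    Σ ℕ λ N → NumConnCayleyUpToIso p N × (toℚ N ≡ N′ p - Nc′ p - toℚ 1)
theorem4p5 p pr 2∤p =
  let m , m≢0 , p≡ = prime-odd pr 2∤p
      𝔽 , odd , agrees = odd-prime-field m {{m≢0}} p≡ pr
  in count-connected m {{m≢0}} p≡ 𝔽 odd agrees
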